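{- Let $B$ be a graphic matroid. Then the splitting matroid $B_X$ is a binary gammoid for every $X \subseteq E(B)$ with $|X| \geq 2$ if and only if $B$ has no minor isomorphic to $M(Q_i)$ for any $i \in \{1,2,3,4\}$, where $Q_1,\dots,Q_4$ are the graphs described below.
   Context: Splitting: let $B$ be a binary matroid represented over $GF(2)$ by a matrix $A$, and let $X \subseteq E(B)$. Let $A_X$ be the matrix obtained from $A$ by appending a new last row with entry $1$ in the columns of the elements of $X$ and $0$ elsewhere. The splitting matroid is $B_X = M(A_X)$. A binary gammoid is a matroid that is both binary and a gammoid (equivalently, a matroid with no minor isomorphic to $U_{2,4}$ or $M(K_4)$). $M(G)$ denotes the cycle matroid of a graph $G$. The graphs: $Q_1 = K_4$. $Q_2$ has vertices $t,a,b$ and six edges: two parallel edges between $t$ and $a$, two parallel edges between $t$ and $b$, one edge between $a$ and $b$, and a loop at $t$. $Q_3$ has vertices $t,a,b$ and six edges: two parallel edges between $t$ and $a$, two parallel edges between $t$ and $b$, one edge between $a$ and $b$, and a loop at $b$. $Q_4$ has vertices $t,a,b$ and six edges: two parallel edges between each of the pairs $\{t,a\}$, $\{t,b\}$, $\{a,b\}$. -}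

module Defs where

open import Data.Nat using (ℕ; zero; suc; _≤_)
open import Data.Fin using (Fin; zero; suc; fromℕ; inject₁)
open import Data.Fin.Subset using (Subset; _∈_; _∉_; _⊆_; _∪_; ∣_∣)
open import Data.Vec using (Vec; []; _∷_; replicate; zipWith; _∷ʳ_; lookup)
open import Data.Bool using (Bool; true; false; if_then_else_; _xor_)
open import Data.Product using (Σ; _×_; _,_; ∃)
open import Data.Sum using (_⊎_)
open import Data.List using (List; []; _∷_; last)
open import Data.List.Relation.Unary.Unique.Propositional using (Unique)
open import Data.List.Membership.Propositional using () renaming (_∈_ to _∈ₗ_)
open import Data.Maybe using (just)
open import Data.Empty using (⊥)
open import Relation.Binary.PropositionalEquality using (_≡_)
open import Relation.Nullary using (¬_)
open import Function.Bundles using (_⇔_)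
open import Function.Definitions using (Injective)

-- Finite matroids on the ground set Fin size, given by their independent
-- sets.  (Every object to which this is applied below is a genuine
-- matroid: a vector matroid over GF(2) or a cycle matroid of a graph.)

record Matroid : Set₁ where
  field
    size  : ℕ
    Indep : Subset size → Set
open Matroid public

-- Matrices over GF(2) = Bool with xor, given by their columns.

colSum : ∀ {n r} → (Fin n → Vec Bool r) → Subset n → Vec Bool r
colSum {zero}  {r} A []      = replicate r false
colSum {suc n} {r} A (b ∷ T) =
  zipWith _xor_ (if b then A zero else replicate r false) (colSum (λ j → A (suc j)) T)

MatIndep : ∀ {n r} → (Fin n → Vec Bool r) → Subset n → Set
MatIndep {n} {r} A I =
  ∀ (T : Subset n) → T ⊆ I → colSum A T ≡ replicate r false → T ≡ replicate n false

vecMatroid : ∀ {n r} → (Fin n → Vec Bool r) → Matroid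
vecMatroid {n} A = record { size = n ; Indep = MatIndep A }

Represents : ∀ {r} (M : Matroid) → (Fin (size M) → Vec Bool r) → Set
Represents M A = ∀ (I : Subset (size M)) → Indep M I ⇔ MatIndep A I

Binary : Matroid → Set
Binary M = Σ ℕ λ r → Σ (Fin (size M) → Vec Bool r) λ A → Represents M A

splitMatrix : ∀ {n r} → (Fin n → Vec Bool r) → Subset n → (Fin n → Vec Bool (suc r))
splitMatrix A X j = A j ∷ʳ lookup X j

splitting : ∀ {n r} → (Fin n → Vec Bool r) → Subset n → Matroid
splitting A X = vecMatroid (splitMatrix A X)

record Graph : Set where
  field
    nV   : ℕ
    nE   : ℕ
    ends : Fin nE → Fin nV × Fin nV
open Graph public

Joins : (G : Graph) → Fin (nE G) → Fin (nV G) → Fin (nV G) → Set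
Joins G e x y = (ends G e ≡ (x , y)) ⊎ (ends G e ≡ (y , x))

record CycleIn (G : Graph) (I : Subset (nE G)) : Set where
  field
    k      : ℕ
    vs     : Fin (suc k) → Fin (nV G)
    es     : Fin (suc k) → Fin (nE G)
    vsInj  : Injective _≡_ _≡_ vs
    esInj  : Injective _≡_ _≡_ es
    inI    : ∀ i → es i ∈ I
    step   : ∀ (i : Fin k) → Joins G (es (inject₁ i)) (vs (inject₁ i)) (vs (suc i))
    close  : Joins G (es (fromℕ k)) (vs (fromℕ k)) (vs zero)

cycleMatroid : Graph → Matroid
cycleMatroid G = record { size = nE G ; Indep = λ I → ¬ CycleIn G I }

-- I is independent in M / C (a subset of E(M) - C whose union with some
-- (equivalently any) basis J of C is independent in M).
ContrIndep : (M : Matroid) → Subset (size M) → Subset (size M) → Set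
ContrIndep M C I =
  (∀ e → e ∈ I → e ∉ C) ×
  Σ (Subset (size M)) λ J →
    J ⊆ C × Indep M J ×
    (∀ J′ → J′ ⊆ C → Indep M J′ → ∣ J′ ∣ ≤ ∣ J ∣) ×
    Indep M (I ∪ J)

-- M has a minor isomorphic to N: there are an injection f : E(N) → E(M)
-- and a set C ⊆ E(M) disjoint from the image of f such that f is an
-- isomorphism from N onto M / C \ D, where D = E(M) - C - f(E(N)).
HasMinor : (N M : Matroid) → Set
HasMinor N M =
  Σ (Fin (size N) → Fin (size M)) λ f →
  Injective _≡_ _≡_ f ×
  Σ (Subset (size M)) λ C →
    (∀ x → f x ∉ C) ×
    (∀ (I : Subset (size N)) (J : Subset (size M)) →
       (∀ j → j ∈ J ⇔ (Σ (Fin (size N)) λ x → x ∈ I × f x ≡ j)) →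
       (Indep N I ⇔ ContrIndep M C J))

data IsWalk {v : ℕ} (Arc : Fin v → Fin v → Bool) : List (Fin v) → Set where
  single : ∀ x → IsWalk Arc (x ∷ [])
  step   : ∀ x y ps → Arc x y ≡ true → IsWalk Arc (y ∷ ps) → IsWalk Arc (x ∷ y ∷ ps)

PathInto : {v : ℕ} → (Fin v → Fin v → Bool) → Fin v → Subset v → List (Fin v) → Set
PathInto {v} Arc a T p =
  Σ (List (Fin v)) λ ps → p ≡ a ∷ ps ×
  IsWalk Arc p × Unique p ×
  Σ (Fin v) λ t → last p ≡ just t × t ∈ T

Linked : {n v : ℕ} → (Fin v → Fin v → Bool) → (Fin n → Fin v) → Subset v → Subset n → Set
Linked {n} {v} Arc emb T I =
  Σ (Fin n → List (Fin v)) λ P →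
    (∀ e → e ∈ I → PathInto Arc (emb e) T (P e)) ×
    (∀ e e′ → e ∈ I → e′ ∈ I → ¬ (e ≡ e′) →
       ∀ x → x ∈ₗ P e → x ∈ₗ P e′ → ⊥)


Gammoid : Matroid → Set
Gammoid M =
  Σ ℕ λ v → Σ (Fin v → Fin v → Bool) λ Arc →
  Σ (Fin (size M) → Fin v) λ emb → Injective _≡_ _≡_ emb ×
  Σ (Subset v) λ T →
    ∀ (I : Subset (size M)) → Indep M I ⇔ Linked Arc emb T I

BinaryGammoid : Matroid → Set
BinaryGammoid M = Binary M × Gammoid M

-- Q₁ = K₄
Q₁ : Graph
Q₁ = record { nV = 4 ; nE = 6 ; ends = e }
  where
  e : Fin 6 → Fin 4 × Fin 4
  e zero = (zero , suc zero)
  e (suc zero) = (zero , suc (suc zero))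
  e (suc (suc zero)) = (zero , suc (suc (suc zero)))
  e (suc (suc (suc zero))) = (suc zero , suc (suc zero))
  e (suc (suc (suc (suc zero)))) = (suc zero , suc (suc (suc zero)))
  e (suc (suc (suc (suc (suc zero))))) = (suc (suc zero) , suc (suc (suc zero)))

private
  t a b : Fin 3
  t = zero
  a = suc zero
  b = suc (suc zero)

Qtab : (Fin 3 × Fin 3) → Graph
Qtab sixth = record { nV = 3 ; nE = 6 ; ends = e }
  where
  e : Fin 6 → Fin 3 × Fin 3
  e zero = (t , a)
  e (suc zero) = (t , a)
  e (suc (suc zero)) = (t , b)
  e (suc (suc (suc zero))) = (t , b)
  e (suc (suc (suc (suc zero)))) = (a , b)
  e (suc (suc (suc (suc (suc zero))))) = sixth

Q₂ Q₃ Q₄ : Graph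
Q₂ = Qtab (t , t)
Q₃ = Qtab (b , b)
Q₄ = Qtab (a , b)

Q : Fin 4 → Graph
Q zero = Q₁
Q (suc zero) = Q₂
Q (suc (suc zero)) = Q₃
Q (suc (suc (suc zero))) = Q₄

{-# OPTIONS --safe #-}

-- The cycle space K of a representation A determines the matroid, and the
-- cycle space of the splitting B_X is the part of K meeting X evenly.  So B
-- is obtained from an extension of B_X by one vector p on contracting p.  If
-- B_X has a minor M(K₄), the corresponding minor of B is therefore M(K₄)
-- itself or comes from M(K₄) by adding a point p of the Fano plane and
-- contracting it: M(Q₂) ≅ M(Q₃) if p is one of the six points, M(Q₄) if it
-- is the seventh.  Conversely each M(Qᵢ) splits to M(K₄).
--
-- It remains to see that a binary matroid is a gammoid iff it has no minor
-- M(K₄).  By Ingleton–Piff duality a gammoid is described by matchings, in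
-- which contraction is just removal of vertices; Hall's theorem applied to
-- the four triangles of K₄ yields sets whose sizes violate an
-- inclusion–exclusion count.  In the other direction, loops, coloops,
-- parallel and series elements can be added to a gammoid, and a nonempty
-- simple and cosimple binary matroid has a minor M(K₄): if no single
-- deletion or contraction is again simple and cosimple, then every element
-- lies in a triangle and in a triad, and a triangle e f g with a triad e f h
-- leads to M(K₄) or to the smaller matroid M / e \ f.
module Submission where

open import Defs
open import Data.Nat using (ℕ; zero; suc; _+_; _∸_; _≤_; _<_; z≤n; s≤s)
import Data.Nat.Properties as ℕ
open import Data.Nat.Induction using (<-wellFounded; Acc; acc)
open import Data.Nat.Solver using (module +-*-Solver)
open import Data.Fin using (Fin; zero; suc; toℕ; fromℕ; inject₁; #_)
import Data.Fin.Properties as Fin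
open import Data.Fin.Subset using (Subset; _∈_; _∉_; _⊆_; _∪_; ∣_∣; ⁅_⁆)
open import Data.Fin.Subset.Properties using (anySubset?; _∈?_; _⊆?_; p⊂q⇒∣p∣<∣q∣; ∣p∣≤n; p⊆p∪q; q⊆p∪q; x∈p∪q⁻; x∈p∪q⁺; x∈⁅x⁆; x∈⁅y⁆⇒x≡y; ∣⁅x⁆∣≡1)
open import Data.Vec using (Vec; []; _∷_; _∷ʳ_; lookup; replicate; tabulate; zipWith; here; there)
import Data.Vec.Properties as Vec
open import Data.Vec.Relation.Unary.All using ([]; _∷_)
open import Data.Vec.Relation.Unary.AllPairs using ([]; _∷_)
open import Data.Vec.Relation.Unary.Unique.Propositional using () renaming (Unique to UniqueVec)
open import Data.Vec.Relation.Unary.Unique.Propositional.Properties using (lookup-injective)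
open import Data.Bool using (Bool; true; false; _∧_; _∨_; not; _xor_; if_then_else_)
import Data.Bool.Properties as Bool
open import Data.Bool.Solver using (module xor-∧-Solver)
open import Data.Product using (Σ; _×_; _,_; ∃; ∃₂; proj₁; proj₂)
open import Data.Sum using (_⊎_; inj₁; inj₂; [_,_]′)
open import Data.List using (List; []; _∷_; last; length; map)
open import Data.List.Properties using (length-map)
open import Data.List.Relation.Unary.Unique.Propositional using (Unique; []; _∷_)
open import Data.List.Relation.Unary.Unique.DecPropositional using (unique?)
open import Data.List.Relation.Unary.Unique.Propositional.Properties using () renaming (map⁺ to Unique-map⁺)
open import Data.List.Relation.Unary.All as All using (All; []; _∷_)
open import Data.List.Relation.Unary.All.Properties using () renaming (map⁺ to All-map⁺)
open import Data.List.Relation.Unary.Any using (Any; here; there; any?; satisfied)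
open import Data.List.Membership.Propositional using () renaming (_∈_ to _∈ₗ_)
import Data.List.Membership.DecPropositional as DecMem
open import Data.Maybe using (just)
open import Data.Maybe.Properties using (just-injective)
open import Data.Empty using (⊥; ⊥-elim)
open import Relation.Binary.PropositionalEquality using (_≡_; _≢_; refl; sym; trans; cong; cong₂; subst; subst₂; ≢-sym; module ≡-Reasoning)
open import Relation.Nullary using (¬_; Dec; yes; no; contradiction; does)
open import Relation.Nullary.Decidable using (_×-dec_; _⊎-dec_; _→-dec_; ¬?; dec-true; dec-false; toWitness; True; map′; decidable-stable)
open import Function using (_∘_; id)
open import Function.Bundles using (_⇔_; mk⇔; Equivalence)
open import Function.Definitions using (Injective)

-- Minors live on the fixed ground set, as a cycle space together with the elements contracted and
-- deleted, so one choice of six elements and of a contracted set can be read both in B and in B_X.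
-- If it gives M(K₄) in B_X, its cycle space in B contains that of K₄ with index at most two,
-- because two cycles that meet X oddly have a sum that meets X evenly. Such a space consists of the
-- edge sets whose boundary in GF(2)⁴ is zero or one fixed even vector p. For a gammoid, contraction
-- by C means that the vertices of a basis of C stay occupied, so that a flow has one more set to
-- avoid. Each Hall violator bounds an excess |N| - |S| from above, and each independent set of
-- edges bounds the excess of a lattice combination of the violators from below; together these
-- bounds are incompatible. In the descent, contracting e from a triangle e f g makes f and g
-- parallel, and deleting f from a triad e f h puts e and h in series. The two repairs agree:
-- contract e and delete f.

-- Linkings as flows

-- A vertex-disjoint linking seen as its successor function: vertices off
-- the linking are fixed, and only vertices outside the target set T need a
-- successor.  A linking from F exists iff such a function avoids F; this is
-- the Ingleton–Piff duality between strict gammoids and transversal matroids.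
record Flow {v : ℕ} (Arc : Fin v → Fin v → Bool) (T : Fin v → Set) (F : Fin v → Set) : Set where
  field
    next  : Fin v → Fin v
    arc   : ∀ x → ¬ T x → x ≡ next x ⊎ Arc x (next x) ≡ true
    inj   : ∀ x y → ¬ T x → ¬ T y → next x ≡ next y → x ≡ y
    avoid : ∀ x → ¬ T x → ¬ F (next x)

Flow-mono : ∀ {v} {Arc : Fin v → Fin v → Bool} {T F F′ : Fin v → Set} →
            (∀ y → F y → F′ y) → Flow Arc T F′ → Flow Arc T F
Flow-mono F⊆F′ φ = record { next = next ; arc = arc ; inj = inj ; avoid = λ x x∉T → avoid x x∉T ∘ F⊆F′ _ }
  where open Flow φ

data Succ {v : ℕ} : List (Fin v) → Fin v → Fin v → Set where
  here  : ∀ {x y ps} → Succ (x ∷ y ∷ ps) x y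
  there : ∀ {x y z ps} → Succ ps x y → Succ (z ∷ ps) x y

Sources : ∀ {n v} → (Fin n → Fin v) → Subset n → Fin v → Set
Sources emb I y = ∃ λ e → e ∈ I × emb e ≡ y

Succ-source : ∀ {v} {p} {x y : Fin v} → Succ p x y → x ∈ₗ p
Succ-source here = here refl
Succ-source (there s) = there (Succ-source s)

Succ-target : ∀ {v} {ps} {z x y : Fin v} → Succ (z ∷ ps) x y → y ∈ₗ ps
Succ-target here = here refl
Succ-target (there s@here) = there (Succ-target s)
Succ-target (there s@(there _)) = there (Succ-target s)

Succ-injective : ∀ {v} {p} {x x′ y : Fin v} → Unique p → Succ p x y → Succ p x′ y → x ≡ x′
Succ-injective u here here = refl
Succ-injective (_ ∷ (a ∷ _)) here (there s)  = contradiction refl (All.lookup a (Succ-target s))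
Succ-injective (_ ∷ (a ∷ _)) (there s)  here = contradiction refl (All.lookup a (Succ-target s))
Succ-injective (_ ∷ u) (there s)  (there s′) = Succ-injective u s s′

Succ-arc : ∀ {v} {Arc p} {x y : Fin v} → IsWalk Arc p → Succ p x y → Arc x y ≡ true
Succ-arc (step x y ps a w) here = a
Succ-arc (step x y ps a w) (there s) = Succ-arc w s
Succ-arc (single x) (there ())

last-or-Succ : ∀ {v} {p} {x t : Fin v} → x ∈ₗ p → last p ≡ just t → x ≡ t ⊎ ∃ (Succ p x)
last-or-Succ {p = _ ∷ []} (here refl) l = inj₁ (just-injective l)
last-or-Succ {p = _ ∷ _ ∷ _} (here refl) l = inj₂ (_ , here)
last-or-Succ {p = _ ∷ _ ∷ _} (there x∈p) l with last-or-Succ x∈p l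
... | inj₁ x≡t = inj₁ x≡t
... | inj₂ (y , s) = inj₂ (y , there s)

module _ {n v : ℕ} (Arc : Fin v → Fin v → Bool) (emb : Fin n → Fin v) (T : Subset v) (I : Subset n) where

  linked⇒flow : Linked Arc emb T I → Flow Arc (_∈ T) (Sources emb I)
  linked⇒flow (P , path , disj) = record
    { next  = next
    ; arc   = λ x x∉T → arc (next-Next x x∉T)
    ; inj   = λ x y x∉T y∉T eq → inj (next-Next x x∉T) (subst (Next y) (sym eq) (next-Next y y∉T))
    ; avoid = λ x x∉T → avoid (next-Next x x∉T)
    }
    where
    open DecMem Fin._≟_ using () renaming (_∈?_ to _∈ₗ?_)

    On : Fin v → Set
    On x = ∃ λ e → e ∈ I × x ∈ₗ P e

    Next : Fin v → Fin v → Set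
    Next x y = (∃ λ e → e ∈ I × Succ (P e) x y) ⊎ (x ≡ y × ¬ On x)

    successor : ∀ x → x ∈ T ⊎ ∃ (Next x)
    successor x with Fin.any? (λ e → (e ∈? I) ×-dec (x ∈ₗ? P e))
    ... | no off = inj₂ (x , inj₂ (refl , off))
    ... | yes (e , e∈I , x∈P) with path e e∈I
    ...   | _ , _ , _ , _ , t , l , t∈T with last-or-Succ x∈P l
    ... | inj₁ refl = inj₁ t∈T
    ... | inj₂ (y , s) = inj₂ (y , inj₁ (e , e∈I , s))

    next : Fin v → Fin v
    next x with successor x
    -- Here `x` ends a path and so lies in `T`, where a flow is unconstrained; the value is only a
    -- default.
    ... | inj₁ _ = x
    ... | inj₂ (y , _) = y

    next-Next : ∀ x → x ∉ T → Next x (next x)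
    next-Next x x∉T with successor x
    ... | inj₁ x∈T = contradiction x∈T x∉T
    ... | inj₂ (y , s) = s

    on : ∀ {e x y} → e ∈ I → Succ (P e) x y → y ∈ₗ P e
    on {e} e∈I s with P e | path e e∈I
    ... | _ | _ , refl , _ = there (Succ-target s)

    arc : ∀ {x y} → Next x y → x ≡ y ⊎ Arc x y ≡ true
    arc (inj₂ (x≡y , _)) = inj₁ x≡y
    arc (inj₁ (e , e∈I , s)) with path e e∈I
    ... | _ , _ , w , _ = inj₂ (Succ-arc w s)

    inj : ∀ {x x′ y} → Next x y → Next x′ y → x ≡ x′
    inj (inj₂ (refl , _)) (inj₂ (refl , _)) = refl
    inj (inj₁ (e , e∈I , s)) (inj₂ (refl , off)) = contradiction (e , e∈I , on e∈I s) off
    inj (inj₂ (refl , off))  (inj₁ (e , e∈I , s))   = contradiction (e , e∈I , on e∈I s) off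
    inj (inj₁ (e , e∈I , s)) (inj₁ (e′ , e′∈I , s′)) with e Fin.≟ e′
    ... | no e≢e′  = ⊥-elim (disj e e′ e∈I e′∈I e≢e′ _ (on e∈I s) (on e′∈I s′))
    ... | yes refl with path e e∈I
    ...   | _ , _ , _ , u , _ = Succ-injective u s s′

    avoid : ∀ {x y} → Next x y → ¬ Sources emb I y
    avoid (inj₂ (refl , off)) (e , e∈I , refl) with path e e∈I
    ... | _ , eq , _ = off (e , e∈I , subst (emb e ∈ₗ_) (sym eq) (here refl))
    avoid (inj₁ (e , e∈I , s)) (e′ , e′∈I , refl) with e Fin.≟ e′
    ... | no e≢e′ with path e′ e′∈I
    ...   | _ , eq , _ = disj e e′ e∈I e′∈I e≢e′ _ (on e∈I s) (subst (emb e′ ∈ₗ_) (sym eq) (here refl))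
    avoid (inj₁ (e , e∈I , s)) (e , e∈I′ , refl) | yes refl with P e | path e e∈I
    ...   | _ | _ , refl , _ , (a ∷ _) , _ = All.lookup a (Succ-target s) refl

  flow⇒linked : Injective _≡_ _≡_ emb → Flow Arc (_∈ T) (Sources emb I) → Linked Arc emb T I
  flow⇒linked emb-inj φ = P , path , disj
    where
    open Flow φ

    orbit : ℕ → Fin v → Fin v
    orbit zero x = x
    orbit (suc k) x = next (orbit k x)

    Before : ℕ → Fin v → Set
    Before k x = ∀ i → i < k → orbit i x ∉ T

    -- Pulling a coincidence of two orbits back along the injective map
    -- next ends at a source, which is not a value of next.
    cancel : ∀ {x y} → Sources emb I x → Sources emb I y → ∀ i j → Before i x → Before j y →
             orbit i x ≡ orbit j y → i ≡ j × x ≡ y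
    cancel sx sy zero zero bi bj eq = refl , eq
    cancel sx sy zero (suc j) bi bj eq = ⊥-elim (avoid _ (bj j ℕ.≤-refl) (subst (Sources emb I) eq sx))
    cancel sx sy (suc i) zero bi bj eq = ⊥-elim (avoid _ (bi i ℕ.≤-refl) (subst (Sources emb I) (sym eq) sy))
    cancel sx sy (suc i) (suc j) bi bj eq
      with cancel sx sy i j (λ k k<i → bi k (ℕ.m≤n⇒m≤1+n k<i)) (λ k k<j → bj k (ℕ.m≤n⇒m≤1+n k<j))
                  (inj _ _ (bi i ℕ.≤-refl) (bj j ℕ.≤-refl) eq)
    ... | refl , refl = refl , refl

    Exit : Fin v → Set
    Exit x = ∃ λ k → orbit k x ∈ T × Before k x

    search : ∀ x k → Exit x ⊎ Before k x
    search x zero = inj₂ λ _ ()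
    search x (suc k) with search x k
    ... | inj₁ ex = inj₁ ex
    ... | inj₂ b with orbit k x ∈? T
    ...   | yes t = inj₁ (k , t , b)
    ...   | no ¬t = inj₂ λ i i<1+k → extend i (ℕ.m≤n⇒m<n∨m≡n (ℕ.≤-pred i<1+k))
      where
      extend : ∀ i → i < k ⊎ i ≡ k → orbit i x ∉ T
      extend i (inj₁ i<k)  = b i i<k
      extend i (inj₂ refl) = ¬t

    -- An orbit whose first v + 1 points all lie outside `T` repeats a vertex by the pigeonhole
    -- principle, which `cancel` forbids.
    exit : ∀ {x} → Sources emb I x → Exit x
    exit {x} sx with search x (suc v)
    ... | inj₁ ex = ex
    ... | inj₂ b with Fin.pigeonhole (ℕ.n<1+n v) (λ i → orbit (toℕ i) x)
    ...   | i , j , i<j , eq = contradiction (proj₁ (cancel sx sx (toℕ i) (toℕ j) (before i) (before j) eq)) (ℕ.<⇒≢ i<j)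
      where
      before : ∀ (i : Fin (suc v)) → Before (toℕ i) x
      before i k k<i = b k (ℕ.<-trans k<i (Fin.toℕ<n i))

    run : ℕ → Fin v → List (Fin v)
    run zero x = x ∷ []
    run (suc k) x = x ∷ run k (next x)

    shift : ∀ k x → orbit k (next x) ≡ orbit (suc k) x
    shift zero x = refl
    shift (suc k) x = cong next (shift k x)

    ∈-run : ∀ k x {y} → y ∈ₗ run k x → ∃ λ i → i ≤ k × y ≡ orbit i x
    ∈-run zero x (here y≡x) = 0 , z≤n , y≡x
    ∈-run (suc k) x (here y≡x) = 0 , z≤n , y≡x
    ∈-run (suc k) x (there y∈) with ∈-run k (next x) y∈
    ... | i , i≤k , refl = suc i , s≤s i≤k , shift i x

    last-run : ∀ k x → last (run k x) ≡ just (orbit k x)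
    last-run zero x = refl
    last-run (suc zero) x = refl
    last-run (suc (suc k)) x = trans (last-run (suc k) (next x)) (cong just (shift (suc k) x))

    run-head : ∀ k x → ∃ λ ps → run k x ≡ x ∷ ps
    run-head zero x = _ , refl
    run-head (suc k) x = _ , refl

    Inj-below : ℕ → Fin v → Set
    Inj-below k x = ∀ i j → i ≤ k → j ≤ k → orbit i x ≡ orbit j x → i ≡ j

    tail-before : ∀ {k x} → Before (suc k) x → Before k (next x)
    tail-before {x = x} b i i<k = subst (_∉ T) (sym (shift i x)) (b (suc i) (s≤s i<k))

    tail-inj : ∀ {k x} → Inj-below (suc k) x → Inj-below k (next x)
    tail-inj {x = x} d i j i≤k j≤k eq =
      ℕ.suc-injective (d (suc i) (suc j) (s≤s i≤k) (s≤s j≤k) (trans (sym (shift i x)) (trans eq (shift j x))))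

    run-walk : ∀ k x → Before k x → Inj-below k x → IsWalk Arc (run k x)
    run-walk zero x b d = single x
    run-walk (suc k) x b d with run k (next x) | run-head k (next x) | run-walk k (next x) (tail-before b) (tail-inj d)
    ... | _ | ps , refl | w with arc x (b 0 (s≤s z≤n))
    ...   | inj₂ a  = step x (next x) ps a w
    -- A flow may fix a vertex, but on this orbit that would repeat a point.
    ...   | inj₁ eq = contradiction (d 0 1 z≤n (s≤s z≤n) eq) λ ()

    run-unique : ∀ k x → Inj-below k x → Unique (run k x)
    run-unique zero x d = [] ∷ []
    run-unique (suc k) x d = All.tabulate fresh ∷ run-unique k (next x) (tail-inj d)
      where
      fresh : ∀ {y} → y ∈ₗ run k (next x) → x ≢ y
      fresh y∈ x≡y with ∈-run k (next x) y∈
      ... | i , i≤k , refl = contradiction (d 0 (suc i) z≤n (s≤s i≤k) (trans x≡y (shift i x))) λ ()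

    source : ∀ {e} → e ∈ I → Sources emb I (emb e)
    source e∈I = _ , e∈I , refl

    P : Fin n → List (Fin v)
    P e with e ∈? I
    ... | yes e∈I = run (proj₁ (exit (source e∈I))) (emb e)
    ... | no _ = []

    below : ∀ {k i x} → i ≤ k → Before k x → Before i x
    below i≤k b j j<i = b j (ℕ.≤-trans j<i i≤k)

    path : ∀ e → e ∈ I → PathInto Arc (emb e) T (P e)
    path e e∈I with e ∈? I
    ... | no e∉I = contradiction e∈I e∉I
    ... | yes e∈I′ with exit (source e∈I′)
    ...   | k , t , b = proj₁ (run-head k (emb e)) , proj₂ (run-head k (emb e)) ,
                        run-walk k (emb e) b d , run-unique k (emb e) d ,
                        orbit k (emb e) , last-run k (emb e) , t
      where
      d : Inj-below k (emb e)
      d i j i≤k j≤k eq = proj₁ (cancel (source e∈I) (source e∈I) i j (below i≤k b) (below j≤k b) eq)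

    disj : ∀ e e′ → e ∈ I → e′ ∈ I → ¬ (e ≡ e′) → ∀ x → x ∈ₗ P e → x ∈ₗ P e′ → ⊥
    disj e e′ e∈I e′∈I e≢e′ x x∈ x∈′ with e ∈? I | e′ ∈? I
    ... | no e∉I   | _ = e∉I e∈I
    ... | yes _ | no e′∉I   = e′∉I e′∈I
    ... | yes i | yes i′ with exit (source i) | exit (source i′)
    ...   | k , _ , b | k′ , _ , b′ with ∈-run k _ x∈ | ∈-run k′ _ x∈′
    ... | j , j≤k , refl | j′ , j′≤k′ , eq =
      e≢e′ (emb-inj (proj₂ (cancel (source i) (source i′) j j′ (below j≤k b) (below j′≤k′ b′) eq)))

infix 4 _≟ₛ_
_≟ₛ_ : ∀ {n} (S T : Vec Bool n) → Dec (S ≡ T)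
_≟ₛ_ = Vec.≡-dec Bool._≟_

allSubset? : ∀ {n} {P : Subset n → Set} → (∀ T → Dec (P T)) → Dec (∀ T → P T)
allSubset? P? = map′ (λ ¬∃ T → decidable-stable (P? T) λ ¬P → ¬∃ (T , ¬P)) (λ all (T , ¬P) → ¬P (all T))
                     (¬? (anySubset? (¬? ∘ P?)))

-- Counting

bit : Bool → ℕ
bit false = 0
bit true  = 1

count : ∀ {n} → (Fin n → Bool) → ℕ
count {zero}  p = 0
count {suc n} p = bit (p zero) + count (p ∘ suc)

infixl 5 _∖_
_∖_ : ∀ {n} → (Fin n → Bool) → Fin n → Fin n → Bool
(p ∖ x) i = p i ∧ not (does (i Fin.≟ x))

∖-intro : ∀ {n} (p : Fin n → Bool) x {i} → p i ≡ true → i ≢ x → (p ∖ x) i ≡ true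
∖-intro p x {i} pi i≢x rewrite pi | dec-false (i Fin.≟ x) i≢x = refl

count-cong : ∀ {n} {p q : Fin n → Bool} → (∀ i → p i ≡ q i) → count p ≡ count q
count-cong {zero}  e = refl
count-cong {suc n} e = cong₂ _+_ (cong bit (e zero)) (count-cong (e ∘ suc))

count-∖ : ∀ {n} (p : Fin n → Bool) x → p x ≡ true → count p ≡ suc (count (p ∖ x))
count-∖ p zero px rewrite px = cong suc (count-cong {p = p ∘ suc} λ i → sym (Bool.∧-identityʳ _))
count-∖ p (suc x) px = trans (cong₂ _+_ (cong bit (sym (Bool.∧-identityʳ (p zero)))) (count-∖ (p ∘ suc) x px)) (ℕ.+-suc _ _)

count-inj : ∀ {a b} (p : Fin a → Bool) (q : Fin b → Bool) (m : Fin a → Fin b) →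
            (∀ x → p x ≡ true → q (m x) ≡ true) →
            (∀ x y → p x ≡ true → p y ≡ true → m x ≡ m y → x ≡ y) → count p ≤ count q
count-inj {zero}  p q m maps inj = z≤n
count-inj {suc a} p q m maps inj with p zero in p0
... | false = count-inj (p ∘ suc) q (m ∘ suc) (λ x → maps (suc x))
                (λ x y px py e → Fin.suc-injective (inj (suc x) (suc y) px py e))
... | true  = subst (suc (count (p ∘ suc)) ≤_) (sym (count-∖ q (m zero) (maps zero p0)))
                (s≤s (count-inj (p ∘ suc) (q ∖ m zero) (m ∘ suc)
                  (λ x px → ∖-intro q (m zero) (maps (suc x) px) (λ e → Fin.0≢1+n (sym (inj (suc x) zero px p0 e))))
                  (λ x y px py e → Fin.suc-injective (inj (suc x) (suc y) px py e))))

count-mono : ∀ {n} {p q : Fin n → Bool} → (∀ i → p i ≡ true → q i ≡ true) → count p ≤ count q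
count-mono p⊆q = count-inj _ _ id p⊆q (λ _ _ _ _ e → e)

-- The points of `q` missed by the injection are what supplies the rank terms in `bound`.
count-inj-avoiding : ∀ {a b} (p : Fin a → Bool) (q : Fin b → Bool) (m : Fin a → Fin b) →
  (∀ x → p x ≡ true → q (m x) ≡ true) →
  (∀ x y → p x ≡ true → p y ≡ true → m x ≡ m y → x ≡ y) →
  (ys : List (Fin b)) → Unique ys → All (λ y → q y ≡ true) ys →
  All (λ y → ∀ x → p x ≡ true → m x ≢ y) ys → count p + length ys ≤ count q
count-inj-avoiding p q m maps inj [] u qs av = subst (_≤ count q) (sym (ℕ.+-identityʳ _)) (count-inj p q m maps inj)
count-inj-avoiding p q m maps inj (y ∷ ys) (y∉ ∷ u) (qy ∷ qs) (av ∷ avs) =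
  subst₂ _≤_ (sym (ℕ.+-suc _ _)) (sym (count-∖ q y qy))
    (s≤s (count-inj-avoiding p (q ∖ y) m
      (λ x px → ∖-intro q y (maps x px) (av x px)) inj ys u
      (All.zipWith (λ { (y≢z , qz) → ∖-intro q y qz (y≢z ∘ sym) }) (y∉ , qs)) avs))

interchange : ∀ a b c d → (a + b) + (c + d) ≡ (a + c) + (b + d)
interchange = solve 4 (λ a b c d → (a :+ b) :+ (c :+ d) := (a :+ c) :+ (b :+ d)) refl
  where open +-*-Solver

count-∨∧ : ∀ {n} (p q : Fin n → Bool) →
           count (λ i → p i ∨ q i) + count (λ i → p i ∧ q i) ≡ count p + count q
count-∨∧ {zero}  p q = refl
count-∨∧ {suc n} p q = begin
  (a + A) + (b + B) ≡⟨ interchange a A b B ⟩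
  (a + b) + (A + B) ≡⟨ cong₂ _+_ (head (p zero) (q zero)) (count-∨∧ (p ∘ suc) (q ∘ suc)) ⟩
  (bit (p zero) + bit (q zero)) + (count (p ∘ suc) + count (q ∘ suc)) ≡⟨ interchange (bit (p zero)) (bit (q zero)) _ _ ⟩
  count p + count q ∎
  where
  open ≡-Reasoning
  a = bit (p zero ∨ q zero)
  b = bit (p zero ∧ q zero)
  A = count (λ i → p (suc i) ∨ q (suc i))
  B = count (λ i → p (suc i) ∧ q (suc i))
  head : ∀ x y → bit (x ∨ y) + bit (x ∧ y) ≡ bit x + bit y
  head false y = ℕ.+-identityʳ _
  head true  false = refl
  head true  true  = refl

count-insert : ∀ {n} (p : Fin n → Bool) x → count (λ i → p i ∨ does (i Fin.≟ x)) ≤ suc (count p)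
count-insert p x = subst (_≤ suc (count p)) (sym (count-∖ _ x (trans (cong (p x ∨_) (dec-true (x Fin.≟ x) refl)) (Bool.∨-zeroʳ (p x)))))
  (s≤s (count-mono back))
  where
  back : ∀ i → (p i ∨ does (i Fin.≟ x)) ∧ not (does (i Fin.≟ x)) ≡ true → p i ≡ true
  back i with p i | does (i Fin.≟ x)
  ... | true  | _ = λ _ → refl
  ... | false | true  = λ ()
  ... | false | false = λ ()

-- Hall's theorem

record Matching {w v} (W : Fin w → Bool) (R : Fin w → Fin v → Bool) : Set where
  constructor matching
  field
    match : Fin w → Fin v
    rel   : ∀ x → W x ≡ true → R x (match x) ≡ true
    inj   : ∀ x y → W x ≡ true → W y ≡ true → match x ≡ match y → x ≡ y

-- `N` may exceed the neighbourhood of `S`. This slack is needed for intersections: the intersection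
-- of two neighbourhoods can be larger than the neighbourhood of the intersection.
record Closed {w v} (W : Fin w → Bool) (R : Fin w → Fin v → Bool) : Set where
  constructor closed
  field
    S   : Fin w → Bool
    N   : Fin v → Bool
    S⊆W : ∀ x → S x ≡ true → W x ≡ true
    nbr : ∀ x y → S x ≡ true → R x y ≡ true → N y ≡ true

Tight Violator : ∀ {w v} (W : Fin w → Bool) (R : Fin w → Fin v → Bool) → Set
Tight W R = Σ (Closed W R) λ c → count (Closed.N c) ≤ count (Closed.S c)
Violator W R = Σ (Closed W R) λ c → count (Closed.N c) < count (Closed.S c)

does⇒ : ∀ {P : Set} (d : Dec P) → does d ≡ true → P
does⇒ (yes p) _ = p

∧-split : ∀ {a b} → a ∧ b ≡ true → a ≡ true × b ≡ true
∧-split {true} {true} refl = refl , refl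

∨-split : ∀ {a b} → a ∨ b ≡ true → a ≡ true ⊎ b ≡ true
∨-split {true}  _ = inj₁ refl
∨-split {false} e = inj₂ e

∨-introˡ : ∀ {a b} → a ≡ true → a ∨ b ≡ true
∨-introˡ refl = refl

∨-introʳ : ∀ {a b} → b ≡ true → a ∨ b ≡ true
∨-introʳ {a} refl = Bool.∨-zeroʳ a

∧-intro : ∀ {a b} → a ≡ true → b ≡ true → a ∧ b ≡ true
∧-intro refl refl = refl

-- Uncrossing: if the intersection is no violator, it has at least as many neighbours as elements,
-- and subtracting it from the modular counts of both sides leaves a tight union.
tight-∪ : ∀ {w v} {W : Fin w → Bool} {R : Fin w → Fin v → Bool} (s t : Tight W R) →
          Violator W R ⊎ Σ (Tight W R) λ u → ∀ y →
            Closed.N (proj₁ s) y ≡ true ⊎ Closed.N (proj₁ t) y ≡ true → Closed.N (proj₁ u) y ≡ true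
tight-∪ {W = W} {R} (closed S N S⊆W nbr , s≤) (closed S′ N′ S′⊆W nbr′ , t≤)
  with count (λ y → N y ∧ N′ y) ℕ.<? count (λ x → S x ∧ S′ x)
... | yes lt = inj₁ (closed _ _ (λ x sx → S⊆W x (proj₁ (∧-split sx)))
                 (λ x y sx r → ∧-intro (nbr x y (proj₁ (∧-split sx)) r) (nbr′ x y (proj₂ (∧-split {S x} sx)) r)) , lt)
... | no ¬lt = inj₂ ((closed (λ x → S x ∨ S′ x) (λ y → N y ∨ N′ y)
                 (λ x sx → [ S⊆W x , S′⊆W x ]′ (∨-split sx))
                 (λ x y sx r → [ (λ s → ∨-introˡ (nbr x y s r)) , (λ s → ∨-introʳ {N y} (nbr′ x y s r)) ]′ (∨-split sx))
               , ℕ.+-cancelʳ-≤ (count (λ x → S x ∧ S′ x)) _ _ le)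
               , λ y → [ ∨-introˡ , ∨-introʳ {N y} ]′)
  where
  open ℕ.≤-Reasoning
  le : count (λ y → N y ∨ N′ y) + count (λ x → S x ∧ S′ x) ≤ count (λ x → S x ∨ S′ x) + count (λ x → S x ∧ S′ x)
  le = begin
    count (λ y → N y ∨ N′ y) + count (λ x → S x ∧ S′ x) ≤⟨ ℕ.+-monoʳ-≤ (count (λ y → N y ∨ N′ y)) (ℕ.≮⇒≥ ¬lt) ⟩
    count (λ y → N y ∨ N′ y) + count (λ y → N y ∧ N′ y) ≡⟨ count-∨∧ N N′ ⟩
    count N + count N′ ≤⟨ ℕ.+-mono-≤ s≤ t≤ ⟩
    count S + count S′ ≡⟨ count-∨∧ S S′ ⟨
    count (λ x → S x ∨ S′ x) + count (λ x → S x ∧ S′ x) ∎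

count-∅ : ∀ n → count {n} (λ _ → false) ≡ 0
count-∅ zero = refl
count-∅ (suc n) = count-∅ n

-- In Hall's theorem the tight sets found for the single neighbours of a vertex must be merged into
-- one that covers them all; the empty set is tight and starts the union.
tight-⋃ : ∀ {w v} {W : Fin w → Bool} {R : Fin w → Fin v → Bool} (Y : Fin v → Bool) →
          (∀ y → Y y ≡ true → Σ (Tight W R) λ t → Closed.N (proj₁ t) y ≡ true) →
          ∀ k (g : Fin k → Fin v) →
          Violator W R ⊎ Σ (Tight W R) λ u → ∀ i → Y (g i) ≡ true → Closed.N (proj₁ u) (g i) ≡ true
tight-⋃ {w} {v} Y t zero g = inj₂ ((closed (λ _ → false) (λ _ → false) (λ _ ()) (λ _ _ ()) , ℕ.≤-reflexive (trans (count-∅ v) (sym (count-∅ w)))) , λ ())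
tight-⋃ Y t (suc k) g with tight-⋃ Y t k (g ∘ suc)
... | inj₁ viol = inj₁ viol
... | inj₂ (u , cov) with Y (g zero) in eq
...   | false = inj₂ (u , λ { zero Y0 → contradiction (trans (sym Y0) eq) λ () ; (suc i) → cov i })
...   | true with t (g zero) eq
... | s , sN with tight-∪ s u
... | inj₁ viol = inj₁ viol
... | inj₂ (u′ , sub) = inj₂ (u′ , λ { zero _ → sub _ (inj₁ sN) ; (suc i) Yi → sub _ (inj₂ (cov i Yi)) })

scan : ∀ {n} {A : Set} {B : Fin n → Set} → (∀ i → A ⊎ B i) → A ⊎ (∀ i → B i)
scan {zero}  h = inj₂ λ ()
scan {suc n} h with h zero | scan (h ∘ suc)
... | inj₁ a | _ = inj₁ a
... | inj₂ _ | inj₁ a = inj₁ a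
... | inj₂ b | inj₂ f = inj₂ λ { zero → b ; (suc i) → f i }

-- Match the first vertex to each of its neighbours y in turn.  When all of
-- these fail, the obstructions become tight sets once y is put back, and
-- the union of tight sets together with the first vertex violates Hall's
-- condition.
hall : ∀ {w v} (W : Fin w → Bool) (R : Fin w → Fin v → Bool) → (Fin w → Fin v) → Matching W R ⊎ Violator W R
hall {zero} W R d = inj₁ (matching (λ ()) (λ ()) (λ ()))
hall {suc w} {v} W R d with W zero in W0
... | false with hall (W ∘ suc) (R ∘ suc) (d ∘ suc)
...   | inj₁ (matching m rel inj) = inj₁ (matching (λ { zero → d zero ; (suc x) → m x })
          (λ { zero W0′ → contradiction (trans (sym W0′) W0) λ () ; (suc x) → rel x })
          (λ { zero _ W0′ _ _ → contradiction (trans (sym W0′) W0) λ ()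
             ; (suc x) zero _ W0′ _ → contradiction (trans (sym W0′) W0) λ ()
             ; (suc x) (suc y) Wx Wy e → cong suc (inj x y Wx Wy e) }))
...   | inj₂ (closed S N S⊆W nbr , lt) = inj₂ (closed (λ { zero → false ; (suc x) → S x }) N
          (λ { zero () ; (suc x) → S⊆W x }) (λ { zero _ () ; (suc x) → nbr x }) , lt)
hall {suc w} {v} W R d | true = result
  where
  R∖ : Fin v → Fin w → Fin v → Bool
  R∖ y x = R (suc x) ∖ y

  try : ∀ y → Matching W R ⊎ (R zero y ≡ true → Σ (Tight (W ∘ suc) (R ∘ suc)) λ t → Closed.N (proj₁ t) y ≡ true)
  try y with R zero y in r0
  ... | false = inj₂ λ ()
  ... | true with hall (W ∘ suc) (R∖ y) (d ∘ suc)
  ...   | inj₁ (matching m rel inj) = inj₁ (matching (λ { zero → y ; (suc x) → m x })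
            (λ { zero _ → r0 ; (suc x) Wx → proj₁ (∧-split (rel x Wx)) })
            (λ { zero zero _ _ _ → refl
               ; zero (suc x) _ Wx e → ⊥-elim (fresh x Wx (sym e))
               ; (suc x) zero Wx _ e → ⊥-elim (fresh x Wx e)
               ; (suc x) (suc x′) Wx Wx′ e → cong suc (inj x x′ Wx Wx′ e) }))
    where
    fresh : ∀ x → W (suc x) ≡ true → m x ≢ y
    fresh x Wx refl with m x Fin.≟ m x | proj₂ (∧-split {R (suc x) (m x)} (rel x Wx))
    ... | no ≢ | _ = ≢ refl
  ...   | inj₂ (closed S N S⊆W nbr , lt) = inj₂ λ _ →
            (closed S (λ z → N z ∨ does (z Fin.≟ y)) S⊆W nbr′ , ℕ.≤-trans (count-insert N y) lt) ,
            ∨-introʳ {N y} (dec-true (y Fin.≟ y) refl)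
    where
    nbr′ : ∀ x z → S x ≡ true → R (suc x) z ≡ true → N z ∨ does (z Fin.≟ y) ≡ true
    nbr′ x z sx r with z Fin.≟ y
    ... | yes _  = Bool.∨-zeroʳ (N z)
    ... | no z≢y = ∨-introˡ (nbr x z sx (∖-intro (R (suc x)) y r z≢y))

  result : Matching W R ⊎ Violator W R
  result with scan try
  ... | inj₁ m = inj₁ m
  ... | inj₂ tight with tight-⋃ (R zero) tight v id
  ...   | inj₁ (closed S N S⊆W nbr , lt) = inj₂ (closed (λ { zero → false ; (suc x) → S x }) N
            (λ { zero () ; (suc x) → S⊆W x }) (λ { zero _ () ; (suc x) → nbr x }) , lt)
  ...   | inj₂ ((closed S N S⊆W nbr , le) , cov) = inj₂ (closed (λ { zero → true ; (suc x) → S x }) N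
            (λ { zero _ → W0 ; (suc x) → S⊆W x }) (λ { zero y _ → cov y ; (suc x) → nbr x }) , s≤s le)

-- M(K₄) is not a gammoid

Σ-list : ∀ {A : Set} → (A → ℕ) → List A → ℕ
Σ-list f [] = 0
Σ-list f (x ∷ xs) = f x + Σ-list f xs

Σ-list-+ : ∀ {A : Set} (f g : A → ℕ) xs → Σ-list (λ x → f x + g x) xs ≡ Σ-list f xs + Σ-list g xs
Σ-list-+ f g [] = refl
Σ-list-+ f g (x ∷ xs) = trans (cong (f x + g x +_) (Σ-list-+ f g xs)) (interchange (f x) (g x) _ _)

Σ-list-mono : ∀ {A : Set} {f g : A → ℕ} {xs} → All (λ x → f x ≤ g x) xs → Σ-list f xs ≤ Σ-list g xs
Σ-list-mono [] = z≤n
Σ-list-mono (h ∷ hs) = ℕ.+-mono-≤ h (Σ-list-mono hs)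

-- The xor makes the column of a loop vanish.
incidence : (G : Graph) → Fin (nE G) → Vec Bool (nV G)
incidence G e = tabulate λ x → does (x Fin.≟ proj₁ (ends G e)) xor does (x Fin.≟ proj₂ (ends G e))

-- Terms rather than functions, because two facts are proved by induction on them: monotonicity, and
-- that a point of p(S) lies in some Sᵢ. The latter depends on the absence of constants and keeps
-- such points outside the target set `T`.
data Lattice : Set where
  var : Fin 4 → Lattice
  _⊓_ _⊔_ : Lattice → Lattice → Lattice

eval : Lattice → (Fin 4 → Bool) → Bool
eval (var i) ρ = ρ i
eval (p ⊓ q) ρ = eval p ρ ∧ eval q ρ
eval (p ⊔ q) ρ = eval p ρ ∨ eval q ρ

eval-mono : ∀ p {ρ ρ′} → (∀ i → ρ i ≡ true → ρ′ i ≡ true) → eval p ρ ≡ true → eval p ρ′ ≡ true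
eval-mono (var i) le e = le i e
eval-mono (p ⊓ q) {ρ} le e with ∧-split {eval p ρ} e
... | a , b = ∧-intro (eval-mono p le a) (eval-mono q le b)
eval-mono (p ⊔ q) {ρ} {ρ′} le e with ∨-split {eval p ρ} e
... | inj₁ a = ∨-introˡ (eval-mono p le a)
... | inj₂ b = ∨-introʳ {eval p ρ′} (eval-mono q le b)

-- For sets Sᵢ, Nᵢ with Nᵢ containing the triangle i and the neighbours of
-- Sᵢ, put δ(p) = |p(N)| − |p(S)|.  Then δ(xᵢ) ≤ 2, while δ(p) is at least the
-- rank of the edges found in p(N), listed with p in polys.  Pointwise the
-- eight polynomials add up to 2x₁ + 3x₂ + x₃ + 2x₄, so the sum of their δ is
-- at most 16; but the ranks add up to 17.
private
  x₁ x₂ x₃ x₄ : Lattice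
  x₁ = var (# 0)
  x₂ = var (# 1)
  x₃ = var (# 2)
  x₄ = var (# 3)

  p₁ p₂ p₃ p₄ p₅ p₆ p₇ p₈ : Lattice
  p₁ = ((x₁ ⊔ x₂) ⊔ x₃) ⊔ x₄
  p₂ = ((x₁ ⊓ x₂) ⊓ x₃) ⊓ x₄
  p₃ = (x₁ ⊓ x₂) ⊔ (x₁ ⊓ x₃)
  p₄ = (x₂ ⊓ x₃) ⊔ (x₂ ⊓ x₄)
  p₅ = (x₄ ⊓ x₃) ⊔ (x₄ ⊓ x₁)
  p₆ = (x₂ ⊓ x₁) ⊔ (x₂ ⊓ x₄)
  p₇ = x₁ ⊔ x₂
  p₈ = x₂ ⊔ x₄

  value : ∀ {v} → (Fin 4 → Fin v → Bool) → Lattice → ℕ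
  value X p = count λ x → eval p λ i → X i x

  polys : List (Lattice × ℕ)
  polys = (p₁ , 3) ∷ (p₂ , 0) ∷ (p₃ , 2) ∷ (p₄ , 2) ∷ (p₅ , 2) ∷ (p₆ , 2) ∷ (p₇ , 3) ∷ (p₈ , 3) ∷ []

  weights : List (Fin 4)
  weights = # 0 ∷ # 0 ∷ # 1 ∷ # 1 ∷ # 1 ∷ # 2 ∷ # 3 ∷ # 3 ∷ []

  total : (Lattice → ℕ) → ℕ
  total c = Σ-list (c ∘ proj₁) polys

  weighted : (Fin 4 → ℕ) → ℕ
  weighted c = Σ-list c weights

  -- Both sides add up over the vertices, and a vertex enters only through its membership in the
  -- four sets, so sixteen truth assignments decide the identity.
  total-value : ∀ {v} (X : Fin 4 → Fin v → Bool) → total (value X) ≡ weighted (count ∘ X)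
  total-value {zero}  X = refl
  total-value {suc v} X = begin
    total (value X) ≡⟨ Σ-list-+ (head ∘ proj₁) (value tail ∘ proj₁) polys ⟩
    total head + total (value tail) ≡⟨ cong₂ _+_ (pointwise (tabulate λ i → X i zero)) (total-value tail) ⟩
    weighted (λ i → bit (X i zero)) + weighted (count ∘ tail) ≡⟨ Σ-list-+ (λ i → bit (X i zero)) (count ∘ tail) weights ⟨
    weighted (count ∘ X) ∎
    where
    open ≡-Reasoning
    head : Lattice → ℕ
    head p = bit (eval p λ i → X i zero)
    tail : Fin 4 → Fin v → Bool
    tail i = X i ∘ suc
    pointwise : ∀ T → total (λ p → bit (eval p (lookup T))) ≡ weighted (λ i → bit (lookup T i))
    pointwise = toWitness {a? = allSubset? λ T → total (λ p → bit (eval p (lookup T))) ℕ.≟ weighted (λ i → bit (lookup T i))} _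

certificate : ∀ {v} (S N : Fin 4 → Fin v → Bool) → (∀ i → count (N i) ≤ count (S i) + 2) →
  ¬ All (λ { (p , r) → value S p + r ≤ value N p }) polys
certificate S N N≤S+2 bounds = ℕ.<⇒≱ (ℕ.n<1+n 16) (ℕ.+-cancelˡ-≤ (weighted (count ∘ S)) 17 16 (begin
    weighted (count ∘ S) + 17 ≡⟨ cong (_+ 17) (total-value S) ⟨
    total (value S) + 17 ≡⟨ Σ-list-+ (value S ∘ proj₁) proj₂ polys ⟨
    Σ-list (λ { (p , r) → value S p + r }) polys ≤⟨ Σ-list-mono bounds ⟩
    total (value N) ≡⟨ total-value N ⟩
    weighted (count ∘ N) ≤⟨ Σ-list-mono (All.tabulate {xs = weights} λ {i} _ → N≤S+2 i) ⟩
    weighted (λ i → count (S i) + 2) ≡⟨ Σ-list-+ (count ∘ S) (λ _ → 2) weights ⟩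
    weighted (count ∘ S) + 16 ∎))
  where open ℕ.≤-Reasoning

matIndep? : ∀ {n r} (A : Fin n → Vec Bool r) (I : Subset n) → Dec (MatIndep A I)
matIndep? {n} {r} A I = map′ to from (¬? (anySubset? λ T → (T ⊆? I) ×-dec ((colSum A T ≟ₛ replicate r false) ×-dec ¬? (T ≟ₛ (replicate n false)))))
  where
  to : _ → MatIndep A I
  to ¬dep T T⊆I z = decidable-stable (T ≟ₛ _) λ T≢∅ → ¬dep (T , (λ {x} → T⊆I {x}) , z , T≢∅)
  from : MatIndep A I → _
  from ind (T , T⊆I , z , T≢∅) = T≢∅ (ind T T⊆I z)

triangle : Fin 4 → Subset 6
triangle zero = true  ∷ true  ∷ false ∷ true  ∷ false ∷ false ∷ []
triangle (suc zero) = true  ∷ false ∷ true  ∷ false ∷ true  ∷ false ∷ []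
triangle (suc (suc zero)) = false ∷ true  ∷ true  ∷ false ∷ false ∷ true  ∷ []
triangle (suc (suc (suc zero))) = false ∷ false ∷ false ∷ true  ∷ true  ∷ true  ∷ []

count-triangle : ∀ {v} (g : Fin 6 → Fin v) (N : Fin v → Bool) i →
  count (λ y → N y ∨ does (Fin.any? λ x → (lookup (triangle i) x Bool.≟ true) ×-dec (g x Fin.≟ y))) ≤ 3 + count N
count-triangle g N i = ℕ.≤-trans (count-mono (three i))
  (ℕ.≤-trans (count-insert _ (g (c i))) (s≤s (ℕ.≤-trans (count-insert _ (g (b i))) (s≤s (count-insert N (g (a i)))))))
  where
  corners : Fin 4 → Vec (Fin 6) 3
  corners zero = # 0 ∷ # 1 ∷ # 3 ∷ []
  corners (suc zero) = # 0 ∷ # 2 ∷ # 4 ∷ []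
  corners (suc (suc zero)) = # 1 ∷ # 2 ∷ # 5 ∷ []
  corners (suc (suc (suc zero))) = # 3 ∷ # 4 ∷ # 5 ∷ []
  a b c : Fin 4 → Fin 6
  a i = lookup (corners i) (# 0)
  b i = lookup (corners i) (# 1)
  c i = lookup (corners i) (# 2)
  corner : ∀ i x → lookup (triangle i) x ≡ true → x ≡ a i ⊎ x ≡ b i ⊎ x ≡ c i
  corner = toWitness {a? = Fin.all? λ i → Fin.all? λ x → (lookup (triangle i) x Bool.≟ true) →-dec ((x Fin.≟ a i) ⊎-dec ((x Fin.≟ b i) ⊎-dec (x Fin.≟ c i)))} _
  three : ∀ i y → N y ∨ does (Fin.any? λ x → (lookup (triangle i) x Bool.≟ true) ×-dec (g x Fin.≟ y)) ≡ true →
          ((N y ∨ does (y Fin.≟ g (a i))) ∨ does (y Fin.≟ g (b i))) ∨ does (y Fin.≟ g (c i)) ≡ true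
  three i y e with ∨-split {N y} e
  ... | inj₁ Ny rewrite Ny = refl
  ... | inj₂ hit with does⇒ (Fin.any? λ x → (lookup (triangle i) x Bool.≟ true) ×-dec (g x Fin.≟ y)) hit
  ...   | x , tx , refl with corner i x tx
  ... | inj₁ refl rewrite dec-true (g x Fin.≟ g x) refl = ∨-introˡ (∨-introˡ (Bool.∨-zeroʳ (N (g x))))
  ... | inj₂ (inj₁ refl) rewrite dec-true (g x Fin.≟ g x) refl = ∨-introˡ (Bool.∨-zeroʳ (N (g x) ∨ does (g x Fin.≟ g (a i))))
  ... | inj₂ (inj₂ refl) rewrite dec-true (g x Fin.≟ g x) refl = Bool.∨-zeroʳ _

-- `J` stands for a basis of the contracted set: a set is independent in the contraction when its
-- union with that basis can be linked.
Occupied : ∀ {v} → (Fin v → Bool) → (Fin 6 → Fin v) → Subset 6 → Fin v → Set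
Occupied J g I y = J y ≡ true ⊎ ∃ λ x → lookup I x ≡ true × g x ≡ y

module _ {v : ℕ} (Arc : Fin v → Fin v → Bool) (T : Subset v) (J : Fin v → Bool)
         (g : Fin 6 → Fin v) (g-inj : Injective _≡_ _≡_ g) (g∉J : ∀ x → J (g x) ≡ false) where

  module Refutation (rep : ∀ I → MatIndep (incidence Q₁) I ⇔ Flow Arc (_∈ T) (Occupied J g I)) where

    W : Fin v → Bool
    W x = not (does (x ∈? T))

    inside : ∀ {x} → W x ≡ true → x ∉ T
    inside {x} Wx with x ∈? T
    ... | no x∉T = x∉T

    outside : ∀ {x} → x ∉ T → W x ≡ true
    outside {x} x∉T rewrite dec-false (x ∈? T) x∉T = refl

    on : Fin 4 → Fin v → Bool
    on i y = does (Fin.any? λ x → (lookup (triangle i) x Bool.≟ true) ×-dec (g x Fin.≟ y))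

    on-intro : ∀ i {x} → lookup (triangle i) x ≡ true → on i (g x) ≡ true
    on-intro i {x} tx = dec-true (Fin.any? λ x′ → (lookup (triangle i) x′ Bool.≟ true) ×-dec (g x′ Fin.≟ g x)) (x , tx , refl)

    -- A matching of `W` in `R i` is the same thing as a flow that avoids `J` and triangle `i`. The
    -- triangle is dependent, so there is none.
    R : Fin 4 → Fin v → Fin v → Bool
    R i x y = (does (x Fin.≟ y) ∨ Arc x y) ∧ not (J y ∨ on i y)

    no-matching : ∀ i → ¬ Matching W (R i)
    no-matching i (matching m rel inj) = dependent i (Equivalence.from (rep (triangle i)) (record
      { next  = m
      ; arc   = λ x x∉T → arc x (proj₁ (∧-split (rel x (outside x∉T))))
      ; inj   = λ x y x∉T y∉T → inj x y (outside x∉T) (outside y∉T)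
      ; avoid = λ x x∉T → avoid (proj₂ (∧-split {does (x Fin.≟ m x) ∨ Arc x (m x)} (rel x (outside x∉T)))) }))
      where
      dependent : ∀ i → ¬ MatIndep (incidence Q₁) (triangle i)
      dependent = toWitness {a? = Fin.all? λ i → ¬? (matIndep? (incidence Q₁) (triangle i))} _
      arc : ∀ x → does (x Fin.≟ m x) ∨ Arc x (m x) ≡ true → x ≡ m x ⊎ Arc x (m x) ≡ true
      arc x e with x Fin.≟ m x
      ... | yes eq = inj₁ eq
      ... | no _   = inj₂ e
      avoid : ∀ {y} → not (J y ∨ on i y) ≡ true → ¬ Occupied J g (triangle i) y
      avoid e (inj₁ Jy) rewrite Jy = contradiction e λ ()
      avoid {y} e (inj₂ (x , tx , refl)) rewrite on-intro i tx | Bool.∨-zeroʳ (J (g x)) = contradiction e λ ()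

    violator : ∀ i → Violator W (R i)
    -- `id` is only the default value for the vertices of `T`, which need no match.
    violator i with hall W (R i) id
    ... | inj₁ m = contradiction m (no-matching i)
    ... | inj₂ c = c

    module Tight-sets (c : ∀ i → Violator W (R i)) where

      S : Fin 4 → Fin v → Bool
      S i = Closed.S (proj₁ (c i))

      N : Fin 4 → Fin v → Bool
      N i y = Closed.N (proj₁ (c i)) y ∨ on i y

      -- The three vertices of the triangle add at most 3, and a violator has fewer neighbours than
      -- elements; the difference 2 is the rank of the triangle.
      N≤S+2 : ∀ i → count (N i) ≤ count (S i) + 2
      N≤S+2 i = subst (count (N i) ≤_) (ℕ.+-comm 2 (count (S i)))
        (ℕ.≤-trans (count-triangle g (Closed.N (proj₁ (c i))) i) (s≤s (s≤s (proj₂ (c i)))))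

      -- A linking that avoids the edges es maps S i into N i, for every i at
      -- once, and so maps p(S) into p(N) minus es.
      bound : ∀ p (I : Subset 6) → MatIndep (incidence Q₁) I → (es : List (Fin 6)) →
              Unique es → All (λ e → lookup I e ≡ true) es →
              All (λ e → eval p (λ i → lookup (triangle i) e) ≡ true) es →
              value S p + length es ≤ value N p
      bound p I ind es u es⊆I es⊆p = subst (λ l → value S p + l ≤ value N p) (length-map g es)
        (count-inj-avoiding _ _ next
          (λ x px → eval-mono p (λ i → moved i x (demand px)) px)
          (λ x y px py → inj x y (demand px) (demand py))
          (map g es) (Unique-map⁺ g-inj u)
          (All-map⁺ (All.map (λ ep → eval-mono p (λ i te → ∨-introʳ {Closed.N (proj₁ (c i)) _} (on-intro i te)) ep) es⊆p))
          (All-map⁺ (All.map (λ eI x px eq → avoid x (demand px) (inj₂ (_ , eI , sym eq))) es⊆I)))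
        where
        open Flow (Equivalence.to (rep I) ind)

        demand : ∀ {x} → eval p (λ i → S i x) ≡ true → x ∉ T
        demand {x} px = inside (some p px)
          where
          some : ∀ p → eval p (λ i → S i x) ≡ true → W x ≡ true
          some (var i) e = Closed.S⊆W (proj₁ (c i)) x e
          some (p ⊓ q) e = some p (proj₁ (∧-split e))
          some (p ⊔ q) e with ∨-split {eval p (λ i → S i x)} e
          ... | inj₁ e′ = some p e′
          ... | inj₂ e′ = some q e′

        moved : ∀ i x → x ∉ T → S i x ≡ true → N i (next x) ≡ true
        moved i x x∉T sx with on i (next x) in eq
        ... | true  = Bool.∨-zeroʳ _
        ... | false = ∨-introˡ (Closed.nbr (proj₁ (c i)) x (next x) sx (∧-intro moves free))
          where
          moves : does (x Fin.≟ next x) ∨ Arc x (next x) ≡ true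
          moves with arc x x∉T
          ... | inj₁ x≡ = ∨-introˡ (dec-true (x Fin.≟ next x) x≡)
          ... | inj₂ a  = ∨-introʳ {does (x Fin.≟ next x)} a
          free : not (J (next x) ∨ on i (next x)) ≡ true
          free rewrite eq with J (next x) in Jn
          ... | true  = ⊥-elim (avoid x x∉T (inj₁ Jn))
          ... | false = refl

      bounds : All (λ { (p , r) → value S p + r ≤ value N p }) polys
      bounds =
        -- Each row lists a basis of the edges that `p` selects from the four triangles, once as a
        -- list and once as a subset.
        row p₁ (# 0 ∷ # 1 ∷ # 2 ∷ []) (true ∷ true ∷ true ∷ false ∷ false ∷ false ∷ []) ∷
        row p₂ [] (replicate 6 false) ∷
        row p₃ (# 0 ∷ # 1 ∷ []) (true ∷ true ∷ false ∷ false ∷ false ∷ false ∷ []) ∷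
        row p₄ (# 2 ∷ # 4 ∷ []) (false ∷ false ∷ true ∷ false ∷ true ∷ false ∷ []) ∷
        row p₅ (# 3 ∷ # 5 ∷ []) (false ∷ false ∷ false ∷ true ∷ false ∷ true ∷ []) ∷
        row p₆ (# 0 ∷ # 4 ∷ []) (true ∷ false ∷ false ∷ false ∷ true ∷ false ∷ []) ∷
        row p₇ (# 0 ∷ # 1 ∷ # 2 ∷ []) (true ∷ true ∷ true ∷ false ∷ false ∷ false ∷ []) ∷
        row p₈ (# 0 ∷ # 2 ∷ # 3 ∷ []) (true ∷ false ∷ true ∷ true ∷ false ∷ false ∷ []) ∷ []
        where
        row : ∀ p es I → {True (matIndep? (incidence Q₁) I)} → {True (unique? Fin._≟_ es)} →
              {True (All.all? (λ e → lookup I e Bool.≟ true) es)} →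
              {True (All.all? (λ e → eval p (λ i → lookup (triangle i) e) Bool.≟ true) es)} →
              value S p + length es ≤ value N p
        row p es I {ind} {u} {es⊆I} {es⊆p} = bound p I (toWitness ind) es (toWitness u) (toWitness es⊆I) (toWitness es⊆p)

    absurd : ⊥
    absurd = certificate (S violator) (N violator) (N≤S+2 violator) (bounds violator)
      where open Tight-sets

  K₄-not-gammoid : ¬ (∀ I → MatIndep (incidence Q₁) I ⇔ Flow Arc (_∈ T) (Occupied J g I))
  K₄-not-gammoid rep = Refutation.absurd rep

-- Cycle spaces

infixl 9 _!_
_!_ : ∀ {n} → Subset n → Fin n → Bool
_!_ = lookup

infixr 6 _⊕_
_⊕_ : ∀ {n} → Subset n → Subset n → Subset n
_⊕_ = zipWith _xor_

∅ : ∀ {n} → Subset n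
∅ = replicate _ false

!-⊕ : ∀ {n} (S T : Subset n) j → (S ⊕ T) ! j ≡ S ! j xor T ! j
!-⊕ S T j = Vec.lookup-zipWith _xor_ j S T

!-∅ : ∀ {n} (j : Fin n) → ∅ ! j ≡ false
!-∅ j = Vec.lookup-replicate j false

record Space (n : ℕ) : Set₁ where
  field
    Cycle : Subset n → Set
    cycle? : ∀ T → Dec (Cycle T)
    cycle-∅ : Cycle ∅
    cycle-⊕ : ∀ {S T} → Cycle S → Cycle T → Cycle (S ⊕ T)

-- A colouring records a minor: contract the elements coloured con, delete
-- those coloured del, keep those coloured act.
data Colour : Set where
  act con del : Colour

act? : ∀ k → Dec (k ≡ act)
act? act = yes refl
act? con = no λ ()
act? del = no λ ()

del? : ∀ k → Dec (k ≡ del)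
del? act = no λ ()
del? con = no λ ()
del? del = yes refl

Colouring : ℕ → Set
Colouring n = Fin n → Colour

infixl 6 _[_↦_]
_[_↦_] : ∀ {n} → Colouring n → Fin n → Colour → Colouring n
(c [ e ↦ k ]) j = if does (j Fin.≟ e) then k else c j

↦-same : ∀ {n} (c : Colouring n) e k → (c [ e ↦ k ]) e ≡ k
↦-same c e k rewrite dec-true (e Fin.≟ e) refl = refl

↦-other : ∀ {n} (c : Colouring n) {e j} k → j ≢ e → (c [ e ↦ k ]) j ≡ c j
↦-other c {e} {j} k j≢e rewrite dec-false (j Fin.≟ e) j≢e = refl

size-act : ∀ {n} → Colouring n → ℕ
size-act c = count λ j → does (act? (c j))

size-act-decreases : ∀ {n} (c c′ : Colouring n) e → c e ≡ act →
  (∀ j → c′ j ≡ act → c j ≡ act × j ≢ e) → size-act c′ < size-act c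
size-act-decreases c c′ e ce sub =
  subst (size-act c′ <_) (sym (count-∖ (λ j → does (act? (c j))) e (dec-true (act? (c e)) ce)))
    (s≤s (count-mono keep))
  where
  keep : ∀ j → does (act? (c′ j)) ≡ true → ((λ i → does (act? (c i))) ∖ e) j ≡ true
  keep j a with act? (c′ j)
  ... | yes c′j = ∖-intro (λ i → does (act? (c i))) e (dec-true (act? (c j)) (proj₁ (sub j c′j))) (proj₂ (sub j c′j))

-- The triangles 01-02-12, 01-03-13 and 02-03-23 form a basis of the cycle
-- space of K₄, and the edges 12, 13, 23 read off the coordinates.
K₄-cycle : Subset 6 → Set
K₄-cycle T = colSum (incidence Q₁) T ≡ ∅

K₄-cycle? : ∀ T → Dec (K₄-cycle T)
K₄-cycle? T = _ ≟ₛ _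

span : Bool → Bool → Bool → Subset 6
span x y z = (x xor y) ∷ (x xor z) ∷ (y xor z) ∷ x ∷ y ∷ z ∷ []

K₄-cycle⇒span : ∀ T → K₄-cycle T → T ≡ span (T ! # 3) (T ! # 4) (T ! # 5)
K₄-cycle⇒span = toWitness {a? = allSubset? λ T → K₄-cycle? T →-dec T ≟ₛ _} _

span-K₄-cycle : ∀ x y z → K₄-cycle (span x y z)
span-K₄-cycle x y z = toWitness {a? = allSubset? λ T → K₄-cycle? (span (T ! # 0) (T ! # 1) (T ! # 2))} _ (x ∷ y ∷ z ∷ [])

lookup-ext : ∀ {n} {S T : Subset n} → (∀ j → S ! j ≡ T ! j) → S ≡ T
lookup-ext {S = []} {[]} e = refl
lookup-ext {S = _ ∷ _} {_ ∷ _} e = cong₂ _∷_ (e zero) (lookup-ext (e ∘ suc))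

pick : ∀ {P : Set} → Dec P → Colour → Colour
pick (yes _) k = act
pick (no _)  k = k

pick-yes : ∀ {P : Set} (d : Dec P) {k} → P → pick d k ≡ act
pick-yes (yes _) p = refl
pick-yes (no ¬p) p = contradiction p ¬p

pick-no : ∀ {P : Set} (d : Dec P) {k} → ¬ P → pick d k ≡ k
pick-no (yes p) ¬p = contradiction p ¬p
pick-no (no _)  ¬p = refl

pick-act : ∀ {P : Set} (d : Dec P) {k} → k ≢ act → pick d k ≡ act → P
pick-act (yes p) _ _ = p
pick-act (no _)  k≢ e = contradiction e k≢

pick-del : ∀ {P : Set} (d : Dec P) {k} → k ≢ del → pick d k ≢ del
pick-del (yes p) _ ()
pick-del (no _)  k≢ e = k≢ e

module Minors {n : ℕ} (𝒦 : Space n) where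
  open Space 𝒦

  -- The cycles of the minor are the restrictions of these sets to the active elements: deleted
  -- elements are excluded and contracted ones are free.
  Allowed : Colouring n → Subset n → Set
  Allowed c T = Cycle T × (∀ j → T ! j ≡ true → c j ≢ del)

  allowed? : ∀ c T → Dec (Allowed c T)
  allowed? c T = cycle? T ×-dec Fin.all? λ j → (T ! j Bool.≟ true) →-dec ¬? (del? (c j))

  allowed-∅ : ∀ {c} → Allowed c ∅
  allowed-∅ = cycle-∅ , λ j e → contradiction (trans (sym e) (!-∅ j)) λ ()

  allowed-⊕ : ∀ {c S T} → Allowed c S → Allowed c T → Allowed c (S ⊕ T)
  allowed-⊕ {c} {S} {T} (KS , aS) (KT , aT) = cycle-⊕ KS KT , λ j e → [ aS j , aT j ]′ (either (S ! j) (trans (sym (!-⊕ S T j)) e))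
    where
    either : ∀ x {y} → x xor y ≡ true → x ≡ true ⊎ y ≡ true
    either true  _ = inj₁ refl
    either false e = inj₂ e

  _·_ : Bool → Subset n → Subset n
  b · T = if b then T else ∅

  !-· : ∀ b T j → (b · T) ! j ≡ b ∧ T ! j
  !-· true  T j = refl
  !-· false T j = !-∅ j

  allowed-· : ∀ {c} b {T} → Allowed c T → Allowed c (b · T)
  allowed-· true  a = a
  allowed-· false a = allowed-∅

  record K₄-minor : Set where
    field
      colour  : Colouring n
      elem : Fin 6 → Fin n
      elem-inj : Injective _≡_ _≡_ elem
      elem-act : ∀ x → colour (elem x) ≡ act
      act-elem : ∀ j → colour j ≡ act → ∃ λ x → elem x ≡ j
      cycles  : ∀ T₆ → K₄-cycle T₆ ⇔ ∃ λ T → Allowed colour T × ∀ x → T ! elem x ≡ T₆ ! x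

  module Build (elem : Fin 6 → Fin n) (elem-inj : Injective _≡_ _≡_ elem)
               (rest : Colouring n) (rest-con-del : ∀ j → rest j ≢ act) where

    hit? : ∀ j → Dec (∃ λ x → elem x ≡ j)
    hit? j = Fin.any? λ x → elem x Fin.≟ j

    colour : Colouring n
    colour j = pick (hit? j) (rest j)

    colour-elem : ∀ x → colour (elem x) ≡ act
    colour-elem x = pick-yes (hit? (elem x)) (x , refl)

    allowed-colour : ∀ {c : Colouring n} {T} → Allowed c T → (∀ j → T ! j ≡ true → c j ≢ del → (∃ λ x → elem x ≡ j) ⊎ rest j ≢ del) → Allowed colour T
    allowed-colour (KT , aT) h = KT , λ j Tj → lem j Tj (aT j Tj)
      where
      lem : ∀ j → _ → _ → colour j ≢ del
      lem j Tj cj with h j Tj cj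
      ... | inj₁ (x , refl) = λ e → contradiction (trans (sym (colour-elem x)) e) λ ()
      ... | inj₂ r = pick-del (hit? j) r

    module _ {A B C : Subset n}
             (aA : Allowed colour A) (tA : ∀ x → A ! elem x ≡ span true false false ! x)
             (aB : Allowed colour B) (tB : ∀ x → B ! elem x ≡ span false true false ! x)
             (aC : Allowed colour C) (tC : ∀ x → C ! elem x ≡ span false false true ! x)
             (reduced : ∀ T → Allowed colour T → T ! elem (# 3) ≡ false → T ! elem (# 4) ≡ false → T ! elem (# 5) ≡ false →
                        T ! elem (# 0) ≡ false × T ! elem (# 1) ≡ false × T ! elem (# 2) ≡ false) where

      combination : Bool → Bool → Bool → Subset n
      combination x y z = x · A ⊕ y · B ⊕ z · C

      combination-allowed : ∀ x y z → Allowed colour (combination x y z)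
      combination-allowed x y z = allowed-⊕ (allowed-· x aA) (allowed-⊕ (allowed-· y aB) (allowed-· z aC))

      combination-trace : ∀ x y z i → combination x y z ! elem i ≡ span x y z ! i
      combination-trace x y z i = begin
        (x · A ⊕ y · B ⊕ z · C) ! elem i ≡⟨ trans (!-⊕ (x · A) _ _) (cong ((x · A) ! elem i xor_) (!-⊕ (y · B) (z · C) _)) ⟩
        (x · A) ! elem i xor ((y · B) ! elem i xor (z · C) ! elem i) ≡⟨ cong₂ _xor_ (at x A (span true false false) tA) (cong₂ _xor_ (at y B (span false true false) tB) (at z C (span false false true) tC)) ⟩
        (x ∧ span true false false ! i) xor ((y ∧ span false true false ! i) xor (z ∧ span false false true ! i)) ≡⟨ linear x y z i ⟩
        span x y z ! i ∎
        where
        open ≡-Reasoning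
        at : ∀ b D u → (∀ x → D ! elem x ≡ u ! x) → (b · D) ! elem i ≡ b ∧ u ! i
        at b D u t = trans (!-· b D (elem i)) (cong (b ∧_) (t i))
        linear : ∀ x y z i → (x ∧ span true false false ! i) xor ((y ∧ span false true false ! i) xor (z ∧ span false false true ! i)) ≡ span x y z ! i
        linear x y z = toWitness {a? = allSubset? λ T → Fin.all? λ i →
          (T ! # 0 ∧ span true false false ! i) xor ((T ! # 1 ∧ span false true false ! i) xor (T ! # 2 ∧ span false false true ! i))
            Bool.≟ span (T ! # 0) (T ! # 1) (T ! # 2) ! i} _ (x ∷ y ∷ z ∷ [])

      -- The traces of `A`, `B`, `C` are the basis triangles, so every cycle of K₄ is a trace. By
      -- `reduced` the coordinates 12, 13, 23 determine a trace, so there are no others.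
      build : K₄-minor
      build = record
        { colour = colour ; elem = elem ; elem-inj = elem-inj ; elem-act = colour-elem
        ; act-elem = act-elem
        ; cycles = λ T₆ → mk⇔ (to T₆) (from T₆) }
        where
        act-elem : ∀ j → colour j ≡ act → ∃ λ x → elem x ≡ j
        act-elem j cj = pick-act (hit? j) (rest-con-del j) cj

        to : ∀ T₆ → K₄-cycle T₆ → ∃ λ T → Allowed colour T × ∀ x → T ! elem x ≡ T₆ ! x
        to T₆ k = _ , combination-allowed x y z , λ i → trans (combination-trace x y z i) (cong (_! i) (sym (K₄-cycle⇒span T₆ k)))
          where
          x = T₆ ! # 3
          y = T₆ ! # 4
          z = T₆ ! # 5

        xor-zero : ∀ a b → a xor b ≡ false → a ≡ b
        xor-zero true  true  _ = refl
        xor-zero false false _ = refl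

        from : ∀ T₆ → (∃ λ T → Allowed colour T × ∀ x → T ! elem x ≡ T₆ ! x) → K₄-cycle T₆
        from T₆ (T , aT , tT) = subst K₄-cycle {span x y z} {T₆} (lookup-ext λ j → trans (sym (eq j)) (tT j)) (span-K₄-cycle x y z)
          where
          x = T ! elem (# 3)
          y = T ! elem (# 4)
          z = T ! elem (# 5)
          D = combination x y z
          diff : ∀ i → (T ⊕ D) ! elem i ≡ T ! elem i xor span x y z ! i
          diff i = trans (!-⊕ T D (elem i)) (cong (T ! elem i xor_) (combination-trace x y z i))
          zeros = reduced (T ⊕ D) (allowed-⊕ aT (combination-allowed x y z))
                    (trans (diff (# 3)) (Bool.xor-same x)) (trans (diff (# 4)) (Bool.xor-same y)) (trans (diff (# 5)) (Bool.xor-same z))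
          eq : ∀ i → T ! elem i ≡ span x y z ! i
          eq zero = xor-zero _ _ (trans (sym (diff (# 0))) (proj₁ zeros))
          eq (suc zero) = xor-zero _ _ (trans (sym (diff (# 1))) (proj₁ (proj₂ zeros)))
          eq (suc (suc zero)) = xor-zero _ _ (trans (sym (diff (# 2))) (proj₂ (proj₂ zeros)))
          eq (suc (suc (suc zero))) = refl
          eq (suc (suc (suc (suc zero)))) = refl
          eq (suc (suc (suc (suc (suc zero))))) = refl

-- Simple and cosimple minors

true≢false : ∀ {b} → b ≡ true → b ≢ false
true≢false refl ()

≢true⇒false : ∀ {b} → b ≢ true → b ≡ false
≢true⇒false {false} _ = refl
≢true⇒false {true}  h = contradiction refl h

even₁ : ∀ x y z → x xor (y xor z) ≡ false → x ≡ y xor z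
even₁ true  true  false _ = refl
even₁ true  false true  _ = refl
even₁ false true  true  _ = refl
even₁ false false false _ = refl

even₂ : ∀ x y z → x xor (y xor z) ≡ false → y ≡ x xor z
even₂ true  true  false _ = refl
even₂ true  false true  _ = refl
even₂ false true  true  _ = refl
even₂ false false false _ = refl

even₃ : ∀ x y z → x xor (y xor z) ≡ false → z ≡ x xor y
even₃ true  true  false _ = refl
even₃ true  false true  _ = refl
even₃ false true  true  _ = refl
even₃ false false false _ = refl

minimal : ∀ {n} {P : Subset n → Set} → (∀ T → Dec (P T)) → (μ : Subset n → ℕ) →
          ∀ T → P T → ∃ λ Z → P Z × ∀ T → P T → μ Z ≤ μ T
minimal {P = P} P? μ T PT = go T PT (<-wellFounded (μ T))
  where
  go : ∀ T → P T → Acc _<_ (μ T) → ∃ λ Z → P Z × ∀ T → P T → μ Z ≤ μ T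
  go T PT (acc rs) with anySubset? (λ S → P? S ×-dec (μ S ℕ.<? μ T))
  ... | yes (S , PS , lt) = go S PS (rs lt)
  ... | no none = T , PT , λ S PS → ℕ.≮⇒≥ λ lt → none (S , PS , lt)

module Structure {n : ℕ} (𝒦 : Space n) where
  open Space 𝒦
  open Minors 𝒦

  ⊕-at : ∀ (S T : Subset n) j {x y} → S ! j ≡ x → T ! j ≡ y → (S ⊕ T) ! j ≡ x xor y
  ⊕-at S T j refl refl = !-⊕ S T j

  -- A loop (a ≡ b) or a parallel pair.
  Small : Colouring n → Fin n → Fin n → Set
  Small c a b = c a ≡ act × c b ≡ act × ∃ λ T →
    Allowed c T × T ! a ≡ true × T ! b ≡ true × ∀ j → c j ≡ act → T ! j ≡ true → j ≡ a ⊎ j ≡ b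

  small? : ∀ c → Dec (∃₂ (Small c))
  small? c = Fin.any? λ a → Fin.any? λ b → act? (c a) ×-dec (act? (c b) ×-dec anySubset? λ T →
    allowed? c T ×-dec ((T ! a Bool.≟ true) ×-dec ((T ! b Bool.≟ true) ×-dec
      Fin.all? λ j → act? (c j) →-dec ((T ! j Bool.≟ true) →-dec ((j Fin.≟ a) ⊎-dec (j Fin.≟ b))))))

  Coloop : Colouring n → Fin n → Set
  Coloop c a = ∀ T → Allowed c T → T ! a ≡ false

  Series : Colouring n → Fin n → Fin n → Set
  Series c a b = ∀ T → Allowed c T → T ! a xor T ! b ≡ false

  Covered : Colouring n → Fin n → Set
  Covered c a = ∃ λ T → Allowed c T × T ! a ≡ true

  Separated : Colouring n → Fin n → Fin n → Set
  Separated c a b = ∃ λ T → Allowed c T × T ! a xor T ! b ≡ true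

  coloop? : ∀ c a → Coloop c a ⊎ Covered c a
  coloop? c a with anySubset? (λ T → allowed? c T ×-dec (T ! a Bool.≟ true))
  ... | yes cov = inj₂ cov
  ... | no none = inj₁ λ T aT → ≢true⇒false λ Ta → none (T , aT , Ta)

  series? : ∀ c a b → Series c a b ⊎ Separated c a b
  series? c a b with anySubset? (λ T → allowed? c T ×-dec (T ! a xor T ! b Bool.≟ true))
  ... | yes sep = inj₂ sep
  ... | no none = inj₁ λ T aT → ≢true⇒false λ Ta → none (T , aT , Ta)

  record Simple (c : Colouring n) : Set where
    constructor simple
    field noSmall : ∀ a b → ¬ Small c a b

  -- The absence of coloops and series pairs, put as the existence of witnesses, since the later
  -- constructions add these cycles to one another.
  record Cosimple (c : Colouring n) : Set where
    constructor cosimple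
    field
      covered   : ∀ a → c a ≡ act → Covered c a
      separated : ∀ a b → c a ≡ act → c b ≡ act → a ≢ b → Separated c a b

  record Triangle (c : Colouring n) (a b d : Fin n) : Set where
    field
      T : Subset n
      allowed : Allowed c T
      ca : c a ≡ act
      cb : c b ≡ act
      cd : c d ≡ act
      a≢b : a ≢ b
      a≢d : a ≢ d
      b≢d : b ≢ d
      Ta : T ! a ≡ true
      Tb : T ! b ≡ true
      Td : T ! d ≡ true
      only : ∀ j → c j ≡ act → T ! j ≡ true → j ≡ a ⊎ j ≡ b ⊎ j ≡ d

    off : ∀ j → c j ≡ act → j ≢ a → j ≢ b → j ≢ d → T ! j ≡ false
    off j cj j≢a j≢b j≢d = ≢true⇒false λ Tj → [ j≢a , [ j≢b , j≢d ]′ ]′ (only j cj Tj)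

  -- Cocycles are the sets orthogonal to all cycles, hence the evenness condition. Without coloops
  -- and series pairs, a cocycle of three elements is a cocircuit.
  record Triad (c : Colouring n) (a b d : Fin n) : Set where
    field
      ca : c a ≡ act
      cb : c b ≡ act
      cd : c d ≡ act
      a≢b : a ≢ b
      a≢d : a ≢ d
      b≢d : b ≢ d
      even : ∀ T → Allowed c T → T ! a xor (T ! b xor T ! d) ≡ false

  module _ {c : Colouring n} where

    triangle-swap : ∀ {a b d} → Triangle c a b d → Triangle c b a d
    triangle-swap t = record
      { T = T ; allowed = allowed ; ca = cb ; cb = ca ; cd = cd ; a≢b = ≢-sym a≢b ; a≢d = b≢d ; b≢d = a≢d
      ; Ta = Tb ; Tb = Ta ; Td = Td
      ; only = λ j cj Tj → [ (λ e → inj₂ (inj₁ e)) , [ inj₁ , (λ e → inj₂ (inj₂ e)) ]′ ]′ (only j cj Tj) }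
      where open Triangle t

    triangle-swapʳ : ∀ {a b d} → Triangle c a b d → Triangle c a d b
    triangle-swapʳ t = record
      { T = T ; allowed = allowed ; ca = ca ; cb = cd ; cd = cb ; a≢b = a≢d ; a≢d = a≢b ; b≢d = ≢-sym b≢d
      ; Ta = Ta ; Tb = Td ; Td = Tb
      ; only = λ j cj Tj → [ inj₁ , [ (λ e → inj₂ (inj₂ e)) , (λ e → inj₂ (inj₁ e)) ]′ ]′ (only j cj Tj) }
      where open Triangle t

    triad-swap : ∀ {a b d} → Triad c a b d → Triad c b a d
    triad-swap {a} {b} {d} t = record
      { ca = cb ; cb = ca ; cd = cd ; a≢b = ≢-sym a≢b ; a≢d = b≢d ; b≢d = a≢d
      ; even = λ T aT → trans (lem (T ! b) (T ! a) (T ! d)) (even T aT) }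
      where
      open Triad t
      lem : ∀ x y z → x xor (y xor z) ≡ y xor (x xor z)
      lem true  true  z = refl
      lem true  false z = refl
      lem false true  z = refl
      lem false false z = refl

    triad-swapʳ : ∀ {a b d} → Triad c a b d → Triad c a d b
    triad-swapʳ {a} {b} {d} t = record
      { ca = ca ; cb = cd ; cd = cb ; a≢b = a≢d ; a≢d = a≢b ; b≢d = ≢-sym b≢d
      ; even = λ T aT → trans (cong (T ! a xor_) (Bool.xor-comm (T ! d) (T ! b))) (even T aT) }
      where open Triad t

    no-pair : Simple c → ∀ T → Allowed c T → ∀ x y → c x ≡ act → c y ≡ act → T ! x ≡ true → T ! y ≡ true →
              ¬ (∀ j → c j ≡ act → j ≢ x → j ≢ y → T ! j ≡ false)
    no-pair (simple noSmall) T aT x y cx cy Tx Ty off = noSmall x y (cx , cy , T , aT , Tx , Ty , only)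
      where
      only : ∀ j → c j ≡ act → T ! j ≡ true → j ≡ x ⊎ j ≡ y
      only j cj Tj with j Fin.≟ x | j Fin.≟ y
      ... | yes e | _ = inj₁ e
      ... | no _  | yes e = inj₂ e
      ... | no ¬x | no ¬y = contradiction (off j cj ¬x ¬y) (true≢false Tj)

    -- If two triangles shared `e` and `f`, their sum would make `g` and `h` parallel.
    two-triangles : Simple c → ∀ {e f g h k} → Triangle c e f g → Triangle c e h k → h ≢ f → h ≢ g → k ≢ f
    two-triangles sim {e} {f} {g} {h} t u h≢f h≢g refl =
      no-pair sim (t.T ⊕ u.T) (allowed-⊕ t.allowed u.allowed) g h t.cd u.cb
        (⊕-at t.T u.T g t.Td (u.off g t.cd (≢-sym t.a≢d) (≢-sym h≢g) (≢-sym t.b≢d)))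
        (⊕-at t.T u.T h (t.off h u.cb (≢-sym u.a≢b) h≢f h≢g) u.Tb) off
      where
      module t = Triangle t
      module u = Triangle u
      off : ∀ j → c j ≡ act → j ≢ g → j ≢ h → (t.T ⊕ u.T) ! j ≡ false
      off j cj j≢g j≢h with j Fin.≟ e | j Fin.≟ f
      ... | yes refl | _ = ⊕-at t.T u.T e t.Ta u.Ta
      ... | no _ | yes refl = ⊕-at t.T u.T f t.Tb u.Td
      ... | no j≢e   | no j≢f   = ⊕-at t.T u.T j (t.off j cj j≢e j≢f j≢g) (u.off j cj j≢e j≢h j≢f)

    -- Dually, two triads sharing `e` and `f` would put `g` and `h` in series.
    two-triads : Cosimple c → ∀ {e f g h k} → Triad c e f g → Triad c e h k → h ≢ f → h ≢ g → k ≢ f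
    two-triads (cosimple _ separated) {e} {f} {g} {h} t u h≢f h≢g refl with separated g h (Triad.cd t) (Triad.cb u) (≢-sym h≢g)
    ... | T , aT , sep = contradiction (lem (T ! e) (T ! f) (T ! g) (T ! h) (Triad.even t T aT) (Triad.even u T aT)) (true≢false sep)
      where
      lem : ∀ x f g h → x xor (f xor g) ≡ false → x xor (h xor f) ≡ false → g xor h ≡ false
      lem x f g h p q with even₃ x f g p | even₂ x h f q
      ... | refl | refl = Bool.xor-same (x xor f)

    third : ∀ {a b d} → Triad c a b d → ∀ T → Allowed c T → ∀ {x y} → T ! a ≡ x → T ! b ≡ y → T ! d ≡ x xor y
    third {a} {b} {d} t T aT refl refl = even₃ (T ! a) (T ! b) (T ! d) (Triad.even t T aT)

    triad-meets : ∀ {a b d} → Triad c a b d → ∀ T → Allowed c T → T ! a ≡ true → T ! b ≡ true ⊎ T ! d ≡ true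
    triad-meets {a} {b} {d} t T aT Ta with T ! b in Tb | T ! d in Td
    ... | true  | _ = inj₁ refl
    ... | false | true  = inj₂ refl
    ... | false | false = contradiction (even₁ (T ! a) (T ! b) (T ! d) (Triad.even t T aT)) λ e → true≢false Ta (trans e (cong₂ _xor_ Tb Td))

    -- Evenness leaves an allowed set supported on the triad with no active element or with two, and
    -- two would be a parallel pair.
    triad-independent : Simple c → ∀ {e f h} → Triad c e f h → ∀ T → Allowed c T →
      (∀ j → c j ≡ act → j ≢ e → j ≢ f → j ≢ h → T ! j ≡ false) → T ! e ≡ false × T ! f ≡ false × T ! h ≡ false
    triad-independent sim {e} {f} {h} t T aT off with T ! e in Te | T ! f in Tf | T ! h in Th | Triad.even t T aT
    ... | false | false | false | _ = refl , refl , refl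
    ... | false | true  | true  | _ = ⊥-elim (no-pair sim T aT f h (Triad.cb t) (Triad.cd t) Tf Th λ j cj ≢f ≢h → other j cj ≢f ≢h)
      where
      other : ∀ j → c j ≡ act → j ≢ f → j ≢ h → T ! j ≡ false
      other j cj ≢f ≢h with j Fin.≟ e
      ... | yes refl = Te
      ... | no ≢e = off j cj ≢e ≢f ≢h
    ... | true | false | true  | _ = ⊥-elim (no-pair sim T aT e h (Triad.ca t) (Triad.cd t) Te Th λ j cj ≢e ≢h → other j cj ≢e ≢h)
      where
      other : ∀ j → c j ≡ act → j ≢ e → j ≢ h → T ! j ≡ false
      other j cj ≢e ≢h with j Fin.≟ f
      ... | yes refl = Tf
      ... | no ≢f = off j cj ≢e ≢f ≢h
    ... | true | true | false | _ = ⊥-elim (no-pair sim T aT e f (Triad.ca t) (Triad.cb t) Te Tf λ j cj ≢e ≢f → other j cj ≢e ≢f)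
      where
      other : ∀ j → c j ≡ act → j ≢ e → j ≢ f → T ! j ≡ false
      other j cj ≢e ≢f with j Fin.≟ h
      ... | yes refl = Th
      ... | no ≢h = off j cj ≢e ≢f ≢h
    triad-independent sim t T aT off | false | false | true | e rewrite e = contradiction e λ ()
    triad-independent sim t T aT off | false | true | false | e = contradiction e λ ()
    triad-independent sim t T aT off | true | false | false | e = contradiction e λ ()
    triad-independent sim t T aT off | true | true | true | e = contradiction e λ ()

  -- A pair `a`, `b` in series in `c′` is separated in `c` by some set, necessarily through `f`.
  -- Adding it to any other set through `f` gives a set avoiding `f`, so all sets through `f`
  -- separate the pair, and `f`, `a`, `b` form a triad. Only the sets avoiding `f` must survive in
  -- `c′`, which may therefore also contract elements.
  cosimple-or-triad : ∀ c → Cosimple c → ∀ f → c f ≡ act → ∀ c′ →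
    (∀ T → Allowed c T → T ! f ≡ false → Allowed c′ T) → (∀ j → c′ j ≡ act → c j ≡ act × j ≢ f) →
    Cosimple c′ ⊎ ∃₂ λ a b → c′ a ≡ act × c′ b ≡ act × Triad c f a b
  cosimple-or-triad c (cosimple covered separated) f cf c′ al sub = result (scan λ a → scan (pair a))
    where
    pair : ∀ a b → (∃₂ λ a b → c′ a ≡ act × c′ b ≡ act × Triad c f a b) ⊎ (c′ a ≡ act → c′ b ≡ act → a ≢ b → Separated c′ a b)
    pair a b with act? (c′ a) | act? (c′ b) | a Fin.≟ b
    ... | no ¬ca | _ | _ = inj₂ λ ca → contradiction ca ¬ca
    ... | yes _  | no ¬cb | _ = inj₂ λ _ cb → contradiction cb ¬cb
    ... | yes _  | yes _  | yes eq = inj₂ λ _ _ ≢ → contradiction eq ≢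
    ... | yes ca | yes cb | no a≢b with series? c′ a b
    ...   | inj₂ sep = inj₂ λ _ _ _ → sep
    ...   | inj₁ ser = inj₁ (a , b , ca , cb , record
            { ca = cf ; cb = proj₁ (sub a ca) ; cd = proj₁ (sub b cb)
            ; a≢b = ≢-sym (proj₂ (sub a ca)) ; a≢d = ≢-sym (proj₂ (sub b cb)) ; b≢d = a≢b ; even = even })
      where
      sep = separated a b (proj₁ (sub a ca)) (proj₁ (sub b cb)) a≢b
      S = proj₁ sep
      Sf : S ! f ≡ true
      Sf with S ! f in Sf
      ... | true  = refl
      ... | false = contradiction (ser S (al S (proj₁ (proj₂ sep)) Sf)) (true≢false (proj₂ (proj₂ sep)))
      lem : ∀ x y x′ y′ → (x xor x′) xor (y xor y′) ≡ false → x′ xor y′ ≡ true → true xor (x xor y) ≡ false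
      lem true  true  true  false () _
      lem true  true  false true  () _
      lem true  false _ _ _  _ = refl
      lem false true  _ _ _  _ = refl
      lem false false true  false () _
      lem false false false true  () _
      even : ∀ T → Allowed c T → T ! f xor (T ! a xor T ! b) ≡ false
      even T aT with T ! f in Tf
      ... | false = ser T (al T aT Tf)
      ... | true  = lem (T ! a) (T ! b) (S ! a) (S ! b)
            (subst₂ (λ x y → x xor y ≡ false) (!-⊕ T S a) (!-⊕ T S b)
              (ser (T ⊕ S) (al (T ⊕ S) (allowed-⊕ aT (proj₁ (proj₂ sep))) (⊕-at T S f Tf Sf))))
            (proj₂ (proj₂ sep))
    -- A coloop of `c′` would in `c` be a coloop or in series with `f`.
    cov : ∀ a → c′ a ≡ act → Covered c′ a
    cov a c′a with coloop? c′ a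
    ... | inj₂ T = T
    ... | inj₁ col with covered a (proj₁ (sub a c′a)) | separated a f (proj₁ (sub a c′a)) cf (proj₂ (sub a c′a))
    ...   | S , aS , Sa | T , aT , Taf with S ! f in Sf | T ! f in Tf
    ... | false | _ = contradiction (col S (al S aS Sf)) (true≢false Sa)
    ... | true  | false = contradiction (trans (sym Taf) (cong (_xor false) (col T (al T aT Tf)))) λ ()
    ... | true  | true  = contradiction (col (S ⊕ T) (al (S ⊕ T) (allowed-⊕ aS aT) (⊕-at S T f Sf Tf)))
                                (true≢false (⊕-at S T a Sa (lem (T ! a) Taf)))
      where
      lem : ∀ x → x xor true ≡ true → x ≡ false
      lem false _ = refl
      lem true ()

    result : _ ⊎ (∀ a b → c′ a ≡ act → c′ b ≡ act → a ≢ b → Separated c′ a b) → _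
    result (inj₁ triad) = inj₂ triad
    result (inj₂ sep)   = inj₁ (cosimple cov sep)

  -- A loop or parallel pair of `c′` is cut out by a set that, `c` being simple, must contain `e`
  -- and two further elements. The triangle is returned as allowed in `c′`, which shows that it
  -- avoids the elements deleted there.
  simple-or-triangle : ∀ c → Simple c → ∀ e → c e ≡ act → ∀ c′ →
    (∀ T → Allowed c′ T → Allowed c T) → (∀ j → c′ j ≡ act → c j ≡ act × j ≢ e) →
    (∀ j → c j ≡ act → j ≢ e → c′ j ≡ act ⊎ (∀ T → Allowed c′ T → T ! j ≡ false)) →
    Simple c′ ⊎ ∃₂ λ a b → c′ a ≡ act × c′ b ≡ act × Σ (Triangle c e a b) λ t → Allowed c′ (Triangle.T t)
  simple-or-triangle c (simple noSmall) e ce c′ al sub sup with small? c′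
  ... | no none = inj₁ (simple λ a b s → none (a , b , s))
  ... | yes (a , b , c′a , c′b , T , aT , Ta , Tb , only′) = by (T ! e Bool.≟ true) (a Fin.≟ b)
    where
    only : ∀ j → c j ≡ act → T ! j ≡ true → j ≡ e ⊎ j ≡ a ⊎ j ≡ b
    only j cj Tj with j Fin.≟ e
    ... | yes j≡e = inj₁ j≡e
    ... | no j≢e with sup j cj j≢e
    ...   | inj₁ c′j = inj₂ (only′ j c′j Tj)
    ...   | inj₂ off = contradiction (off T aT) (true≢false Tj)
    ca = sub a c′a
    cb = sub b c′b
    by : Dec (T ! e ≡ true) → Dec (a ≡ b) → _
    by (no ¬Te) _ = ⊥-elim (noSmall a b (proj₁ ca , proj₁ cb , T , al T aT , Ta , Tb ,
      λ j cj Tj → [ (λ { refl → contradiction Tj ¬Te }) , id ]′ (only j cj Tj)))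
    by (yes Te) (yes refl) = ⊥-elim (noSmall e a (ce , proj₁ ca , T , al T aT , Te , Ta ,
      λ j cj Tj → [ inj₁ , (λ h → inj₂ ([ id , id ]′ h)) ]′ (only j cj Tj)))
    by (yes Te) (no a≢b) = inj₂ (a , b , c′a , c′b , record
      { T = T ; allowed = al T aT ; ca = ce ; cb = proj₁ ca ; cd = proj₁ cb
      ; a≢b = ≢-sym (proj₂ ca) ; a≢d = ≢-sym (proj₂ cb) ; b≢d = a≢b
      ; Ta = Te ; Tb = Ta ; Td = Tb ; only = only } , aT)

  del-instead con-instead : Colour → Colour
  del-instead act = del
  del-instead con = con
  del-instead del = del
  con-instead act = con
  con-instead con = con
  con-instead del = del

  del-instead≢act : ∀ k → del-instead k ≢ act
  del-instead≢act act ()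
  del-instead≢act con ()
  del-instead≢act del ()

  con-instead≢act : ∀ k → con-instead k ≢ act
  con-instead≢act act ()
  con-instead≢act con ()
  con-instead≢act del ()

  module Found {c : Colouring n} (elem : Fin 6 → Fin n) (elem-inj : Injective _≡_ _≡_ elem) (elem-act : ∀ x → c (elem x) ≡ act)
               (rest : Colouring n) (rest≢act : ∀ j → rest j ≢ act)
               (rest-del : ∀ j → c j ≡ del → rest j ≡ del) (rest-con : ∀ j → c j ≡ con → rest j ≡ con) where
    open Build elem elem-inj rest rest≢act public

    allowed-back : ∀ {T} → Allowed colour T → Allowed c T
    allowed-back {T} (KT , aT) = KT , λ j Tj cj → aT j Tj (trans (pick-no (hit? j) (miss j cj)) (rest-del j cj))
      where
      miss : ∀ j → c j ≡ del → ¬ (∃ λ x → elem x ≡ j)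
      miss j cj (x , refl) = contradiction (trans (sym (elem-act x)) cj) λ ()

    allowed-forth : ∀ {T} → Allowed c T → (∀ j → c j ≡ act → T ! j ≡ true → (∃ λ x → elem x ≡ j) ⊎ rest j ≢ del) → Allowed colour T
    allowed-forth {T} aT h = allowed-colour aT go
      where
      go : ∀ j → T ! j ≡ true → c j ≢ del → (∃ λ x → elem x ≡ j) ⊎ rest j ≢ del
      go j Tj c≢ with c j in cj
      ... | act = h j cj Tj
      ... | con = inj₂ λ e → contradiction (trans (sym (rest-con j cj)) e) λ ()
      ... | del = contradiction refl c≢

    off-del : ∀ {T} → Allowed colour T → ∀ j → ¬ (∃ λ x → elem x ≡ j) → rest j ≡ del → T ! j ≡ false
    off-del (_ , aT) j miss r = ≢true⇒false λ Tj → aT j Tj (trans (pick-no (hit? j) miss) r)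

  module _ {c : Colouring n} (sim : Simple c) (cos : Cosimple c) where
    open Cosimple cos

    -- The order follows the edges of `Q₁`: `e`, `f`, `h` are the star of a vertex, and `g`, `k`,
    -- `l` complete the pairs `e f`, `e h`, `f h` to triangles.
    hexad : (e f h g k l : Fin n) → Fin 6 → Fin n
    hexad e f h g k l = lookup (e ∷ f ∷ h ∷ g ∷ k ∷ l ∷ [])

    record Hexad (e f h g k l : Fin n) : Set where
      constructor mk
      field
        distinct : UniqueVec (e ∷ f ∷ h ∷ g ∷ k ∷ l ∷ [])
        ce : c e ≡ act
        cf : c f ≡ act
        ch : c h ≡ act
        cg : c g ≡ act
        ck : c k ≡ act
        cl : c l ≡ act

      inj : Injective _≡_ _≡_ (hexad e f h g k l)
      inj = lookup-injective distinct _ _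

      active : ∀ x → c (hexad e f h g k l x) ≡ act
      active zero = ce
      active (suc zero) = cf
      active (suc (suc zero)) = ch
      active (suc (suc (suc zero))) = cg
      active (suc (suc (suc (suc zero)))) = ck
      active (suc (suc (suc (suc (suc zero))))) = cl

    six : ∀ T e f h g k l {x₀ x₁ x₂ x₃ x₄ x₅} →
          T ! e ≡ x₀ → T ! f ≡ x₁ → T ! h ≡ x₂ → T ! g ≡ x₃ → T ! k ≡ x₄ → T ! l ≡ x₅ →
          ∀ x → T ! hexad e f h g k l x ≡ (x₀ ∷ x₁ ∷ x₂ ∷ x₃ ∷ x₄ ∷ x₅ ∷ []) ! x
    six _ _ _ _ _ _ _ p q r s t u zero = p
    six _ _ _ _ _ _ _ p q r s t u (suc zero) = q
    six _ _ _ _ _ _ _ p q r s t u (suc (suc zero)) = r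
    six _ _ _ _ _ _ _ p q r s t u (suc (suc (suc zero))) = s
    six _ _ _ _ _ _ _ p q r s t u (suc (suc (suc (suc zero)))) = t
    six _ _ _ _ _ _ _ p q r s t u (suc (suc (suc (suc (suc zero))))) = u

    -- All other active elements are deleted. What then misses `g`, `k`, `l` is supported on the
    -- triad and vanishes by `triad-independent`.
    triangles⇒K₄ : ∀ {e f g h k l} → Triad c e f h → Triangle c e f g → Triangle c e h k → Triangle c f h l → h ≢ g → K₄-minor
    triangles⇒K₄ {e} {f} {g} {h} {k} {l} v t u w h≢g =
      build {t.T} {u.T} {w.T}
        (allowed-forth t.allowed λ j cj Tj → inj₁ ([ at (# 0) , [ at (# 1) , at (# 3) ]′ ]′ (t.only j cj Tj)))
        (six t.T e f h g k l t.Ta t.Tb (t.off h u.cb (≢-sym u.a≢b) h≢f h≢g) t.Td (t.off k u.cd (≢-sym u.a≢d) k≢f k≢g) (t.off l w.cd l≢e (≢-sym w.a≢d) l≢g))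
        (allowed-forth u.allowed λ j cj Tj → inj₁ ([ at (# 0) , [ at (# 2) , at (# 4) ]′ ]′ (u.only j cj Tj)))
        (six u.T e f h g k l u.Ta (u.off f t.cb (≢-sym t.a≢b) (≢-sym h≢f) (≢-sym k≢f)) u.Tb (u.off g t.cd (≢-sym t.a≢d) (≢-sym h≢g) (≢-sym k≢g)) u.Td (u.off l w.cd l≢e (≢-sym w.b≢d) (≢-sym k≢l)))
        (allowed-forth w.allowed λ j cj Tj → inj₁ ([ at (# 1) , [ at (# 2) , at (# 5) ]′ ]′ (w.only j cj Tj)))
        (six w.T e f h g k l (w.off e t.ca t.a≢b u.a≢b (≢-sym l≢e)) w.Ta w.Tb (w.off g t.cd (≢-sym t.b≢d) (≢-sym h≢g) (≢-sym l≢g)) (w.off k u.cd k≢f (≢-sym u.b≢d) k≢l) w.Td)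
        reduced
      where
      module t = Triangle t
      module u = Triangle u
      module w = Triangle w
      h≢f : h ≢ f
      h≢f = ≢-sym w.a≢b
      k≢f : k ≢ f
      k≢f = two-triangles sim t u h≢f h≢g
      k≢g : k ≢ g
      k≢g = two-triangles sim (triangle-swapʳ t) u h≢g h≢f
      l≢e : l ≢ e
      l≢e = two-triangles sim (triangle-swap t) w (≢-sym u.a≢b) h≢g
      l≢g : l ≢ g
      l≢g = two-triangles sim (triangle-swapʳ (triangle-swap t)) w h≢g (≢-sym u.a≢b)
      k≢l : k ≢ l
      k≢l k≡l = two-triangles sim (triangle-swapʳ (triangle-swap u)) (triangle-swap w) (≢-sym k≢f) (≢-sym t.a≢b) (sym k≡l)
      hex : Hexad e f h g k l
      hex = mk ((t.a≢b ∷ u.a≢b ∷ t.a≢d ∷ u.a≢d ∷ ≢-sym l≢e ∷ []) ∷ (w.a≢b ∷ t.b≢d ∷ ≢-sym k≢f ∷ w.a≢d ∷ []) ∷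
                (h≢g ∷ u.b≢d ∷ w.b≢d ∷ []) ∷ (≢-sym k≢g ∷ ≢-sym l≢g ∷ []) ∷ (k≢l ∷ []) ∷ [] ∷ [])
               t.ca t.cb u.cb t.cd u.cd w.cd
      open Found {c} (hexad e f h g k l) (Hexad.inj hex) (Hexad.active hex) (del-instead ∘ c) (λ j → del-instead≢act (c j))
             (λ j e → cong del-instead e) (λ j e → cong del-instead e)
      at : ∀ i {j} → j ≡ hexad e f h g k l i → ∃ λ x → hexad e f h g k l x ≡ j
      at i refl = i , refl
      reduced : ∀ T → Allowed colour T → T ! g ≡ false → T ! k ≡ false → T ! l ≡ false → T ! e ≡ false × T ! f ≡ false × T ! h ≡ false
      reduced T aT Tg Tk Tl = triad-independent sim v T (allowed-back aT) off
        where
        off : ∀ j → c j ≡ act → j ≢ e → j ≢ f → j ≢ h → T ! j ≡ false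
        off j cj ≢e ≢f ≢h with j Fin.≟ g | j Fin.≟ k | j Fin.≟ l
        ... | yes refl | _ | _ = Tg
        ... | no _ | yes refl | _ = Tk
        ... | no _ | no _ | yes refl = Tl
        ... | no ≢g | no ≢k | no ≢l = off-del aT j miss (cong del-instead cj)
          where
          miss : ¬ (∃ λ x → hexad e f h g k l x ≡ j)
          miss (zero , q) = ≢e (sym q)
          miss (suc zero , q) = ≢f (sym q)
          miss (suc (suc zero) , q) = ≢h (sym q)
          miss (suc (suc (suc zero)) , q) = ≢g (sym q)
          miss (suc (suc (suc (suc zero))) , q) = ≢k (sym q)
          miss (suc (suc (suc (suc (suc zero)))) , q) = ≢l (sym q)

    -- Of a set separating `x` from `y`, one separating `x` from `z`, and their sum, at least one
    -- does both. Adding the triangle complements the values on `x`, `y`, `z` if `x` has the wrong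
    -- one.
    isolate : ∀ {x y z} → Triangle c x y z → ∃ λ T → Allowed c T × T ! x ≡ true × T ! y ≡ false × T ! z ≡ false
    isolate {x} {y} {z} t = normalise apart
      where
      open Triangle t renaming (T to R)
      Apart : Set
      Apart = ∃ λ T → Allowed c T × T ! x xor T ! y ≡ true × T ! x xor T ! z ≡ true
      odd-sum : ∀ p q r s {x y} → p xor q ≡ x → r xor s ≡ y → (p xor r) xor (q xor s) ≡ x xor y
      odd-sum p q r s refl refl = solve 4 (λ p q r s → (p :+ r) :+ (q :+ s) := (p :+ q) :+ (r :+ s)) refl p q r s
        where open xor-∧-Solver
      apart : Apart
      apart with separated x y ca cb a≢b | separated x z ca cd a≢d
      ... | T , aT , xy | S , aS , xz with T ! x xor T ! z in xz′ | S ! x xor S ! y in xy′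
      ...   | true  | _ = T , aT , xy , xz′
      ...   | false | true  = S , aS , xy′ , xz
      ...   | false | false = T ⊕ S , allowed-⊕ aT aS
              , trans (cong₂ _xor_ (!-⊕ T S x) (!-⊕ T S y)) (odd-sum (T ! x) (T ! y) (S ! x) (S ! y) xy xy′)
              , trans (cong₂ _xor_ (!-⊕ T S x) (!-⊕ T S z)) (odd-sum (T ! x) (T ! z) (S ! x) (S ! z) xz′ xz)
      lem₁ : ∀ {q} → true xor q ≡ true → q ≡ false
      lem₁ {false} _ = refl
      normalise : Apart → ∃ λ T → Allowed c T × T ! x ≡ true × T ! y ≡ false × T ! z ≡ false
      normalise (T , aT , xy , xz) with T ! x in Tx
      ... | true  = T , aT , Tx , lem₁ xy , lem₁ xz
      ... | false = T ⊕ R , allowed-⊕ aT allowed , ⊕-at T R x Tx Ta , ⊕-at T R y xy Tb , ⊕-at T R z xz Td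

    -- Dual to `triangles⇒K₄`: all other active elements are contracted, and the three triads let
    -- the values on `e`, `f`, `g` determine those on `h`, `s`, `t`. The sets isolating `e` and `f`
    -- then have the traces of the other two basis triangles.
    triads⇒K₄ : ∀ {e f g h s t} → Triangle c e f g → Triad c e f h → Triad c e g s → Triad c f g t → h ≢ g → K₄-minor
    triads⇒K₄ {e} {f} {g} {h} {s} {t} Δ u v w h≢g with isolate Δ | isolate (triangle-swap Δ)
    ... | B , aB , Be , Bf , Bg | C , aC , Cf , Ce , Cg =
      build {Δ.T} {B} {C}
        (forth Δ.allowed) (six Δ.T e f h g s t Δ.Ta Δ.Tb (Δ.off h u.cd (≢-sym u.a≢d) (≢-sym u.b≢d) h≢g) Δ.Td (Δ.off s v.cd (≢-sym v.a≢d) s≢f (≢-sym v.b≢d)) (Δ.off t w.cd t≢e (≢-sym w.a≢d) (≢-sym w.b≢d)))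
        (forth aB) (six B e f h g s t Be Bf (third u B aB Be Bf) Bg (third v B aB Be Bg) (third w B aB Bf Bg))
        (forth aC) (six C e f h g s t Ce Cf (third u C aC Ce Cf) Cg (third v C aC Ce Cg) (third w C aC Cf Cg))
        reduced
      where
      module Δ = Triangle Δ
      module u = Triad u
      module v = Triad v
      module w = Triad w
      s≢f : s ≢ f
      s≢f = two-triads cos u v (≢-sym Δ.b≢d) (≢-sym h≢g)
      s≢h : s ≢ h
      s≢h = two-triads cos (triad-swapʳ u) v (≢-sym h≢g) (≢-sym Δ.b≢d)
      t≢e : t ≢ e
      t≢e = two-triads cos (triad-swap u) w (≢-sym Δ.a≢d) (≢-sym h≢g)
      t≢h : t ≢ h
      t≢h = two-triads cos (triad-swapʳ (triad-swap u)) w (≢-sym h≢g) (≢-sym Δ.a≢d)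
      t≢s : t ≢ s
      t≢s = two-triads cos (triad-swapʳ (triad-swap v)) (triad-swap w) (≢-sym s≢f) (≢-sym Δ.a≢b)
      hex : Hexad e f h g s t
      hex = mk ((Δ.a≢b ∷ u.a≢d ∷ Δ.a≢d ∷ v.a≢d ∷ ≢-sym t≢e ∷ []) ∷ (u.b≢d ∷ Δ.b≢d ∷ ≢-sym s≢f ∷ w.a≢d ∷ []) ∷
                (h≢g ∷ ≢-sym s≢h ∷ ≢-sym t≢h ∷ []) ∷ (v.b≢d ∷ w.b≢d ∷ []) ∷ (≢-sym t≢s ∷ []) ∷ [] ∷ [])
               Δ.ca Δ.cb u.cd Δ.cd v.cd w.cd
      open Found {c} (hexad e f h g s t) (Hexad.inj hex) (Hexad.active hex) (con-instead ∘ c) (λ j → con-instead≢act (c j))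
             (λ j e → cong con-instead e) (λ j e → cong con-instead e)
      forth : ∀ {T} → Allowed c T → Allowed colour T
      forth aT = allowed-forth aT λ j cj _ → inj₂ λ q → contradiction (trans (sym (cong con-instead cj)) q) λ ()
      reduced : ∀ T → Allowed colour T → T ! g ≡ false → T ! s ≡ false → T ! t ≡ false → T ! e ≡ false × T ! f ≡ false × T ! h ≡ false
      reduced T aT Tg Ts Tt = Te , Tf , third u T (allowed-back aT) Te Tf
        where
        Te = third (triad-swap (triad-swapʳ (triad-swap v))) T (allowed-back aT) Ts Tg
        Tf = third (triad-swap (triad-swapʳ (triad-swap w))) T (allowed-back aT) Tt Tg

    restZ : Subset n → Fin n → Colour → Colour
    restZ Z j act = if Z ! j then con else del
    restZ Z j con = con
    restZ Z j del = del

    restZ≢act : ∀ Z j k → restZ Z j k ≢ act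
    restZ≢act Z j act e with Z ! j
    restZ≢act Z j act () | true
    restZ≢act Z j act () | false
    restZ≢act Z j con ()
    restZ≢act Z j del ()

    -- e f g and e h k are triangles and e f h and e g k triads, as in K₄
    -- minus the edge l.  The series pair that f g would otherwise be forces
    -- a cycle Z meeting the five elements in f h; a minimal one supplies l
    -- once all but one of its other elements are contracted.
    diamond⇒K₄ : ∀ {e f g h k} → Triangle c e f g → Triangle c e h k → Triad c e f h → Triad c e g k → h ≢ g → K₄-minor
    diamond⇒K₄ {e} {f} {g} {h} {k} t u v w h≢g = finish (minimal Diag? μ _ (proj₂ diag))
      where
      module t = Triangle t
      module u = Triangle u
      module v = Triad v
      module w = Triad w
      h≢f : h ≢ f
      h≢f = ≢-sym v.b≢d
      k≢f : k ≢ f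
      k≢f = two-triangles sim t u h≢f h≢g
      k≢g : k ≢ g
      k≢g = ≢-sym w.b≢d

      Diag : Subset n → Set
      Diag T = Allowed c T × T ! e ≡ false × T ! f ≡ true × T ! g ≡ false

      Diag? : ∀ T → Dec (Diag T)
      Diag? T = allowed? c T ×-dec ((T ! e Bool.≟ false) ×-dec ((T ! f Bool.≟ true) ×-dec (T ! g Bool.≟ false)))

      diag : ∃ Diag
      diag = fix-e (fix-f (separated f g t.cb t.cd t.b≢d))
        where
        fix-f : Separated c f g → ∃ λ T → Allowed c T × T ! f ≡ true × T ! g ≡ false
        fix-f (T , aT , fg) with T ! f in Tf | T ! g in Tg
        ... | true  | false = T , aT , Tf , Tg
        ... | false | true  = T ⊕ t.T , allowed-⊕ aT t.allowed , ⊕-at T t.T f Tf t.Tb , ⊕-at T t.T g Tg t.Td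
        fix-e : (∃ λ T → Allowed c T × T ! f ≡ true × T ! g ≡ false) → ∃ Diag
        fix-e (T , aT , Tf , Tg) with T ! e in Te
        ... | false = T , aT , Te , Tf , Tg
        ... | true  = T ⊕ u.T , allowed-⊕ aT u.allowed , ⊕-at T u.T e Te u.Ta
                    , ⊕-at T u.T f Tf (u.off f t.cb (≢-sym t.a≢b) (≢-sym h≢f) (≢-sym k≢f))
                    , ⊕-at T u.T g Tg (u.off g t.cd (≢-sym t.a≢d) (≢-sym h≢g) (≢-sym k≢g))

      trace : Subset n → Fin n → Bool
      trace T j = does (act? (c j)) ∧ T ! j

      μ : Subset n → ℕ
      μ T = count (trace T)

      finish : (∃ λ Z → Diag Z × ∀ T → Diag T → μ Z ≤ μ T) → K₄-minor
      finish (Z , (aZ , Ze , Zf , Zg) , min) with Fin.any? (λ l → act? (c l) ×-dec ((Z ! l Bool.≟ true) ×-dec (¬? (l Fin.≟ f) ×-dec ¬? (l Fin.≟ h))))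
      ... | no none = ⊥-elim (no-pair sim Z aZ f h t.cb u.cb Zf (third v Z aZ Ze Zf)
                        λ j cj ≢f ≢h → ≢true⇒false λ Zj → none (j , cj , Zj , ≢f , ≢h))
      ... | yes (l , cl , Zl , l≢f , l≢h) =
        build {t.T} {u.T} {Z}
          (allowed-forth t.allowed λ j cj Tj → inj₁ ([ at (# 0) , [ at (# 1) , at (# 3) ]′ ]′ (t.only j cj Tj)))
          (six t.T e f h g k l t.Ta t.Tb (t.off h u.cb (≢-sym u.a≢b) h≢f h≢g) t.Td (t.off k u.cd (≢-sym u.a≢d) k≢f k≢g) (t.off l cl l≢e l≢f l≢g))
          (allowed-forth u.allowed λ j cj Tj → inj₁ ([ at (# 0) , [ at (# 2) , at (# 4) ]′ ]′ (u.only j cj Tj)))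
          (six u.T e f h g k l u.Ta (u.off f t.cb (≢-sym t.a≢b) (≢-sym h≢f) (≢-sym k≢f)) u.Tb (u.off g t.cd (≢-sym t.a≢d) (≢-sym h≢g) (≢-sym k≢g)) u.Td (u.off l cl l≢e l≢h l≢k))
          (allowed-forth aZ λ j cj Zj → inj₂ λ q → contradiction (trans (sym (restZ-in j cj Zj)) q) λ ())
          (six Z e f h g k l Ze Zf (third v Z aZ Ze Zf) Zg Zk Zl)
          reduced
        where
        Zk : Z ! k ≡ false
        Zk = third w Z aZ Ze Zg
        apart : ∀ {x} → Z ! x ≡ false → l ≢ x
        apart Zx refl = true≢false Zl Zx
        l≢e : l ≢ e
        l≢e = apart Ze
        l≢g : l ≢ g
        l≢g = apart Zg
        l≢k : l ≢ k
        l≢k = apart Zk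
        rest : Colouring n
        rest j = restZ Z j (c j)
        restZ-in : ∀ j → c j ≡ act → Z ! j ≡ true → rest j ≡ con
        restZ-in j cj Zj rewrite cj | Zj = refl
        restZ-out : ∀ j → c j ≡ act → Z ! j ≡ false → rest j ≡ del
        restZ-out j cj Zj rewrite cj | Zj = refl
        hex : Hexad e f h g k l
        hex = mk ((t.a≢b ∷ u.a≢b ∷ t.a≢d ∷ u.a≢d ∷ ≢-sym l≢e ∷ []) ∷ (≢-sym h≢f ∷ t.b≢d ∷ ≢-sym k≢f ∷ ≢-sym l≢f ∷ []) ∷
                  (h≢g ∷ u.b≢d ∷ ≢-sym l≢h ∷ []) ∷ (≢-sym k≢g ∷ ≢-sym l≢g ∷ []) ∷ (≢-sym l≢k ∷ []) ∷ [] ∷ [])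
                 t.ca t.cb u.cb t.cd u.cd cl
        open Found {c} (hexad e f h g k l) (Hexad.inj hex) (Hexad.active hex) rest (λ j → restZ≢act Z j (c j))
               (λ j e → cong (restZ Z j) e) (λ j e → cong (restZ Z j) e)
        at : ∀ i {j} → j ≡ hexad e f h g k l i → ∃ λ x → hexad e f h g k l x ≡ j
        at i refl = i , refl
        reduced : ∀ T → Allowed colour T → T ! g ≡ false → T ! k ≡ false → T ! l ≡ false → T ! e ≡ false × T ! f ≡ false × T ! h ≡ false
        reduced T aT Tg Tk Tl with T ! f in Tf | third (triad-swap (triad-swapʳ (triad-swap w))) T (allowed-back aT) Tk Tg
        ... | false | Te = Te , refl , third v T (allowed-back aT) Te Tf
        -- Such a `T` satisfies `Diag`, and its active elements lie in `Z` without `l`, against the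
        -- minimality of `Z`.
        ... | true  | Te = contradiction (min T (allowed-back aT , Te , Tf , Tg)) (ℕ.<⇒≱ smaller)
          where
          inZ : ∀ j → trace T j ≡ true → (trace Z ∖ l) j ≡ true
          inZ j e′ with ∧-split {does (act? (c j))} e′
          ... | a , Tj = ∖-intro (trace Z) l (∧-intro a Zj) λ { refl → true≢false Tj Tl }
            where
            Zj : Z ! j ≡ true
            Zj with Z ! j in Zj
            ... | true  = refl
            ... | false = contradiction (off-del aT j miss (restZ-out j (does⇒ (act? (c j)) a) Zj)) (true≢false Tj)
              where
              miss : ¬ (∃ λ x → hexad e f h g k l x ≡ j)
              miss (zero , refl) = true≢false Tj Te
              miss (suc zero , refl) = true≢false Zf Zj
              miss (suc (suc zero) , refl) = true≢false (third v Z aZ Ze Zf) Zj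
              miss (suc (suc (suc zero)) , refl) = true≢false Tj Tg
              miss (suc (suc (suc (suc zero))) , refl) = true≢false Tj Tk
              miss (suc (suc (suc (suc (suc zero)))) , refl) = true≢false Tj Tl
          smaller : μ T < μ Z
          smaller = subst (μ T <_) (sym (count-∖ (trace Z) l (∧-intro (dec-true (act? (c l)) cl) Zl)))
            (s≤s (count-mono inZ))

-- Descent of simple and cosimple minors to M(K₄)

module Reduction {n : ℕ} (𝒦 : Space n) where
  open Space 𝒦
  open Minors 𝒦
  open Structure 𝒦

  ↦-elim : ∀ (c : Colouring n) {e k k′ j} → k ≢ k′ → (c [ e ↦ k ]) j ≡ k′ → c j ≡ k′ × j ≢ e
  ↦-elim c {e} {j = j} k≢ eq with j Fin.≟ e
  ... | yes refl = contradiction eq k≢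
  ... | no j≢e   = eq , j≢e

  ↦-intro : ∀ (c : Colouring n) {e k k′ j} → c e ≡ act → act ≢ k′ → c j ≡ k′ → (c [ e ↦ k ]) j ≡ k′
  ↦-intro c {e} {j = j} ce k≢ eq with j Fin.≟ e
  ... | yes refl = contradiction (trans (sym ce) eq) k≢
  ... | no _ = eq

  allowed-sub : ∀ {c c′ : Colouring n} {T} → (∀ j → T ! j ≡ true → c′ j ≡ del → c j ≡ del) → Allowed c T → Allowed c′ T
  allowed-sub h (KT , aT) = KT , λ j Tj c′j → aT j Tj (h j Tj c′j)

  off-deleted : ∀ {c : Colouring n} {T e} → Allowed c T → c e ≡ del → T ! e ≡ false
  off-deleted {e = e} (_ , aT) ce = ≢true⇒false λ Te → aT e Te ce

  delete-allowed : ∀ (c : Colouring n) {e T} → Allowed c T → T ! e ≡ false → Allowed (c [ e ↦ del ]) T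
  delete-allowed c {e} {T} aT Te = allowed-sub lem aT
    where
    lem : ∀ j → T ! j ≡ true → (c [ e ↦ del ]) j ≡ del → c j ≡ del
    lem j Tj eq with j Fin.≟ e
    ... | yes refl = contradiction Te (true≢false Tj)
    ... | no _ = eq

  delete-simple : ∀ c e → c e ≡ act → Simple c → Simple (c [ e ↦ del ])
  delete-simple c e ce (simple noSmall) = simple λ a b (ca , cb , T , aT , Ta , Tb , only) →
    noSmall a b (proj₁ (↦-elim c (λ ()) ca) , proj₁ (↦-elim c (λ ()) cb) , T , allowed-sub (λ j _ cj → ↦-intro c ce (λ ()) cj) aT , Ta , Tb
                , λ j cj Tj → only j (trans (↦-other c del (λ { refl → true≢false Tj (off-deleted aT (↦-same c e del)) })) cj) Tj)

  contract-cosimple : ∀ c e → Cosimple c → Cosimple (c [ e ↦ con ])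
  contract-cosimple c e (cosimple covered separated) = cosimple
    (λ a ca → let (T , aT , Ta) = covered a (proj₁ (↦-elim c (λ ()) ca)) in T , forth aT , Ta)
    (λ a b ca cb a≢b → let (T , aT , Tab) = separated a b (proj₁ (↦-elim c (λ ()) ca)) (proj₁ (↦-elim c (λ ()) cb)) a≢b in T , forth aT , Tab)
    where
    forth : ∀ {T} → Allowed c T → Allowed (c [ e ↦ con ]) T
    forth aT = allowed-sub (λ j _ → proj₁ ∘ ↦-elim c λ ()) aT

  -- The recursion needs an element that survives the removal of `e`. Were `e` alone, the set
  -- covering it would be a loop.
  another : ∀ c → Simple c → Cosimple c → ∀ e → c e ≡ act → ∃ λ j → c j ≡ act × j ≢ e
  another c (simple noSmall) (cosimple covered _) e ce with Fin.any? (λ j → act? (c j) ×-dec ¬? (j Fin.≟ e))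
  ... | yes j = j
  ... | no none with covered e ce
  ...   | T , aT , Te = ⊥-elim (noSmall e e (ce , ce , T , aT , Te , Te ,
            λ j cj _ → inj₁ (decidable-stable (j Fin.≟ e) λ j≢e → none (j , cj , j≢e))))

  -- The triangle `e h k` meets the triad `e g s` in `e`, hence in `g` or `s`. It does not contain
  -- `g`, and `s` is not `h` because two triads share at most one element.
  diamond : ∀ {c} → Simple c → Cosimple c → ∀ {e f g h k s} → Triangle c e f g → Triangle c e h k →
            Triad c e f h → Triad c e g s → h ≢ g → s ≡ k
  diamond sim cos {g = g} {s = s} t u v w h≢g with triad-meets w (Triangle.T u) (Triangle.allowed u) (Triangle.Ta u)
  ... | inj₁ Tg = contradiction (Triangle.off u g (Triangle.cd t) (≢-sym (Triangle.a≢d t)) (≢-sym h≢g)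
                    (≢-sym (two-triangles sim (triangle-swapʳ t) u h≢g (≢-sym (Triad.b≢d v))))) (true≢false Tg)
  ... | inj₂ Ts with Triangle.only u s (Triad.cd w) Ts
  ...   | inj₁ s≡e = contradiction (sym s≡e) (Triad.a≢d w)
  ...   | inj₂ (inj₁ s≡h) = contradiction s≡h (two-triads cos (triad-swapʳ v) w (≢-sym h≢g) (≢-sym (Triangle.b≢d t)))
  ...   | inj₂ (inj₂ s≡k) = s≡k

  irreducible⇒K₄ : ∀ c → Acc _<_ (size-act c) → Simple c → Cosimple c → ∀ e → c e ≡ act → K₄-minor
  irreducible⇒K₄ c (acc rs) sim cos e₀ ce₀ = start
    where
    -- With `e` contracted and `f` deleted, a failure of simplicity is a triangle through `e`
    -- avoiding `f`, which by orthogonality to the triad contains `h`. A failure of cosimplicity is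
    -- a triad through `f` avoiding `e`, which by orthogonality to the triangle contains `g`.
    attempt : ∀ {e f g h} → Triangle c e f g → Triad c e f h → h ≢ g →
              K₄-minor ⊎ (∃ (Triangle c e h) ⊎ ∃ (Triad c f g))
    attempt {e} {f} {g} {h} t v h≢g
      = result (simple-or-triangle c sim e t.ca c′ back sub-e sup) (cosimple-or-triad c cos f t.cb c′ forth sub-f)
      where
      module t = Triangle t
      c′ : Colouring n
      c′ = c [ f ↦ del ] [ e ↦ con ]
      c′f : c′ f ≡ del
      c′f = trans (↦-other (c [ f ↦ del ]) con (≢-sym t.a≢b)) (↦-same c f del)
      sub-e : ∀ j → c′ j ≡ act → c j ≡ act × j ≢ e
      sub-e j c′j with ↦-elim (c [ f ↦ del ]) (λ ()) c′j
      ... | cj , j≢e = proj₁ (↦-elim c (λ ()) cj) , j≢e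
      sub-f : ∀ j → c′ j ≡ act → c j ≡ act × j ≢ f
      sub-f j c′j = ↦-elim c (λ ()) (proj₁ (↦-elim (c [ f ↦ del ]) (λ ()) c′j))
      back : ∀ T → Allowed c′ T → Allowed c T
      back T = allowed-sub λ j _ cj → ↦-intro (c [ f ↦ del ]) (trans (↦-other c del t.a≢b) t.ca) (λ ()) (↦-intro c t.cb (λ ()) cj)
      forth : ∀ T → Allowed c T → T ! f ≡ false → Allowed c′ T
      forth T aT Tf = allowed-sub (λ j _ → proj₁ ∘ ↦-elim (c [ f ↦ del ]) λ ()) (delete-allowed c aT Tf)
      sup : ∀ j → c j ≡ act → j ≢ e → c′ j ≡ act ⊎ (∀ T → Allowed c′ T → T ! j ≡ false)
      sup j cj j≢e = by (j Fin.≟ f)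
        where
        by : Dec (j ≡ f) → _
        by (yes refl) = inj₂ λ T aT → off-deleted aT c′f
        by (no j≢f)   = inj₁ (trans (↦-other (c [ f ↦ del ]) con j≢e) (trans (↦-other c del j≢f) cj))
      c′g : c′ g ≡ act
      c′g = trans (↦-other (c [ f ↦ del ]) con (≢-sym t.a≢d)) (trans (↦-other c del (≢-sym t.b≢d)) t.cd)
      is-g : ∀ {j} → c′ j ≡ act → t.T ! j ≡ true → j ≡ g
      is-g {j} c′j Tj with t.only j (proj₁ (sub-e j c′j)) Tj
      ... | inj₁ j≡e = contradiction j≡e (proj₂ (sub-e j c′j))
      ... | inj₂ (inj₁ j≡f) = contradiction j≡f (proj₂ (sub-f j c′j))
      ... | inj₂ (inj₂ j≡g) = j≡g
      third-triad : ∀ {a b} → c′ a ≡ act → c′ b ≡ act → Triad c f a b → t.T ! a ≡ true ⊎ t.T ! b ≡ true → ∃ (Triad c f g)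
      third-triad c′a c′b w (inj₁ Ta) with is-g c′a Ta
      ... | refl = _ , w
      third-triad c′a c′b w (inj₂ Tb) with is-g c′b Tb
      ... | refl = _ , triad-swapʳ w
      third-triangle : ∀ {a b} (u : Triangle c e a b) → Triangle.T u ! f ≡ false →
                       Triangle.T u ! f ≡ true ⊎ Triangle.T u ! h ≡ true → ∃ (Triangle c e h)
      third-triangle u Uf (inj₁ Tf) = contradiction Uf (true≢false Tf)
      third-triangle u Uf (inj₂ Th) with Triangle.only u h (Triad.cd v) Th
      ... | inj₁ h≡e = contradiction (sym h≡e) (Triad.a≢d v)
      ... | inj₂ (inj₁ refl) = _ , u
      ... | inj₂ (inj₂ refl) = _ , triangle-swapʳ u
      result : Simple c′ ⊎ _ → Cosimple c′ ⊎ _ → K₄-minor ⊎ (∃ (Triangle c e h) ⊎ ∃ (Triad c f g))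
      result (inj₁ sim′) (inj₁ cos′) = inj₁ (irreducible⇒K₄ c′ (rs (size-act-decreases c c′ e t.ca sub-e)) sim′ cos′ g c′g)
      result (inj₂ (_ , _ , _ , _ , u , aU)) _ =
        inj₂ (inj₁ (third-triangle u (off-deleted aU c′f) (triad-meets v (Triangle.T u) (Triangle.allowed u) (Triangle.Ta u))))
      result (inj₁ _) (inj₂ (_ , _ , c′a , c′b , w)) =
        inj₂ (inj₂ (third-triad c′a c′b w (triad-meets w t.T t.allowed t.Tb)))

    -- The attempt is made with `e` and `f` in both roles. Two new triangles, two new triads, or one
    -- of each lead to the three constructions of M(K₄).
    fan : ∀ {e f g h} → Triangle c e f g → Triad c e f h → K₄-minor
    fan {e} {f} {g} {h} t v = cases (attempt t v h≢g) (attempt (triangle-swap t) (triad-swap v) h≢g)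
      where
      h≢g : h ≢ g
      -- Otherwise the triangle and the triad would meet in three elements, an odd number.
      h≢g refl = contradiction (trans (sym (cong₂ _xor_ (Triangle.Ta t) (cong₂ _xor_ (Triangle.Tb t) (Triangle.Td t))))
                                      (Triad.even v (Triangle.T t) (Triangle.allowed t))) λ ()
      cases : K₄-minor ⊎ (∃ (Triangle c e h) ⊎ ∃ (Triad c f g)) → K₄-minor ⊎ (∃ (Triangle c f h) ⊎ ∃ (Triad c e g)) → K₄-minor
      cases (inj₁ m) _ = m
      cases (inj₂ _) (inj₁ m) = m
      cases (inj₂ (inj₁ (k , u))) (inj₂ (inj₁ (l , w))) = triangles⇒K₄ sim cos v t u w h≢g
      cases (inj₂ (inj₂ (s , u))) (inj₂ (inj₂ (r , w))) = triads⇒K₄ sim cos t v w u h≢g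
      cases (inj₂ (inj₁ (k , u))) (inj₂ (inj₂ (s , w))) with diamond sim cos t u v w h≢g
      ... | refl = diamond⇒K₄ sim cos t u v w h≢g
      cases (inj₂ (inj₂ (s , w))) (inj₂ (inj₁ (l , u))) with diamond sim cos (triangle-swap t) u (triad-swap v) w h≢g
      ... | refl = diamond⇒K₄ sim cos (triangle-swap t) u (triad-swap v) w h≢g

    -- By orthogonality the triangle and the triad share an element besides `e`.
    meet : ∀ {e a b p q} → Triangle c e a b → Triad c e p q → K₄-minor
    meet {a = a} {b} {p} {q} t v with triad-meets v (Triangle.T t) (Triangle.allowed t) (Triangle.Ta t)
    ... | inj₁ Tp with Triangle.only t p (Triad.cb v) Tp
    ...   | inj₁ p≡e = contradiction (sym p≡e) (Triad.a≢b v)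
    ...   | inj₂ (inj₁ refl) = fan t v
    ...   | inj₂ (inj₂ refl) = fan (triangle-swapʳ t) v
    meet {a = a} {b} {p} {q} t v | inj₂ Tq with Triangle.only t q (Triad.cd v) Tq
    ...   | inj₁ q≡e = contradiction (sym q≡e) (Triad.a≢d v)
    ...   | inj₂ (inj₁ refl) = fan t (triad-swapʳ v)
    ...   | inj₂ (inj₂ refl) = fan (triangle-swapʳ t) (triad-swapʳ v)

    start : K₄-minor
    start with another c sim cos e₀ ce₀
             | cosimple-or-triad c cos e₀ ce₀ (c [ e₀ ↦ del ]) (λ T → delete-allowed c) (λ j → ↦-elim c λ ())
             | simple-or-triangle c sim e₀ ce₀ (c [ e₀ ↦ con ])
                 (λ T → allowed-sub λ j _ → ↦-intro c ce₀ λ ()) (λ j → ↦-elim c λ ())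
                 (λ j cj j≢e → inj₁ (trans (↦-other c con j≢e) cj))
    ... | j , cj , j≢e | inj₁ cos′ | _ =
      irreducible⇒K₄ (c [ e₀ ↦ del ]) (rs (size-act-decreases c _ e₀ ce₀ λ _ → ↦-elim c λ ()))
        (delete-simple c e₀ ce₀ sim) cos′ j (trans (↦-other c del j≢e) cj)
    ... | j , cj , j≢e | inj₂ _ | inj₁ sim′ =
      irreducible⇒K₄ (c [ e₀ ↦ con ]) (rs (size-act-decreases c _ e₀ ce₀ λ _ → ↦-elim c λ ()))
        sim′ (contract-cosimple c e₀ cos) j (trans (↦-other c con j≢e) cj)
    ... | _ | inj₂ (p , q , _ , _ , v) | inj₂ (a , b , _ , _ , t , _) = meet t v

-- Series-parallel extensions of gammoids

module _ {v : ℕ} (Arc : Fin v → Fin v → Bool) (N : Fin v → Bool) where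

  -- No arc enters the new vertex, so a flow restricts to the old vertices.
  add-vertex : Fin (suc v) → Fin (suc v) → Bool
  add-vertex zero zero = false
  add-vertex zero (suc y) = N y
  add-vertex (suc x) zero = false
  add-vertex (suc x) (suc y) = Arc x y

  module _ {T : Subset v} {F : Fin (suc v) → Set} where

    private
      lower : Fin (suc v) → Fin v → Fin v
      lower zero d = d
      lower (suc y) d = y

      suc∉ : ∀ {b x} → x ∉ T → suc x ∉ (b ∷ T)
      suc∉ x∉T (there x∈T) = x∉T x∈T

    module _ {b : Bool} (φ : Flow add-vertex (_∈ (b ∷ T)) F) where
      open Flow φ

      suc-next : ∀ x → x ∉ T → next (suc x) ≡ suc (lower (next (suc x)) x)
      suc-next x x∉T with next (suc x) | arc (suc x) (suc∉ x∉T)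
      ... | suc y | _ = refl
      ... | zero  | inj₁ ()
      ... | zero  | inj₂ ()

      restrict : Flow Arc (_∈ T) (F ∘ suc)
      restrict = record
        { next  = λ x → lower (next (suc x)) x
        ; arc   = arc′
        ; inj   = λ x y x∉T y∉T eq → Fin.suc-injective (inj (suc x) (suc y) (suc∉ x∉T) (suc∉ y∉T)
                    (trans (suc-next x x∉T) (trans (cong suc eq) (sym (suc-next y y∉T)))))
        ; avoid = λ x x∉T Fx → avoid (suc x) (suc∉ x∉T) (subst F (sym (suc-next x x∉T)) Fx) }
        where
        arc′ : ∀ x → x ∉ T → x ≡ lower (next (suc x)) x ⊎ Arc x (lower (next (suc x)) x) ≡ true
        arc′ x x∉T with next (suc x) | arc (suc x) (suc∉ x∉T)
        ... | suc y | inj₁ refl = inj₁ refl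
        ... | suc y | inj₂ a = inj₂ a
        ... | zero  | inj₁ ()
        ... | zero  | inj₂ ()

    -- If the new vertex moves to `y`, injectivity keeps the rest of the flow away from `y`: linking
    -- the new vertex amounts to linking `y` in its place.
    restrict-source : Flow add-vertex (_∈ (false ∷ T)) F →
      ¬ F zero ⊎ ∃ λ y → N y ≡ true × ¬ F (suc y) × Flow Arc (_∈ T) (λ z → F (suc z) ⊎ z ≡ y)
    restrict-source φ with Flow.next φ zero in eq | Flow.arc φ zero (λ ()) | Flow.avoid φ zero (λ ())
    ... | zero  | _ | ¬F0 = inj₁ ¬F0
    ... | suc y | inj₂ a | ¬Fy = inj₂ (y , a , ¬Fy , record
            { next = next ; arc = arc ; inj = inj
            ; avoid = λ { x x∉T (inj₁ Fx) → avoid x x∉T Fx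
                        ; x x∉T (inj₂ e) → Fin.0≢1+n (Flow.inj φ zero (suc x) (λ ()) (suc∉ x∉T)
                            (trans eq (trans (cong suc (sym e)) (sym (suc-next φ x x∉T))))) } })
      where open Flow (restrict φ)

    extend-with : ∀ {b} (y : Fin (suc v)) → (zero ∉ (b ∷ T) → zero ≡ y ⊎ add-vertex zero y ≡ true) → (zero ∉ (b ∷ T) → ¬ F y) →
      (φ : Flow Arc (_∈ T) (F ∘ suc)) → (∀ x → x ∉ T → zero ∉ (b ∷ T) → y ≢ suc (Flow.next φ x)) → Flow add-vertex (_∈ (b ∷ T)) F
    extend-with {b} y arc₀ avoid₀ φ fresh = record { next = next′ ; arc = arc′ ; inj = inj′ ; avoid = avoid′ }
      where
      open Flow φ
      pred∉ : ∀ {x} → suc x ∉ (b ∷ T) → x ∉ T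
      pred∉ ∉ ∈ = ∉ (there ∈)
      next′ : Fin (suc v) → Fin (suc v)
      next′ zero = y
      next′ (suc x) = suc (next x)
      arc′ : ∀ x → x ∉ (b ∷ T) → x ≡ next′ x ⊎ add-vertex x (next′ x) ≡ true
      arc′ zero ∉ = arc₀ ∉
      arc′ (suc x) ∉ with arc x (pred∉ ∉)
      ... | inj₁ e = inj₁ (cong suc e)
      ... | inj₂ a = inj₂ a
      inj′ : ∀ x z → x ∉ (b ∷ T) → z ∉ (b ∷ T) → next′ x ≡ next′ z → x ≡ z
      inj′ zero zero _ _ _  = refl
      inj′ zero (suc z) ∉ ∉′ e = contradiction e (fresh z (pred∉ ∉′) ∉)
      inj′ (suc x) zero ∉ ∉′ e = contradiction (sym e) (fresh x (pred∉ ∉) ∉′)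
      inj′ (suc x) (suc z) ∉ ∉′ e = cong suc (inj x z (pred∉ ∉) (pred∉ ∉′) (Fin.suc-injective e))
      avoid′ : ∀ x → x ∉ (b ∷ T) → ¬ F (next′ x)
      avoid′ zero ∉ = avoid₀ ∉
      avoid′ (suc x) ∉ = avoid x (pred∉ ∉)

    extend-sink : Flow Arc (_∈ T) (F ∘ suc) → Flow add-vertex (_∈ (true ∷ T)) F
    extend-sink φ = extend-with zero (λ ∉ → contradiction here ∉) (λ ∉ → contradiction here ∉) φ (λ _ _ ∉ → contradiction here ∉)

    extend-free : ∀ {b} → ¬ F zero → Flow Arc (_∈ T) (F ∘ suc) → Flow add-vertex (_∈ (b ∷ T)) F
    extend-free ¬F0 φ = extend-with zero (λ _ → inj₁ refl) (λ _ → ¬F0) φ (λ _ _ _ → Fin.0≢1+n)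

    extend-source : ∀ {b} y → N y ≡ true → ¬ F (suc y) → Flow Arc (_∈ T) (λ z → F (suc z) ⊎ z ≡ y) → Flow add-vertex (_∈ (b ∷ T)) F
    extend-source y Ny ¬Fy φ = extend-with (suc y) (λ _ → inj₂ Ny) (λ _ → ¬Fy) (Flow-mono (λ _ → inj₁) φ)
      (λ x x∉T _ e → Flow.avoid φ x x∉T (inj₂ (sym (Fin.suc-injective e))))

module Representation {n : ℕ} (𝒦 : Space n) where
  open Space 𝒦
  open Minors 𝒦
  open Structure 𝒦
  open Reduction 𝒦

  Within : Colouring n → (Fin n → Bool) → Subset n → Set
  Within c I T = ∀ j → T ! j ≡ true → I j ≡ true ⊎ c j ≡ con

  Active : Colouring n → (Fin n → Bool) → Set
  Active c I = ∀ j → I j ≡ true → c j ≡ act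

  -- This is independence in the minor; a cycle within `I` and the contracted elements need not be
  -- empty, only disjoint from `I`.
  Indep-in : Colouring n → (Fin n → Bool) → Set
  Indep-in c I = ∀ T → Cycle T → Within c I T → ∀ j → I j ≡ true → T ! j ≡ false

  Image : ∀ {v} → (Fin n → Fin v) → (Fin n → Bool) → Fin v → Set
  Image emb I y = ∃ λ j → I j ≡ true × emb j ≡ y

  record Rep (c : Colouring n) : Set where
    field
      {v} : ℕ
      Arc : Fin v → Fin v → Bool
      T   : Subset v
      emb : Fin n → Fin v
      emb-inj : ∀ i j → c i ≡ act → c j ≡ act → emb i ≡ emb j → i ≡ j
      rep : ∀ I → Active c I → Indep-in c I ⇔ Flow Arc (_∈ T) (Image emb I)

  ∖-elim : ∀ (I : Fin n → Bool) f {j} → (I ∖ f) j ≡ true → I j ≡ true × j ≢ f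
  ∖-elim I f {j} e with ∧-split {I j} e
  ... | Ij , e′ with j Fin.≟ f
  ...   | no j≢f = Ij , j≢f

  within-allowed : ∀ {c I T} → Active c I → Cycle T → Within c I T → Allowed c T
  within-allowed {c} I⊆ KT w = KT , λ j Tj cj → [ (λ Ij → contradiction (trans (sym (I⊆ j Ij)) cj) λ ()) , (λ k → contradiction (trans (sym k) cj) λ ()) ]′ (w j Tj)

  small-within : ∀ {c a b I} (sm : Small c a b) → I a ≡ true → I b ≡ true → Within c I (proj₁ (proj₂ (proj₂ sm)))
  small-within {c} (_ , _ , L , aL , _ , _ , only) Ia Ib j Lj with c j in cj
  ... | con = inj₂ refl
  ... | del = contradiction cj (proj₂ aL j Lj)
  ... | act with only j cj Lj
  ...   | inj₁ refl = inj₁ Ia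
  ...   | inj₂ refl = inj₁ Ib

  act≢con : ∀ {k : Colour} → k ≡ act → k ≢ con
  act≢con refl ()

  place : ∀ {v} → (Fin n → Fin v) → Fin n → Fin n → Fin (suc v)
  place emb f j = if does (j Fin.≟ f) then zero else suc (emb j)

  place-same : ∀ {v} (emb : Fin n → Fin v) f → place emb f f ≡ zero
  place-same emb f rewrite dec-true (f Fin.≟ f) refl = refl

  place-other : ∀ {v} (emb : Fin n → Fin v) {f j} → j ≢ f → place emb f j ≡ suc (emb j)
  place-other emb {f} {j} j≢f rewrite dec-false (j Fin.≟ f) j≢f = refl

  place-zero : ∀ {v} (emb : Fin n → Fin v) {f j} → place emb f j ≡ zero → j ≡ f
  place-zero emb {f} {j} e with j Fin.≟ f
  ... | yes j≡f = j≡f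

  place-suc : ∀ {v} (emb : Fin n → Fin v) {f j y} → place emb f j ≡ suc y → j ≢ f × emb j ≡ y
  place-suc emb {f} {j} e with j Fin.≟ f
  ... | no j≢f = j≢f , Fin.suc-injective e

  place-inj : ∀ {v} (emb : Fin n → Fin v) f {c c′ : Colouring n} → (∀ j → c j ≡ act → j ≢ f → c′ j ≡ act) →
    (∀ i j → c′ i ≡ act → c′ j ≡ act → emb i ≡ emb j → i ≡ j) →
    ∀ i j → c i ≡ act → c j ≡ act → place emb f i ≡ place emb f j → i ≡ j
  place-inj emb f sub inj i j ci cj e with i Fin.≟ f | j Fin.≟ f
  ... | yes refl | yes refl = refl
  ... | no i≢f   | no j≢f   = inj i j (sub i ci i≢f) (sub j cj j≢f) (Fin.suc-injective e)
  ... | yes _ | no _ = contradiction e λ ()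
  ... | no _ | yes _ = contradiction e λ ()

  image-zero : ∀ {v} (emb : Fin n → Fin v) {f I} → Image (place emb f) I zero → I f ≡ true
  image-zero emb (j , Ij , e) with place-zero emb e
  ... | refl = Ij

  image-suc : ∀ {v} (emb : Fin n → Fin v) {f I y} → Image (place emb f) I (suc y) → Image emb (I ∖ f) y
  image-suc emb {f} {I} (j , Ij , e) with place-suc emb {f} e
  ... | j≢f , refl = j , ∖-intro I f Ij j≢f , refl

  image-suc-back : ∀ {v} (emb : Fin n → Fin v) {f I y} → Image emb (I ∖ f) y → Image (place emb f) I (suc y)
  image-suc-back emb {f} {I} (j , Ij , refl) with ∖-elim I f Ij
  ... | Ij′ , j≢f = j , Ij′ , place-other emb j≢f

  module _ (c : Colouring n) (f : Fin n) {k : Colour} where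

    ∖-act : ∀ {I} → Active c I → Active (c [ f ↦ k ]) (I ∖ f)
    ∖-act {I} I⊆ j e with ∖-elim I f e
    ... | Ij , j≢f = trans (↦-other c k j≢f) (I⊆ j Ij)

    kept : ∀ j → c j ≡ act → j ≢ f → (c [ f ↦ k ]) j ≡ act
    kept j cj j≢f = trans (↦-other c k j≢f) cj

  module _ (c : Colouring n) (f : Fin n) (cf : c f ≡ act) where

    indep-delete : ∀ {I} → Indep-in c I → Indep-in (c [ f ↦ del ]) (I ∖ f)
    indep-delete {I} ind T KT w j e = ind T KT w′ j (proj₁ (∖-elim I f e))
      where
      w′ : Within c I T
      w′ j Tj with w j Tj
      ... | inj₁ e = inj₁ (proj₁ (∖-elim I f e))
      ... | inj₂ e = inj₂ (proj₁ (↦-elim c (λ ()) e))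

    indep-undelete : ∀ {I} → (∀ T → Cycle T → Within c I T → T ! f ≡ false) → Indep-in (c [ f ↦ del ]) (I ∖ f) → Indep-in c I
    indep-undelete {I} off ind T KT w j Ij with j Fin.≟ f
    ... | yes refl = off T KT w
    ... | no j≢f   = ind T KT w′ j (∖-intro I f Ij j≢f)
      where
      w′ : Within (c [ f ↦ del ]) (I ∖ f) T
      w′ j Tj with w j Tj
      ... | inj₁ Ij = inj₁ (∖-intro I f Ij λ { refl → true≢false Tj (off T KT w) })
      ... | inj₂ cj = inj₂ (↦-intro c cf (λ ()) cj)

    avoids : ∀ {I} T → I f ≡ false → Within c I T → T ! f ≡ false
    avoids T If w = ≢true⇒false λ Tf → [ (λ Ij → true≢false Ij If) , act≢con cf ]′ (w f Tf)

    -- The new vertex lies outside `T` and has no arc, so it cannot be linked once it is occupied.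
    add-loop : Small c f f → Rep (c [ f ↦ del ]) → Rep c
    add-loop sm@(_ , _ , L , aL , Lf , _) r = record
      { Arc = add-vertex Arc none ; T = false ∷ T ; emb = place emb f
      ; emb-inj = place-inj emb f (kept c f) emb-inj
      ; rep = λ I I⊆ → mk⇔ (to I I⊆) (from I I⊆) }
      where
      open Rep r
      none : Fin v → Bool
      none _ = false
      to : ∀ I → Active c I → Indep-in c I → Flow _ _ (Image (place emb f) I)
      to I I⊆ ind = extend-free Arc none (λ F0 → true≢false Lf (ind L (proj₁ aL) (small-within sm (image-zero emb F0) (image-zero emb F0)) f (image-zero emb F0)))
        (Flow-mono (λ _ → image-suc emb) (Equivalence.to (rep (I ∖ f) (∖-act c f I⊆)) (indep-delete ind)))
      from : ∀ I → Active c I → Flow _ _ (Image (place emb f) I) → Indep-in c I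
      from I I⊆ φ with restrict-source Arc none φ
      ... | inj₁ ¬F0 = indep-undelete (λ T KT w → avoids T (≢true⇒false λ If → ¬F0 (f , If , place-same emb f)) w)
              (Equivalence.from (rep (I ∖ f) (∖-act c f I⊆)) (Flow-mono (λ _ → image-suc-back emb) (restrict Arc none φ)))

    -- The new vertex lies in the target set and is linked by itself.
    add-coloop : Coloop c f → Rep (c [ f ↦ del ]) → Rep c
    add-coloop col r = record
      { Arc = add-vertex Arc none ; T = true ∷ T ; emb = place emb f
      ; emb-inj = place-inj emb f (kept c f) emb-inj
      ; rep = λ I I⊆ → mk⇔
          (λ ind → extend-sink Arc none (Flow-mono (λ _ → image-suc emb) (Equivalence.to (rep (I ∖ f) (∖-act c f I⊆)) (indep-delete ind))))
          (λ φ → indep-undelete (λ T KT w → col T (within-allowed I⊆ KT w))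
              (Equivalence.from (rep (I ∖ f) (∖-act c f I⊆)) (Flow-mono (λ _ → image-suc-back emb) (restrict Arc none φ)))) }
      where
      open Rep r
      none : Fin v → Bool
      none _ = false

  module _ (c : Colouring n) (a b : Fin n) (a≢b : a ≢ b) where

    -- The new vertex of `b` has one arc, to the vertex of `a`. Hence a set containing `b` is linked
    -- iff it omits `a` and stays linked when `b` is exchanged for `a`, as for parallel elements.
    add-parallel : Small c a b → Rep (c [ b ↦ del ]) → Rep c
    add-parallel sm@(ca , cb , L , aL , La , Lb , only) r = record
      { Arc = add-vertex Arc N ; T = false ∷ T ; emb = place emb b
      ; emb-inj = place-inj emb b (kept c b) emb-inj
      ; rep = λ I I⊆ → mk⇔ (to I I⊆) (from I I⊆) }
      where
      open Rep r
      N : Fin v → Bool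
      N y = does (y Fin.≟ emb a)

      swap : (Fin n → Bool) → Fin n → Bool
      swap I j = (I ∖ b) j ∨ does (j Fin.≟ a)

      swap-a : ∀ I → swap I a ≡ true
      swap-a I rewrite dec-true (a Fin.≟ a) refl = Bool.∨-zeroʳ _

      swap-elim : ∀ I {j} → swap I j ≡ true → (I j ≡ true × j ≢ b) ⊎ j ≡ a
      swap-elim I {j} e with ∨-split {(I ∖ b) j} e
      ... | inj₁ e′ = inj₁ (∖-elim I b e′)
      ... | inj₂ e′ = inj₂ (does⇒ (j Fin.≟ a) e′)

      swap-intro : ∀ I {j} → I j ≡ true → j ≢ b → swap I j ≡ true
      swap-intro I Ij j≢b = ∨-introˡ (∖-intro I b Ij j≢b)

      swap-act : ∀ I → Active c I → Active (c [ b ↦ del ]) (swap I)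
      swap-act I I⊆ j e with swap-elim I e
      ... | inj₁ (Ij , j≢b) = trans (↦-other c del j≢b) (I⊆ j Ij)
      ... | inj₂ refl = trans (↦-other c del a≢b) ca

      ⊕L : ∀ T j → c j ≢ del → (T ⊕ L) ! j ≡ true → (j ≢ a × j ≢ b × T ! j ≡ true) ⊎ j ≡ a ⊎ j ≡ b ⊎ c j ≡ con
      ⊕L T j c≢ e with j Fin.≟ a | j Fin.≟ b
      ... | yes q | _ = inj₂ (inj₁ q)
      ... | no _  | yes q = inj₂ (inj₂ (inj₁ q))
      ... | no ≢a | no ≢b with c j in cj
      ...   | con = inj₂ (inj₂ (inj₂ refl))
      ...   | del = contradiction refl c≢
      ...   | act = inj₁ (≢a , ≢b , trans (sym (Bool.xor-identityʳ _)) (trans (sym (⊕-at T L j refl (≢true⇒false λ Lj → [ ≢a , ≢b ]′ (only j cj Lj)))) e))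

      swap-indep : ∀ I → Active c I → I b ≡ true → Indep-in c I → Indep-in (c [ b ↦ del ]) (swap I)
      swap-indep I I⊆ Ib ind T KT w = zero-on
        where
        Tb : T ! b ≡ false
        Tb = ≢true⇒false λ Tb → [ (λ e → [ (λ (_ , b≢b) → b≢b refl) , (λ b≡a → a≢b (sym b≡a)) ]′ (swap-elim I e)) , (λ e → contradiction (trans (sym (↦-same c b del)) e) λ ()) ]′ (w b Tb)
        allowed : Allowed (c [ b ↦ del ]) T
        allowed = within-allowed (swap-act I I⊆) KT w
        Ta : T ! a ≡ false
        Ta with T ! a in Ta
        ... | false = refl
        ... | true  = contradiction (ind (T ⊕ L) (cycle-⊕ KT (proj₁ aL)) w′ b Ib) (true≢false (⊕-at T L b Tb Lb))
          where
          w′ : Within c I (T ⊕ L)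
          w′ j e with ⊕L T j (proj₂ (allowed-⊕ (allowed-sub (λ i _ → ↦-intro c cb λ ()) allowed) aL) j e) e
          ... | inj₂ (inj₁ refl) = contradiction (⊕-at T L a Ta La) (true≢false e)
          ... | inj₂ (inj₂ (inj₁ refl)) = inj₁ Ib
          ... | inj₂ (inj₂ (inj₂ cj))   = inj₂ cj
          ... | inj₁ (≢a , ≢b , Tj) with w j Tj
          ...   | inj₂ cj = inj₂ (proj₁ (↦-elim c (λ ()) cj))
          ...   | inj₁ s with swap-elim I s
          ... | inj₁ (Ij , _) = inj₁ Ij
          ... | inj₂ j≡a = contradiction j≡a ≢a
        w″ : Within c I T
        w″ j Tj with w j Tj
        ... | inj₂ cj = inj₂ (proj₁ (↦-elim c (λ ()) cj))
        ... | inj₁ s with swap-elim I s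
        ...   | inj₁ (Ij , _) = inj₁ Ij
        ...   | inj₂ refl = contradiction Ta (true≢false Tj)
        zero-on : ∀ j → swap I j ≡ true → T ! j ≡ false
        zero-on j s with swap-elim I s
        ... | inj₁ (Ij , _) = ind T KT w″ j Ij
        ... | inj₂ refl = Ta

      swap-indep-back : ∀ I → Active c I → I a ≡ false → Indep-in (c [ b ↦ del ]) (swap I) → Indep-in c I
      swap-indep-back I I⊆ Ia ind T KT w = zero-on
        where
        Ta : T ! a ≡ false
        Ta = avoids c a ca T Ia w
        allowed : Allowed c T
        allowed = within-allowed I⊆ KT w
        w₁ : ∀ j → T ! j ≡ true → j ≢ b → swap I j ≡ true ⊎ (c [ b ↦ del ]) j ≡ con
        w₁ j Tj j≢b with w j Tj
        ... | inj₁ Ij = inj₁ (swap-intro I Ij j≢b)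
        ... | inj₂ cj = inj₂ (↦-intro c cb (λ ()) cj)
        Tb : T ! b ≡ false
        Tb with T ! b in Tb
        ... | false = refl
        ... | true  = contradiction (ind (T ⊕ L) (cycle-⊕ KT (proj₁ aL)) w′ a (swap-a I)) (true≢false (⊕-at T L a Ta La))
          where
          w′ : Within (c [ b ↦ del ]) (swap I) (T ⊕ L)
          w′ j e with ⊕L T j (proj₂ (allowed-⊕ allowed aL) j e) e
          ... | inj₂ (inj₁ refl) = inj₁ (swap-a I)
          ... | inj₂ (inj₂ (inj₁ refl)) = contradiction (⊕-at T L b Tb Lb) (true≢false e)
          ... | inj₂ (inj₂ (inj₂ cj))   = inj₂ (↦-intro c cb (λ ()) cj)
          ... | inj₁ (≢a , ≢b , Tj) = w₁ j Tj ≢b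
        zero-on : ∀ j → I j ≡ true → T ! j ≡ false
        zero-on j Ij = by (j Fin.≟ b)
          where
          by : Dec (j ≡ b) → T ! j ≡ false
          by (yes refl) = Tb
          by (no j≢b)   = ind T KT (λ i Ti → w₁ i Ti λ { refl → true≢false Ti Tb }) j (swap-intro I Ij j≢b)

      to : ∀ I → Active c I → Indep-in c I → Flow _ _ (Image (place emb b) I)
      to I I⊆ ind with I b in Ib
      ... | false = extend-free Arc N (λ F0 → true≢false (image-zero emb F0) Ib)
              (Flow-mono (λ _ → image-suc emb) (Equivalence.to (rep (I ∖ b) (∖-act c b I⊆)) (indep-delete c b cb ind)))
      ... | true = extend-source Arc N (emb a) (dec-true (emb a Fin.≟ emb a) refl) ¬Fa
              (Flow-mono sub (Equivalence.to (rep (swap I) (swap-act I I⊆)) (swap-indep I I⊆ Ib ind)))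
        where
        Ia : I a ≡ false
        Ia = ≢true⇒false λ Ia → true≢false La (ind L (proj₁ aL) (small-within sm Ia Ib) a Ia)
        ¬Fa : ¬ Image (place emb b) I (suc (emb a))
        ¬Fa F with image-suc emb F
        ... | j , e , eq with emb-inj j a (∖-act c b I⊆ j e) (kept c b a ca a≢b) eq
        ...   | refl = true≢false (proj₁ (∖-elim I b e)) Ia
        sub : ∀ y → Image (place emb b) I (suc y) ⊎ y ≡ emb a → Image emb (swap I) y
        sub y (inj₂ refl) = a , swap-a I , refl
        sub y (inj₁ F) with image-suc emb F
        ... | j , e , eq = j , ∨-introˡ e , eq

      from : ∀ I → Active c I → Flow _ _ (Image (place emb b) I) → Indep-in c I
      from I I⊆ φ with restrict-source Arc N φ
      ... | inj₁ ¬F0 = indep-undelete c b cb (λ T KT w → avoids c b cb T (≢true⇒false λ Ib → ¬F0 (b , Ib , place-same emb b)) w)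
              (Equivalence.from (rep (I ∖ b) (∖-act c b I⊆)) (Flow-mono (λ _ → image-suc-back emb) (restrict Arc N φ)))
      ... | inj₂ (y , Ny , ¬Fy , ψ) with does⇒ (y Fin.≟ emb a) Ny
      ...   | refl = swap-indep-back I I⊆ (≢true⇒false λ Ia → ¬Fy (a , Ia , place-other emb a≢b))
              (Equivalence.from (rep (swap I) (swap-act I I⊆)) (Flow-mono sub ψ))
        where
        sub : ∀ y → Image emb (swap I) y → Image (place emb b) I (suc y) ⊎ y ≡ emb a
        sub y (j , s , refl) with swap-elim I s
        ... | inj₁ (Ij , j≢b) = inj₁ (j , Ij , place-other emb j≢b)
        ... | inj₂ refl = inj₂ refl

    -- The new vertex of `b` is a target without arcs, and the new vertex of `a` has arcs to it and
    -- to the old vertex of `a`. If `I` contains both, then `b` blocks its target and `a` must take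
    -- its old place, as in the contraction by `b`. Otherwise neither constrains the rest: a cycle
    -- that misses one of two series elements misses both.
    add-series : c a ≡ act → c b ≡ act → Series c a b → Rep (c [ b ↦ con ]) → Rep c
    add-series ca cb ser r = record
      { Arc = add-vertex Arc₁ N ; T = false ∷ true ∷ T ; emb = place (place emb b) a
      ; emb-inj = place-inj (place emb b) a {c} {c} (λ j cj _ → cj) (place-inj emb b (kept c b) emb-inj)
      ; rep = λ I I⊆ → mk⇔ (to I I⊆) (from I I⊆) }
      where
      open Rep r
      none : Fin v → Bool
      none _ = false
      Arc₁ = add-vertex Arc none
      N : Fin (suc v) → Bool
      N zero = true
      N (suc y) = does (y Fin.≟ emb a)

      c′ : Colouring n
      c′ = c [ b ↦ con ]

      c′-con : ∀ {j} → c′ j ≡ con → j ≡ b ⊎ c j ≡ con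
      c′-con {j} e with j Fin.≟ b
      ... | yes j≡b = inj₁ j≡b
      ... | no _ = inj₂ e

      same : ∀ T → Allowed c T → T ! a ≡ T ! b
      same T aT with T ! a | T ! b | ser T aT
      ... | true  | true  | _ = refl
      ... | false | false | _ = refl

      both-indep : ∀ I → I b ≡ true → Indep-in c I → Indep-in c′ (I ∖ b)
      both-indep I Ib ind T KT w j e = ind T KT w′ j (proj₁ (∖-elim I b e))
        where
        w′ : Within c I T
        w′ j Tj with w j Tj
        ... | inj₁ e = inj₁ (proj₁ (∖-elim I b e))
        ... | inj₂ e with c′-con e
        ...   | inj₁ refl = inj₁ Ib
        ...   | inj₂ cj   = inj₂ cj

      both-indep-back : ∀ I → Active c I → I a ≡ true → Indep-in c′ (I ∖ b) → Indep-in c I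
      both-indep-back I I⊆ Ia ind T KT w j Ij = by (j Fin.≟ b)
        where
        w′ : Within c′ (I ∖ b) T
        w′ i Ti = split (i Fin.≟ b) (w i Ti)
          where
          split : Dec (i ≡ b) → I i ≡ true ⊎ c i ≡ con → (I ∖ b) i ≡ true ⊎ c′ i ≡ con
          split (yes refl) _ = inj₂ (↦-same c b con)
          split (no i≢b)   (inj₁ Ii) = inj₁ (∖-intro I b Ii i≢b)
          split (no i≢b)   (inj₂ ci) = inj₂ (trans (↦-other c con i≢b) ci)
        by : Dec (j ≡ b) → T ! j ≡ false
        by (no j≢b)   = ind T KT w′ j (∖-intro I b Ij j≢b)
        by (yes refl) = trans (sym (same T (within-allowed I⊆ KT w))) (ind T KT w′ a (∖-intro I b Ia a≢b))

      not-both-indep : ∀ I → Active c I → Indep-in c I → Indep-in c′ ((I ∖ b) ∖ a)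
      not-both-indep I I⊆ ind T KT w j e = ind T KT w′ j (elim e)
        where
        elim : ∀ {j} → ((I ∖ b) ∖ a) j ≡ true → I j ≡ true
        elim e = proj₁ (∖-elim I b (proj₁ (∖-elim (I ∖ b) a e)))
        allowed : Allowed c T
        allowed = KT , λ j Tj cj → bad j cj (w j Tj)
          where
          bad : ∀ j → c j ≡ del → ¬ (((I ∖ b) ∖ a) j ≡ true ⊎ c′ j ≡ con)
          bad j cj (inj₁ e) = contradiction (trans (sym (I⊆ j (elim e))) cj) λ ()
          bad j cj (inj₂ e) with c′-con e
          ... | inj₁ refl = contradiction (trans (sym cb) cj) λ ()
          ... | inj₂ k = contradiction (trans (sym k) cj) λ ()
        Ta : T ! a ≡ false
        Ta = ≢true⇒false λ Ta → [ (λ e → proj₂ (∖-elim (I ∖ b) a e) refl) , (λ e → act≢con (trans (↦-other c con a≢b) ca) e) ]′ (w a Ta)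
        w′ : Within c I T
        w′ j Tj with w j Tj
        ... | inj₁ e = inj₁ (elim e)
        ... | inj₂ e with c′-con e
        ...   | inj₁ refl = contradiction (trans (sym (same T allowed)) Ta) (true≢false Tj)
        ...   | inj₂ cj   = inj₂ cj

      not-both-indep-back : ∀ I → Active c I → I a ≡ false ⊎ I b ≡ false →
                            Indep-in c′ ((I ∖ b) ∖ a) → Indep-in c I
      not-both-indep-back I I⊆ out ind T KT w j Ij = by (j Fin.≟ a) (j Fin.≟ b)
        where
        Ta : T ! a ≡ false
        Ta = [ (λ Ia → avoids c a ca T Ia w) , (λ Ib → trans (same T (within-allowed I⊆ KT w)) (avoids c b cb T Ib w)) ]′ out
        Tb : T ! b ≡ false
        Tb = trans (sym (same T (within-allowed I⊆ KT w))) Ta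
        w′ : Within c′ ((I ∖ b) ∖ a) T
        w′ i Ti with w i Ti
        ... | inj₁ Ii = inj₁ (∖-intro (I ∖ b) a (∖-intro I b Ii λ { refl → true≢false Ti Tb }) λ { refl → true≢false Ti Ta })
        ... | inj₂ ci = inj₂ (↦-intro c cb (λ ()) ci)
        by : Dec (j ≡ a) → Dec (j ≡ b) → T ! j ≡ false
        by (yes refl) _ = Ta
        by (no _) (yes refl)   = Tb
        by (no j≢a) (no j≢b)   = ind T KT w′ j (∖-intro (I ∖ b) a (∖-intro I b Ij j≢b) j≢a)

      ∖∖-act : ∀ I → Active c I → Active c′ ((I ∖ b) ∖ a)
      ∖∖-act I I⊆ j e = ∖-act c b I⊆ j (proj₁ (∖-elim (I ∖ b) a e))

      image₂ : ∀ I {y} → Image (place (place emb b) a) I (suc (suc y)) → Image emb ((I ∖ b) ∖ a) y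
      image₂ I F with image-suc emb (image-suc (place emb b) F)
      ... | j , e , eq with ∖-elim (I ∖ a) b e
      ...   | e′ , j≢b with ∖-elim I a e′
      ... | Ij , j≢a = j , ∖-intro (I ∖ b) a (∖-intro I b Ij j≢b) j≢a , eq

      image₂-back : ∀ I {j} → I j ≡ true → j ≢ a → j ≢ b → Image (place (place emb b) a) I (suc (suc (emb j)))
      image₂-back I {j} Ij j≢a j≢b = j , Ij , trans (place-other (place emb b) j≢a) (cong suc (place-other emb j≢b))

      to : ∀ I → Active c I → Indep-in c I → Flow _ _ (Image (place (place emb b) a) I)
      to I I⊆ ind with I a in Ia | I b in Ib
      ... | true | true = extend-source Arc₁ N (suc (emb a)) (dec-true (emb a Fin.≟ emb a) refl) ¬Fa
              (extend-sink Arc none (Flow-mono sub (Equivalence.to (rep (I ∖ b) (∖-act c b I⊆)) (both-indep I Ib ind))))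
        where
        ¬Fa : ¬ Image (place (place emb b) a) I (suc (suc (emb a)))
        ¬Fa F with image₂ I F
        ... | j , e , eq = proj₂ (∖-elim (I ∖ b) a e) (emb-inj j a (∖∖-act I I⊆ j e) (kept c b a ca a≢b) eq)
        sub : ∀ y → Image (place (place emb b) a) I (suc (suc y)) ⊎ suc y ≡ suc (emb a) → Image emb (I ∖ b) y
        sub y (inj₂ refl) = a , ∖-intro I b Ia a≢b , refl
        sub y (inj₁ F) with image₂ I F
        ... | j , e , eq = j , proj₁ (∖-elim (I ∖ b) a e) , eq
      ... | true | false = extend-source Arc₁ N zero refl (λ F → true≢false (proj₁ (∖-elim I a (image-zero emb (image-suc (place emb b) F)))) Ib)
              (extend-sink Arc none (Flow-mono (λ { y (inj₁ F) → image₂ I F ; y (inj₂ ()) }) (Equivalence.to (rep _ (∖∖-act I I⊆)) (not-both-indep I I⊆ ind))))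
      ... | false | _ = extend-free Arc₁ N (λ F → true≢false (image-zero (place emb b) F) Ia)
              (extend-sink Arc none (Flow-mono (λ y F → image₂ I F) (Equivalence.to (rep _ (∖∖-act I I⊆)) (not-both-indep I I⊆ ind))))

      from : ∀ I → Active c I → Flow _ _ (Image (place (place emb b) a) I) → Indep-in c I
      from I I⊆ φ = cases (I a Bool.≟ true) (I b Bool.≟ true) (restrict-source Arc₁ N φ)
        where
        F = Image (place (place emb b) a) I
        unlinked : I a ≡ false ⊎ I b ≡ false → Indep-in c I
        unlinked out = not-both-indep-back I I⊆ out (Equivalence.from (rep _ (∖∖-act I I⊆)) (Flow-mono sub (restrict Arc none (restrict Arc₁ N φ))))
          where
          sub : ∀ y → Image emb ((I ∖ b) ∖ a) y → F (suc (suc y))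
          sub y (j , e , refl) with ∖-elim (I ∖ b) a e
          ... | e′ , j≢a with ∖-elim I b e′
          ...   | Ij , j≢b = image₂-back I Ij j≢a j≢b
        cases : Dec (I a ≡ true) → Dec (I b ≡ true) →
          ¬ F zero ⊎ (∃ λ y → N y ≡ true × ¬ F (suc y) × Flow Arc₁ (_∈ (true ∷ T)) (λ z → F (suc z) ⊎ z ≡ y)) → Indep-in c I
        cases (no ¬Ia) _ _ = unlinked (inj₁ (≢true⇒false ¬Ia))
        cases (yes _) (no ¬Ib) _ = unlinked (inj₂ (≢true⇒false ¬Ib))
        cases (yes Ia) (yes Ib) (inj₁ ¬F0) = contradiction (a , Ia , place-same (place emb b) a) ¬F0
        cases (yes Ia) (yes Ib) (inj₂ (zero , _ , ¬Fb , _)) =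
          contradiction (b , Ib , trans (place-other (place emb b) (≢-sym a≢b)) (cong suc (place-same emb b))) ¬Fb
        cases (yes Ia) (yes Ib) (inj₂ (suc y , Ny , _ , ψ)) with does⇒ (y Fin.≟ emb a) Ny
        ... | refl = both-indep-back I I⊆ Ia (Equivalence.from (rep _ (∖-act c b I⊆)) (Flow-mono sub (restrict Arc none ψ)))
          where
          sub : ∀ y → Image emb (I ∖ b) y → F (suc (suc y)) ⊎ suc y ≡ suc (emb a)
          sub y (j , e , refl) with ∖-elim I b e
          ... | Ij , j≢b with j Fin.≟ a
          ...   | yes refl = inj₂ refl
          ...   | no j≢a   = inj₁ (image₂-back I Ij j≢a j≢b)

  no-elements : ∀ c → (∀ j → c j ≢ act) → Rep c
  no-elements c none = record
    { Arc = λ _ _ → false ; T = ∅ ; emb = id ; emb-inj = λ _ _ _ _ e → e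
    ; rep = λ I I⊆ → mk⇔
        (λ _ → record { next = id ; arc = λ _ _ → inj₁ refl ; inj = λ _ _ _ _ e → e ; avoid = λ { _ _ (j , Ij , _) → none j (I⊆ j Ij) } })
        (λ _ T _ _ j Ij → contradiction (I⊆ j Ij) (none j)) }

  decompose : ∀ c → Acc _<_ (size-act c) → K₄-minor ⊎ Rep c
  decompose c (acc rs) = reduce (small? c)
    where
    recurse : ∀ f {k} → c f ≡ act → k ≢ act → (Rep (c [ f ↦ k ]) → Rep c) → K₄-minor ⊎ Rep c
    recurse f {k} cf k≢act lift with decompose (c [ f ↦ k ]) (rs (size-act-decreases c _ f cf λ _ → ↦-elim c k≢act))
    ... | inj₁ m = inj₁ m
    ... | inj₂ r = inj₂ (lift r)

    find-coloop : (∃ λ a → c a ≡ act × Coloop c a) ⊎ (∀ a → c a ≡ act → Covered c a)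
    find-coloop = scan λ a → by a (act? (c a)) (coloop? c a)
      where
      by : ∀ a → Dec (c a ≡ act) → Coloop c a ⊎ Covered c a → (∃ λ a → c a ≡ act × Coloop c a) ⊎ (c a ≡ act → Covered c a)
      by a (no ¬ca) _ = inj₂ λ ca → contradiction ca ¬ca
      by a (yes ca) (inj₁ l) = inj₁ (a , ca , l)
      by a (yes ca) (inj₂ l) = inj₂ λ _ → l

    SeriesPair : Set
    SeriesPair = ∃₂ λ a b → c a ≡ act × c b ≡ act × a ≢ b × Series c a b

    find-series : SeriesPair ⊎ (∀ a b → c a ≡ act → c b ≡ act → a ≢ b → Separated c a b)
    find-series = scan λ a → scan λ b → by a b (act? (c a)) (act? (c b)) (a Fin.≟ b) (series? c a b)
      where
      by : ∀ a b → Dec (c a ≡ act) → Dec (c b ≡ act) → Dec (a ≡ b) → Series c a b ⊎ Separated c a b →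
           SeriesPair ⊎ (c a ≡ act → c b ≡ act → a ≢ b → Separated c a b)
      by a b (no ¬ca) _ _ _ = inj₂ λ ca → contradiction ca ¬ca
      by a b _ (no ¬cb) _ _ = inj₂ λ _ cb → contradiction cb ¬cb
      by a b _ _ (yes e) _  = inj₂ λ _ _ ≢ → contradiction e ≢
      by a b (yes ca) (yes cb) (no a≢b) (inj₁ s) = inj₁ (a , b , ca , cb , a≢b , s)
      by a b _ _ _ (inj₂ s) = inj₂ λ _ _ _ → s

    irreducible : Simple c → Cosimple c → Dec (∃ λ e → c e ≡ act) → K₄-minor ⊎ Rep c
    irreducible sim cos (yes (e , ce)) = inj₁ (irreducible⇒K₄ c (acc rs) sim cos e ce)
    irreducible sim cos (no none) = inj₂ (no-elements c λ j cj → none (j , cj))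

    reduce : Dec (∃₂ (Small c)) → K₄-minor ⊎ Rep c
    reduce (yes (a , b , s)) with a Fin.≟ b
    ... | yes refl = recurse a (proj₁ s) (λ ()) (add-loop c a (proj₁ s) s)
    ... | no a≢b   = recurse b (proj₁ (proj₂ s)) (λ ()) (add-parallel c a b a≢b s)
    reduce (no ¬small) with find-coloop | find-series
    ... | inj₁ (a , ca , l) | _ = recurse a ca (λ ()) (add-coloop c a ca l)
    ... | inj₂ _ | inj₁ (a , b , ca , cb , a≢b , s) = recurse b cb (λ ()) (add-series c a b a≢b ca cb s)
    ... | inj₂ cov | inj₂ sep = irreducible (simple λ a b s → ¬small (a , b , s)) (cosimple cov sep) (Fin.any? λ e → act? (c e))

-- Kernels of matrices

dot : ∀ {n} → Subset n → (Fin n → Bool) → Bool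
dot [] f = false
dot (b ∷ T) f = (b ∧ f zero) xor dot T (f ∘ suc)

dot-⊕ : ∀ {n} (S T : Subset n) f → dot (S ⊕ T) f ≡ dot S f xor dot T f
dot-⊕ [] [] f = refl
dot-⊕ (a ∷ S) (b ∷ T) f = trans (cong ((((a xor b) ∧ f zero)) xor_) (dot-⊕ S T (f ∘ suc))) (lem a b (f zero) _ _)
  where
  open xor-∧-Solver
  lem : ∀ a b x s t → ((a xor b) ∧ x) xor (s xor t) ≡ ((a ∧ x) xor s) xor ((b ∧ x) xor t)
  lem = solve 5 (λ a b x s t → ((a :+ b) :* x) :+ (s :+ t) := ((a :* x) :+ s) :+ ((b :* x) :+ t)) refl

dot-∅ : ∀ n (f : Fin n → Bool) → dot ∅ f ≡ false
dot-∅ zero f = refl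
dot-∅ (suc n) f = dot-∅ n (f ∘ suc)

dot-xor : ∀ {n} (T : Subset n) f g → dot T (λ j → f j xor g j) ≡ dot T f xor dot T g
dot-xor [] f g = refl
dot-xor (b ∷ T) f g = trans (cong ((b ∧ (f zero xor g zero)) xor_) (dot-xor T (f ∘ suc) (g ∘ suc))) (lem b (f zero) (g zero) _ _)
  where
  open xor-∧-Solver
  lem : ∀ b x y s t → (b ∧ (x xor y)) xor (s xor t) ≡ ((b ∧ x) xor s) xor ((b ∧ y) xor t)
  lem = solve 5 (λ b x y s t → (b :* (x :+ y)) :+ (s :+ t) := ((b :* x) :+ s) :+ ((b :* y) :+ t)) refl

dot-cong : ∀ {n} (T : Subset n) {f g} → (∀ j → f j ≡ g j) → dot T f ≡ dot T g
dot-cong [] e = refl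
dot-cong (b ∷ T) e = cong₂ _xor_ (cong (b ∧_) (e zero)) (dot-cong T (e ∘ suc))

dot-false : ∀ {n} (T : Subset n) → dot T (λ _ → false) ≡ false
dot-false [] = refl
dot-false (b ∷ T) = trans (cong₂ _xor_ (Bool.∧-zeroʳ b) (dot-false T)) refl

dot-single : ∀ {n} (T : Subset n) j y → dot T (λ i → y ∧ does (i Fin.≟ j)) ≡ y ∧ T ! j
dot-single (b ∷ T) zero y = trans (cong₂ _xor_ (cong (b ∧_) (Bool.∧-identityʳ y)) (trans (dot-cong T (λ _ → Bool.∧-zeroʳ y)) (dot-false T)))
                                  (trans (Bool.xor-identityʳ _) (Bool.∧-comm b y))
dot-single (b ∷ T) (suc j) y = trans (cong (λ z → (b ∧ z) xor dot T (λ i → y ∧ does (i Fin.≟ j))) (Bool.∧-zeroʳ y))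
                                     (trans (cong (_xor _) (Bool.∧-zeroʳ b)) (dot-single T j y))

colSum-at : ∀ {n r} (A : Fin n → Vec Bool r) T i → lookup (colSum A T) i ≡ dot T λ j → lookup (A j) i
colSum-at A [] i = Vec.lookup-replicate i false
colSum-at A (true ∷ T)  i = trans (Vec.lookup-zipWith _xor_ i (A zero) _) (cong (lookup (A zero) i xor_) (colSum-at (A ∘ suc) T i))
colSum-at {r = r} A (false ∷ T) i = trans (Vec.lookup-zipWith _xor_ i (replicate r false) _)
  (cong₂ _xor_ (Vec.lookup-replicate i false) (colSum-at (A ∘ suc) T i))

colSum-⊕ : ∀ {n r} (A : Fin n → Vec Bool r) S T → colSum A (S ⊕ T) ≡ colSum A S ⊕ colSum A T
colSum-⊕ A S T = lookup-ext λ i → trans (colSum-at A (S ⊕ T) i) (trans (dot-⊕ S T _)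
  (sym (trans (!-⊕ (colSum A S) (colSum A T) i) (cong₂ _xor_ (colSum-at A S i) (colSum-at A T i)))))

colSum-∅ : ∀ {n r} (A : Fin n → Vec Bool r) → colSum A ∅ ≡ ∅
colSum-∅ {n} A = lookup-ext λ i → trans (colSum-at A ∅ i) (trans (dot-∅ n _) (sym (!-∅ i)))

⊕-self : ∀ {n} (T : Subset n) → T ⊕ T ≡ ∅
⊕-self T = lookup-ext λ j → trans (!-⊕ T T j) (trans (Bool.xor-same (T ! j)) (sym (!-∅ j)))

⊕-cancel : ∀ {n} (S T : Subset n) → S ⊕ (S ⊕ T) ≡ T
⊕-cancel S T = lookup-ext λ j → trans (!-⊕ S (S ⊕ T) j) (trans (cong (S ! j xor_) (!-⊕ S T j)) (lem (S ! j) (T ! j)))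
  where
  lem : ∀ x y → x xor (x xor y) ≡ y
  lem true  y = Bool.not-involutive y
  lem false y = refl

kernel : ∀ {n r} → (Fin n → Vec Bool r) → Space n
kernel A = record
  { Cycle   = λ T → colSum A T ≡ ∅
  ; cycle?  = λ T → _ ≟ₛ _
  ; cycle-∅ = colSum-∅ A
  ; cycle-⊕ = λ {S} {T} s t → trans (colSum-⊕ A S T) (trans (cong₂ _⊕_ s t) (⊕-self ∅)) }

∅-∷ʳ : ∀ r → ∅ {suc r} ≡ ∅ {r} ∷ʳ false
∅-∷ʳ zero = refl
∅-∷ʳ (suc r) = cong (false ∷_) (∅-∷ʳ r)

colSum-split : ∀ {n r} (A : Fin n → Vec Bool r) X T → colSum (splitMatrix A X) T ≡ colSum A T ∷ʳ dot T (X !_)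
colSum-split {r = r} A [] [] = ∅-∷ʳ r
colSum-split A (x ∷ X) (b ∷ T) = trans (cong₂ (zipWith _xor_) (head b) (colSum-split (A ∘ suc) X T)) (zip-∷ʳ _ _ _ _)
  where
  head : ∀ b → (if b then A zero ∷ʳ x else replicate _ false) ≡ (if b then A zero else replicate _ false) ∷ʳ (b ∧ x)
  head true  = refl
  head false = ∅-∷ʳ _
  zip-∷ʳ : ∀ {r} (u w : Vec Bool r) a d → zipWith _xor_ (u ∷ʳ a) (w ∷ʳ d) ≡ zipWith _xor_ u w ∷ʳ (a xor d)
  zip-∷ʳ [] [] a d = refl
  zip-∷ʳ (y ∷ u) (z ∷ w) a d = cong (_ ∷_) (zip-∷ʳ u w a d)

split-cycle : ∀ {n r} (A : Fin n → Vec Bool r) X T →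
  (colSum (splitMatrix A X) T ≡ ∅) ⇔ (colSum A T ≡ ∅ × dot T (X !_) ≡ false)
split-cycle {r = r} A X T = mk⇔
  (λ e → Vec.∷ʳ-injective (colSum A T) ∅ (trans (sym (colSum-split A X T)) (trans e (∅-∷ʳ r))))
  (λ (e , d) → trans (colSum-split A X T) (trans (cong₂ _∷ʳ_ e d) (sym (∅-∷ʳ r))))

∈⇒! : ∀ {n} {T : Subset n} {j} → j ∈ T → T ! j ≡ true
∈⇒! = Vec.[]=⇒lookup

!⇒∈ : ∀ {n} (T : Subset n) {j} → T ! j ≡ true → j ∈ T
!⇒∈ T {j} = Vec.lookup⇒[]= j T

∅-intro : ∀ {n} {T : Subset n} → (∀ j → T ! j ≢ true) → T ≡ ∅
∅-intro h = lookup-ext λ j → trans (≢true⇒false (h j)) (sym (!-∅ j))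

!-tabulate : ∀ {n} (p : Fin n → Bool) j → tabulate p ! j ≡ p j
!-tabulate = Vec.lookup∘tabulate

-- Independence in a contraction

module _ {n r : ℕ} (A : Fin n → Vec Bool r) where
  open Space (kernel A)

  record Basis (C : Subset n) : Set where
    field
      J : Subset n
      J⊆C   : J ⊆ C
      indep : MatIndep A J
      max   : ∀ J′ → J′ ⊆ C → MatIndep A J′ → ∣ J′ ∣ ≤ ∣ J ∣

  basis : ∀ C → Basis C
  basis C with minimal (λ J → (J ⊆? C) ×-dec matIndep? A J) (λ J → n ∸ ∣ J ∣) ∅
                 ((λ {j} j∈ → contradiction (∈⇒! j∈) λ e → true≢false e (!-∅ j)) , λ T T⊆∅ _ → ∅-intro λ j Tj → true≢false (∈⇒! (T⊆∅ (!⇒∈ T Tj))) (!-∅ j))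
  ... | J , (J⊆C , ind) , min = record
        { J = J ; J⊆C = J⊆C ; indep = ind
        ; max = λ J′ J′⊆C ind′ → ℕ.∸-cancelʳ-≤ (∣p∣≤n J′) (min J′ ((λ {x} → J′⊆C {x}) , ind′)) }

  module _ {C : Subset n} (b : Basis C) where
    open Basis b

    Moved : Subset n → Subset n → Set
    Moved T T′ = Cycle T′ × (∀ j → T′ ! j ≡ true → j ∈ C → j ∈ J) × (∀ j → j ∉ C → T′ ! j ≡ T ! j)

    -- `ContrIndep` refers to a basis of `C`, whereas a cycle of the minor may use all of `C`. By
    -- maximality each `i` in `C` outside `J` lies on a cycle within `J` and `i`; adding it removes
    -- `i` and otherwise changes only `J`.
    respan : ∀ T → Cycle T → ∃ (Moved T)
    respan T KT = go T KT (<-wellFounded (excess T))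
      where
      out : Subset n → Fin n → Bool
      out T j = does ((j ∈? C) ×-dec ¬? (j ∈? J)) ∧ T ! j
      excess : Subset n → ℕ
      excess T = count (out T)
      go : ∀ T → Cycle T → Acc _<_ (excess T) → ∃ (Moved T)
      go T KT (acc rs) with Fin.any? (λ j → (j ∈? C) ×-dec (¬? (j ∈? J) ×-dec (T ! j Bool.≟ true)))
      ... | no none = T , KT , (λ j Tj j∈C → decidable-stable (j ∈? J) λ j∉J → none (j , j∈C , j∉J , Tj)) , λ _ _ → refl
      ... | yes (i , i∈C , i∉J , Ti) with anySubset? (λ D → (D ⊆? (J ∪ ⁅ i ⁆)) ×-dec (cycle? D ×-dec (D ! i Bool.≟ true)))
      ...   | no none = contradiction (max (J ∪ ⁅ i ⁆) bigger⊆ bigger-indep) (ℕ.<⇒≱ (p⊂q⇒∣p∣<∣q∣ (p⊆p∪q ⁅ i ⁆ , i , q⊆p∪q J ⁅ i ⁆ (x∈⁅x⁆ i) , i∉J)))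
        where
        bigger⊆ : (J ∪ ⁅ i ⁆) ⊆ C
        bigger⊆ x∈ with x∈p∪q⁻ J ⁅ i ⁆ x∈
        ... | inj₁ x∈J = J⊆C x∈J
        ... | inj₂ x∈i with x∈⁅y⁆⇒x≡y i x∈i
        ...   | refl = i∈C
        bigger-indep : MatIndep A (J ∪ ⁅ i ⁆)
        bigger-indep D D⊆ KD = indep D D⊆J KD
          where
          D⊆J : D ⊆ J
          D⊆J {x} x∈D with x∈p∪q⁻ J ⁅ i ⁆ (D⊆ x∈D)
          ... | inj₁ x∈J = x∈J
          ... | inj₂ x∈i with x∈⁅y⁆⇒x≡y i x∈i
          ...   | refl = contradiction (D , (λ {x} → D⊆ {x}) , KD , ∈⇒! x∈D) none
      ...   | yes (D , D⊆ , KD , Di) with go (T ⊕ D) (cycle-⊕ KT KD) (rs smaller)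
        where
        onlyi : ∀ j → j ∉ J → D ! j ≡ true → j ≡ i
        onlyi j j∉J Dj with x∈p∪q⁻ J ⁅ i ⁆ (D⊆ (!⇒∈ D Dj))
        ... | inj₁ j∈J = contradiction j∈J j∉J
        ... | inj₂ j∈i = x∈⁅y⁆⇒x≡y i j∈i
        keep : ∀ j → out (T ⊕ D) j ≡ true → (out T ∖ i) j ≡ true
        keep j e with ∧-split {does ((j ∈? C) ×-dec ¬? (j ∈? J))} e
        ... | d , e′ with does⇒ ((j ∈? C) ×-dec ¬? (j ∈? J)) d
        ...   | j∈C , j∉J = ∖-intro (out T) i (∧-intro d Tj) j≢i
          where
          j≢i : j ≢ i
          j≢i refl = true≢false e′ (trans (!-⊕ T D i) (cong₂ _xor_ Ti Di))
          Dj : D ! j ≡ false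
          Dj = ≢true⇒false λ Dj → j≢i (onlyi j j∉J Dj)
          Tj : T ! j ≡ true
          Tj = trans (sym (trans (trans (!-⊕ T D j) (cong (T ! j xor_) Dj)) (Bool.xor-identityʳ _))) e′
        smaller : excess (T ⊕ D) < excess T
        smaller = subst (excess (T ⊕ D) <_) (sym (count-∖ (out T) i (∧-intro (dec-true ((i ∈? C) ×-dec ¬? (i ∈? J)) (i∈C , i∉J)) Ti)))
          (s≤s (count-mono keep))
      ... | T′ , KT′ , inJ , same = T′ , KT′ , inJ , λ j j∉C → trans (same j j∉C) (trans (!-⊕ T D j) (trans (cong (T ! j xor_) (Dj j j∉C)) (Bool.xor-identityʳ _)))
        where
        Dj : ∀ j → j ∉ C → D ! j ≡ false
        Dj j j∉C = ≢true⇒false λ Dj → [ (λ j∈J → j∉C (J⊆C j∈J)) , (λ j∈i → j∉C (subst (_∈ C) (sym (x∈⁅y⁆⇒x≡y i j∈i)) i∈C)) ]′ (x∈p∪q⁻ J ⁅ i ⁆ (D⊆ (!⇒∈ D Dj)))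

-- Minors as cycle spaces

Image⇔ : ∀ {m n} → (Fin m → Fin n) → Subset m → Subset n → Set
Image⇔ f I J = ∀ j → j ∈ J ⇔ (∃ λ x → x ∈ I × f x ≡ j)

image : ∀ {m n} → (Fin m → Fin n) → Subset m → Subset n
image f I = tabulate λ j → does (Fin.any? λ x → (x ∈? I) ×-dec (f x Fin.≟ j))

image⇔ : ∀ {m n} (f : Fin m → Fin n) I → Image⇔ f I (image f I)
image⇔ f I j = mk⇔
  (λ j∈ → does⇒ (hit? j) (trans (sym (!-tabulate _ j)) (∈⇒! j∈)))
  (λ h → !⇒∈ (image f I) (trans (!-tabulate _ j) (dec-true (hit? j) h)))
  where
  hit? : ∀ j → Dec (∃ λ x → x ∈ I × f x ≡ j)
  hit? j = Fin.any? λ x → (x ∈? I) ×-dec (f x Fin.≟ j)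

IndepOf : ∀ {n} → (Subset n → Set) → Subset n → Set
IndepOf Z I = ∀ T → T ⊆ I → Z T → T ≡ ∅

module _ {n r : ℕ} (A : Fin n → Vec Bool r) {m : ℕ} (f : Fin m → Fin n) (C : Subset n) where
  open Space (kernel A)

  MinorCycle : Subset m → Set
  MinorCycle U = ∃ λ T → Cycle T × (∀ j → T ! j ≡ true → j ∈ C ⊎ ∃ λ x → f x ≡ j) × ∀ x → T ! f x ≡ U ! x

  minorCycle? : ∀ U → Dec (MinorCycle U)
  minorCycle? U = anySubset? λ T → cycle? T ×-dec
    ((Fin.all? λ j → (T ! j Bool.≟ true) →-dec ((j ∈? C) ⊎-dec Fin.any? λ x → f x Fin.≟ j)) ×-dec
     Fin.all? λ x → T ! f x Bool.≟ U ! x)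

  minorCycle-⊕ : ∀ {S T} → MinorCycle S → MinorCycle T → MinorCycle (S ⊕ T)
  minorCycle-⊕ {S} {T} (S′ , KS , wS , tS) (T′ , KT , wT , tT) = S′ ⊕ T′ , cycle-⊕ KS KT , w , λ x →
    trans (!-⊕ S′ T′ (f x)) (trans (cong₂ _xor_ (tS x) (tT x)) (sym (!-⊕ S T x)))
    where
    w : ∀ j → (S′ ⊕ T′) ! j ≡ true → j ∈ C ⊎ ∃ λ x → f x ≡ j
    w j e with S′ ! j in Sj | trans (sym (!-⊕ S′ T′ j)) e
    ... | true  | _  = wS j Sj
    ... | false | Tj = wT j Tj

  -- `respan` moves a witness of a minor cycle into the union of `J` and the basis without changing
  -- its trace. Conversely a cycle in that union with empty trace lies in the basis, and so is
  -- empty.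
  contrIndep⇔ : (f-inj : Injective _≡_ _≡_ f) → (∀ x → f x ∉ C) →
    (Ind : Subset n → Set) → (∀ I → Ind I ⇔ MatIndep A I) →
    ∀ I J → Image⇔ f I J →
    ContrIndep (record { size = n ; Indep = Ind }) C J ⇔ IndepOf MinorCycle I
  contrIndep⇔ f-inj f∉C Ind rep I J img = mk⇔ to from
    where
    to : ContrIndep (record { size = n ; Indep = Ind }) C J → IndepOf MinorCycle I
    to (disj , B , B⊆C , indB , max , ind) U U⊆I (T , KT , wT , tT) = ∅-intro λ x Ux →
      true≢false (trans (tT x) Ux) (trans (sym (same (f x) (f∉C x))) (trans (cong (_! f x) T′≡∅) (!-∅ (f x))))
      where
      b : Basis A C
      b = record { J = B ; J⊆C = B⊆C ; indep = Equivalence.to (rep B) indB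
                 ; max = λ J′ J′⊆C ind′ → max J′ J′⊆C (Equivalence.from (rep J′) ind′) }
      spanned = respan A b T KT
      T′ = proj₁ spanned
      same = proj₂ (proj₂ (proj₂ spanned))
      T′⊆ : T′ ⊆ (J ∪ B)
      T′⊆ {j} j∈ with j ∈? C
      ... | yes j∈C = x∈p∪q⁺ (inj₂ (proj₁ (proj₂ (proj₂ spanned)) j (∈⇒! j∈) j∈C))
      ... | no j∉C with wT j (trans (sym (same j j∉C)) (∈⇒! j∈))
      ...   | inj₁ j∈C = contradiction j∈C j∉C
      ...   | inj₂ (x , refl) = x∈p∪q⁺ (inj₁ (Equivalence.from (img (f x)) (x , U⊆I (!⇒∈ U (trans (sym (tT x)) (trans (sym (same (f x) j∉C)) (∈⇒! j∈)))) , refl)))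
      T′≡∅ : T′ ≡ ∅
      T′≡∅ = Equivalence.to (rep (J ∪ B)) ind T′ T′⊆ (proj₁ (proj₂ spanned))

    from : IndepOf MinorCycle I → ContrIndep (record { size = n ; Indep = Ind }) C J
    from ind = disj , B , J⊆C , Equivalence.from (rep B) indep
             , (λ J′ J′⊆C ind′ → max J′ J′⊆C (Equivalence.to (rep J′) ind′)) , Equivalence.from (rep (J ∪ B)) ind∪
      where
      open Basis (basis A C) renaming (J to B)
      disj : ∀ e → e ∈ J → e ∉ C
      disj e e∈J with Equivalence.to (img e) e∈J
      ... | x , _ , refl = f∉C x
      ind∪ : MatIndep A (J ∪ B)
      ind∪ T T⊆ KT = indep T T⊆B KT
        where
        U = tabulate λ x → T ! f x
        U⊆I : U ⊆ I
        U⊆I {x} x∈U with x∈p∪q⁻ J B (T⊆ (!⇒∈ T (trans (sym (!-tabulate _ x)) (∈⇒! x∈U))))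
        ... | inj₂ fx∈B = contradiction (J⊆C fx∈B) (f∉C x)
        ... | inj₁ fx∈J with Equivalence.to (img (f x)) fx∈J
        ...   | y , y∈I , eq = subst (_∈ I) (f-inj eq) y∈I
        within : ∀ j → T ! j ≡ true → j ∈ C ⊎ ∃ λ x → f x ≡ j
        within j Tj with x∈p∪q⁻ J B (T⊆ (!⇒∈ T Tj))
        ... | inj₂ j∈B = inj₁ (J⊆C j∈B)
        ... | inj₁ j∈J with Equivalence.to (img j) j∈J
        ...   | x , _ , eq = inj₂ (x , eq)
        U≡∅ : U ≡ ∅
        U≡∅ = ind U U⊆I (T , KT , within , λ x → sym (!-tabulate _ x))
        T⊆B : T ⊆ B
        T⊆B {j} j∈T with x∈p∪q⁻ J B (T⊆ j∈T)
        ... | inj₂ j∈B = j∈B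
        ... | inj₁ j∈J with Equivalence.to (img j) j∈J
        ...   | x , _ , refl = contradiction (trans (sym (!-tabulate _ x)) (trans (cong (_! x) U≡∅) (!-∅ x))) (true≢false (∈⇒! j∈T))

-- Induction on the size of `T`. A nonempty `T` in one space is dependent for both, so it contains a
-- nonempty `S` of the other. Unless `S` is all of `T`, both `S` and the sum of `S` and `T` are
-- smaller: the first passes back, so the second lies in the first space and passes over.
independents-determine : ∀ {n} {Z Z′ : Subset n → Set} → (∀ T → Dec (Z T)) → (∀ T → Dec (Z′ T)) →
  Z ∅ → Z′ ∅ → (∀ {S T} → Z S → Z T → Z (S ⊕ T)) → (∀ {S T} → Z′ S → Z′ T → Z′ (S ⊕ T)) →
  (∀ I → IndepOf Z I ⇔ IndepOf Z′ I) → ∀ T → Z T ⇔ Z′ T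
independents-determine {n} {Z} {Z′} Z? Z′? Z∅ Z′∅ Z⊕ Z′⊕ same T =
  mk⇔ (half Z? Z′? Z∅ Z′∅ Z⊕ Z′⊕ (λ I → Equivalence.from (same I)) (λ I → Equivalence.to (same I)) T (<-wellFounded _))
      (half Z′? Z? Z′∅ Z∅ Z′⊕ Z⊕ (λ I → Equivalence.to (same I)) (λ I → Equivalence.from (same I)) T (<-wellFounded _))
  where
  half : ∀ {Y Y′ : Subset n → Set} → (∀ T → Dec (Y T)) → (∀ T → Dec (Y′ T)) → Y ∅ → Y′ ∅ →
    (∀ {S T} → Y S → Y T → Y (S ⊕ T)) → (∀ {S T} → Y′ S → Y′ T → Y′ (S ⊕ T)) →
    (∀ I → IndepOf Y′ I → IndepOf Y I) → (∀ I → IndepOf Y I → IndepOf Y′ I) →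
    ∀ T → Acc _<_ ∣ T ∣ → Y T → Y′ T
  half {Y} {Y′} Y? Y′? Y∅ Y′∅ Y⊕ Y′⊕ from to T (acc rs) YT
    with anySubset? (λ S → (S ⊆? T) ×-dec (Y′? S ×-dec ¬? (S ≟ₛ ∅)))
  ... | no none = subst Y′ (sym (from T (λ S S⊆T Y′S → decidable-stable (S ≟ₛ ∅) λ S≢∅ → none (S , (λ {x} → S⊆T {x}) , Y′S , S≢∅)) T id YT)) Y′∅
  ... | yes (S , S⊆T , Y′S , S≢∅) with Fin.any? (λ j → (j ∈? T) ×-dec ¬? (j ∈? S))
  ...   | no none = subst Y′ (lookup-ext eq) Y′S
    where
    eq : ∀ j → S ! j ≡ T ! j
    eq j with S ! j in Sj | T ! j in Tj
    ... | true  | true  = refl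
    ... | false | false = refl
    ... | true  | false = contradiction Tj (true≢false (∈⇒! (S⊆T (!⇒∈ S Sj))))
    ... | false | true  = contradiction (j , !⇒∈ T Tj , λ j∈S → true≢false (∈⇒! j∈S) Sj) none
  ...   | yes (j , j∈T , j∉S) =
    subst Y′ (⊕-cancel S T) (Y′⊕ Y′S (half Y? Y′? Y∅ Y′∅ Y⊕ Y′⊕ from to (S ⊕ T) (rs (p⊂q⇒∣p∣<∣q∣ (sum⊆ , k , S⊆T (!⇒∈ S Sk) , k∉)))
      (Y⊕ (half Y′? Y? Y′∅ Y∅ Y′⊕ Y⊕ to from S (rs (p⊂q⇒∣p∣<∣q∣ ((λ {x} → S⊆T {x}) , j , j∈T , j∉S))) Y′S) YT)))
    where
    nonempty : ∃ λ k → S ! k ≡ true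
    nonempty = decidable-stable (Fin.any? λ k → S ! k Bool.≟ true) λ none → S≢∅ (∅-intro λ k Sk → none (k , Sk))
    k = proj₁ nonempty
    Sk = proj₂ nonempty
    sum⊆ : (S ⊕ T) ⊆ T
    sum⊆ {i} i∈ with S ! i in Si | trans (sym (!-⊕ S T i)) (∈⇒! i∈)
    ... | true  | _  = S⊆T (!⇒∈ S Si)
    ... | false | Ti = !⇒∈ T Ti
    k∉ : k ∉ (S ⊕ T)
    k∉ k∈ = true≢false (∈⇒! k∈) (trans (!-⊕ S T k) (cong₂ _xor_ Sk (∈⇒! (S⊆T (!⇒∈ S Sk)))))

-- Cycles of the graphs Qᵢ

xsum : ∀ {k} → (Fin k → Bool) → Bool
xsum {zero}  f = false
xsum {suc k} f = f zero xor xsum (f ∘ suc)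

⨁ : ∀ {k n} → (Fin k → Fin n) → Subset n
⨁ {zero}  es = ∅
⨁ {suc k} es = ⁅ es zero ⁆ ⊕ ⨁ (es ∘ suc)

⁅⁆-at : ∀ {n} (e j : Fin n) → ⁅ e ⁆ ! j ≡ does (j Fin.≟ e)
⁅⁆-at e j with j Fin.≟ e
... | yes refl = ∈⇒! (x∈⁅x⁆ e)
... | no j≢e   = ≢true⇒false λ h → j≢e (x∈⁅y⁆⇒x≡y e (!⇒∈ ⁅ e ⁆ h))

dot-⁅⁆ : ∀ {n} (e : Fin n) g → dot ⁅ e ⁆ g ≡ g e
dot-⁅⁆ {suc n} zero g = trans (cong (g zero xor_) (dot-∅ n (g ∘ suc))) (Bool.xor-identityʳ _)
dot-⁅⁆ (suc e) g = dot-⁅⁆ e (g ∘ suc)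

dot-⨁ : ∀ {k n} (es : Fin k → Fin n) g → dot (⨁ es) g ≡ xsum (g ∘ es)
dot-⨁ {zero}  {n} es g = dot-∅ n g
dot-⨁ {suc k} es g = trans (dot-⊕ ⁅ es zero ⁆ (⨁ (es ∘ suc)) g) (cong₂ _xor_ (dot-⁅⁆ (es zero) g) (dot-⨁ (es ∘ suc) g))

⨁-out : ∀ {k n} (es : Fin k → Fin n) j → (∀ i → es i ≢ j) → ⨁ es ! j ≡ false
⨁-out {zero}  es j out = !-∅ j
⨁-out {suc k} es j out = trans (!-⊕ ⁅ es zero ⁆ _ j) (cong₂ _xor_
  (trans (⁅⁆-at (es zero) j) (dec-false (j Fin.≟ es zero) (≢-sym (out zero)))) (⨁-out (es ∘ suc) j (out ∘ suc)))

telescope : ∀ {k V} (g : Fin V → Bool) (vs : Fin (suc k) → Fin V) →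
  xsum (λ (i : Fin k) → g (vs (inject₁ i)) xor g (vs (suc i))) ≡ g (vs zero) xor g (vs (fromℕ k))
telescope {zero}  g vs = sym (Bool.xor-same (g (vs zero)))
telescope {suc k} g vs = trans (cong ((g (vs zero) xor g (vs (suc zero))) xor_) (telescope g (vs ∘ suc))) (lem (g (vs zero)) (g (vs (suc zero))) _)
  where
  open xor-∧-Solver
  lem : ∀ x y z → (x xor y) xor (y xor z) ≡ x xor z
  lem = solve 3 (λ x y z → (x :+ y) :+ (y :+ z) := x :+ z) refl

xsum-snoc : ∀ {k} (f : Fin (suc k) → Bool) → xsum f ≡ xsum (f ∘ inject₁) xor f (fromℕ k)
xsum-snoc {zero}  f = Bool.xor-identityʳ (f zero)
xsum-snoc {suc k} f = trans (cong (f zero xor_) (xsum-snoc (f ∘ suc))) (sym (Bool.xor-assoc (f zero) _ _))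

xsum-cong : ∀ {k} {f g : Fin k → Bool} → (∀ i → f i ≡ g i) → xsum f ≡ xsum g
xsum-cong {zero}  e = refl
xsum-cong {suc k} e = cong₂ _xor_ (e zero) (xsum-cong (e ∘ suc))

-- The incidence columns telescope around the cycle. Their index set is nonempty because, the edges
-- being distinct, the first one does not cancel.
cycle⇒dependent : ∀ G I → CycleIn G I → ¬ MatIndep (incidence G) I
cycle⇒dependent G I cyc ind = true≢false here′ (trans (cong (_! es zero) (ind (⨁ es) sub (lookup-ext kernel-at))) (!-∅ (es zero)))
  where
  open CycleIn cyc
  g : Fin (nV G) → Fin (nV G) → Bool
  g x y = does (x Fin.≟ y)
  joins : ∀ x {e y z} → Joins G e y z → incidence G e ! x ≡ g x y xor g x z
  joins x {e} (inj₁ eq) rewrite !-tabulate (λ x → g x (proj₁ (ends G e)) xor g x (proj₂ (ends G e))) x | eq = refl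
  joins x {e} {y} {z} (inj₂ eq) rewrite !-tabulate (λ x → g x (proj₁ (ends G e)) xor g x (proj₂ (ends G e))) x | eq = Bool.xor-comm (g x z) (g x y)
  kernel-at : ∀ x → colSum (incidence G) (⨁ es) ! x ≡ ∅ ! x
  kernel-at x = begin
    colSum (incidence G) (⨁ es) ! x ≡⟨ colSum-at (incidence G) (⨁ es) x ⟩
    dot (⨁ es) (λ e → incidence G e ! x) ≡⟨ dot-⨁ es _ ⟩
    xsum (λ i → incidence G (es i) ! x) ≡⟨ xsum-snoc (λ i → incidence G (es i) ! x) ⟩
    xsum (λ i → incidence G (es (inject₁ i)) ! x) xor incidence G (es (fromℕ k)) ! x
      ≡⟨ cong₂ _xor_ (xsum-cong λ i → joins x (CycleIn.step cyc i)) (joins x close) ⟩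
    xsum (λ i → g x (vs (inject₁ i)) xor g x (vs (suc i))) xor (g x (vs (fromℕ k)) xor g x (vs zero))
      ≡⟨ cong (_xor (g x (vs (fromℕ k)) xor g x (vs zero))) (telescope (g x) vs) ⟩
    (g x (vs zero) xor g x (vs (fromℕ k))) xor (g x (vs (fromℕ k)) xor g x (vs zero))
      ≡⟨ lem (g x (vs zero)) (g x (vs (fromℕ k))) ⟩
    false ≡⟨ !-∅ x ⟨
    ∅ ! x ∎
    where
    open ≡-Reasoning
    lem : ∀ a b → (a xor b) xor (b xor a) ≡ false
    lem true  true  = refl
    lem true  false = refl
    lem false true  = refl
    lem false false = refl
  sub : ⨁ es ⊆ I
  sub {j} j∈ with Fin.any? (λ i → es i Fin.≟ j)
  ... | yes (i , refl) = inI i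
  ... | no none = contradiction (⨁-out es j λ i eq → none (i , eq)) (true≢false (∈⇒! j∈))
  here′ : ⨁ es ! es zero ≡ true
  here′ = trans (!-⊕ ⁅ es zero ⁆ _ (es zero)) (cong₂ _xor_ (∈⇒! (x∈⁅x⁆ (es zero)))
    (⨁-out (es ∘ suc) (es zero) λ i eq → Fin.0≢1+n (sym (esInj eq))))

record Circuit (G : Graph) : Set where
  constructor circuit
  field
    {k} : ℕ
    vs  : Vec (Fin (nV G)) (suc k)
    es  : Vec (Fin (nE G)) (suc k)

joins? : ∀ G e x y → Dec (Joins G e x y)
joins? G e x y = pair? (ends G e) (x , y) ⊎-dec pair? (ends G e) (y , x)
  where
  pair? : (p q : Fin (nV G) × Fin (nV G)) → Dec (p ≡ q)
  pair? (a , b) (c , d) = map′ (λ { (refl , refl) → refl }) (λ { refl → refl , refl }) ((a Fin.≟ c) ×-dec (b Fin.≟ d))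

Valid : ∀ {G} → Circuit G → Set
Valid {G} (circuit {k} vs es) =
  (∀ i j → lookup vs i ≡ lookup vs j → i ≡ j) × (∀ i j → lookup es i ≡ lookup es j → i ≡ j) ×
  (∀ (i : Fin k) → Joins G (lookup es (inject₁ i)) (lookup vs (inject₁ i)) (lookup vs (suc i))) ×
  Joins G (lookup es (fromℕ k)) (lookup vs (fromℕ k)) (lookup vs zero)

valid? : ∀ {G} (c : Circuit G) → Dec (Valid c)
valid? {G} (circuit vs es) =
  (Fin.all? λ i → Fin.all? λ j → (lookup vs i Fin.≟ lookup vs j) →-dec (i Fin.≟ j)) ×-dec
  ((Fin.all? λ i → Fin.all? λ j → (lookup es i Fin.≟ lookup es j) →-dec (i Fin.≟ j)) ×-dec
  ((Fin.all? λ i → joins? G _ _ _) ×-dec joins? G _ _ _))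

EdgesIn : ∀ {G} → Circuit G → Subset (nE G) → Set
EdgesIn c T = ∀ i → T ! lookup (Circuit.es c) i ≡ true

edgesIn? : ∀ {G} (c : Circuit G) T → Dec (EdgesIn c T)
edgesIn? c T = Fin.all? λ i → T ! lookup (Circuit.es c) i Bool.≟ true

valid⇒cycle : ∀ {G I} (c : Circuit G) → Valid c → EdgesIn c I → CycleIn G I
valid⇒cycle {I = I} c (vs-inj , es-inj , st , cl) e = record
  { vs = lookup (Circuit.vs c) ; es = lookup (Circuit.es c) ; vsInj = vs-inj _ _ ; esInj = es-inj _ _
  ; inI = λ i → !⇒∈ I (e i) ; step = st ; close = cl }

-- That every nonempty element of the cycle space contains a cycle is settled for each Qᵢ by
-- evaluation over its 64 edge sets.
Enough : (G : Graph) → List (Circuit G) → Set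
Enough G cs = ∀ T → colSum (incidence G) T ≡ ∅ → T ≡ ∅ ⊎ Any (λ c → Valid c × EdgesIn c T) cs

enough? : ∀ G cs → Dec (Enough G cs)
enough? G cs = allSubset? λ T → _ ≟ₛ _ →-dec (T ≟ₛ ∅ ⊎-dec any? (λ c → valid? c ×-dec edgesIn? c T) cs)

acyclic⇔ : ∀ G cs → Enough G cs → ∀ I → (¬ CycleIn G I) ⇔ MatIndep (incidence G) I
acyclic⇔ G cs enough I = mk⇔ to (λ ind cyc → cycle⇒dependent G I cyc ind)
  where
  to : ¬ CycleIn G I → MatIndep (incidence G) I
  to acyclic T T⊆I KT with enough T KT
  ... | inj₁ T≡∅ = T≡∅
  ... | inj₂ found with satisfied found
  ...   | c , val , inT = contradiction (valid⇒cycle c val λ i → ∈⇒! (T⊆I (!⇒∈ T (inT i)))) acyclic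

circuits₁ : List (Circuit Q₁)
circuits₁ =
  circuit (# 0 ∷ # 1 ∷ # 2 ∷ []) (# 0 ∷ # 3 ∷ # 1 ∷ []) ∷
  circuit (# 0 ∷ # 1 ∷ # 3 ∷ []) (# 0 ∷ # 4 ∷ # 2 ∷ []) ∷
  circuit (# 0 ∷ # 2 ∷ # 3 ∷ []) (# 1 ∷ # 5 ∷ # 2 ∷ []) ∷
  circuit (# 1 ∷ # 2 ∷ # 3 ∷ []) (# 3 ∷ # 5 ∷ # 4 ∷ []) ∷
  circuit (# 0 ∷ # 1 ∷ # 2 ∷ # 3 ∷ []) (# 0 ∷ # 3 ∷ # 5 ∷ # 2 ∷ []) ∷
  circuit (# 0 ∷ # 1 ∷ # 3 ∷ # 2 ∷ []) (# 0 ∷ # 4 ∷ # 5 ∷ # 1 ∷ []) ∷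
  circuit (# 0 ∷ # 2 ∷ # 1 ∷ # 3 ∷ []) (# 1 ∷ # 3 ∷ # 4 ∷ # 2 ∷ []) ∷ []

-- Some of these are not circuits, depending on the ends s of the sixth edge.
candidates : ∀ s → List (Circuit (Qtab s))
candidates s =
  circuit (# 0 ∷ []) (# 5 ∷ []) ∷ circuit (# 2 ∷ []) (# 5 ∷ []) ∷
  circuit (# 0 ∷ # 1 ∷ []) (# 0 ∷ # 1 ∷ []) ∷ circuit (# 0 ∷ # 2 ∷ []) (# 2 ∷ # 3 ∷ []) ∷ circuit (# 1 ∷ # 2 ∷ []) (# 4 ∷ # 5 ∷ []) ∷
  triangle-on (# 0) (# 2) (# 4) ∷ triangle-on (# 0) (# 3) (# 4) ∷ triangle-on (# 1) (# 2) (# 4) ∷ triangle-on (# 1) (# 3) (# 4) ∷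
  triangle-on (# 0) (# 2) (# 5) ∷ triangle-on (# 0) (# 3) (# 5) ∷ triangle-on (# 1) (# 2) (# 5) ∷ triangle-on (# 1) (# 3) (# 5) ∷ []
  where
  triangle-on : Fin 6 → Fin 6 → Fin 6 → Circuit (Qtab s)
  triangle-on ta tb ab = circuit (# 0 ∷ # 1 ∷ # 2 ∷ []) (ta ∷ ab ∷ tb ∷ [])

acyclic⇔Q : ∀ i I → (¬ CycleIn (Q i) I) ⇔ MatIndep (incidence (Q i)) I
acyclic⇔Q zero = acyclic⇔ Q₁ circuits₁ (toWitness {a? = enough? Q₁ circuits₁} _)
acyclic⇔Q (suc zero) = acyclic⇔ Q₂ (candidates _) (toWitness {a? = enough? Q₂ (candidates _)} _)
acyclic⇔Q (suc (suc zero)) = acyclic⇔ Q₃ (candidates _) (toWitness {a? = enough? Q₃ (candidates _)} _)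
acyclic⇔Q (suc (suc (suc zero))) = acyclic⇔ Q₄ (candidates _) (toWitness {a? = enough? Q₄ (candidates _)} _)

-- From a minor M(Qᵢ) to a splitting that is not a gammoid

infixl 7 _∘ₛ_
_∘ₛ_ : ∀ {m n} → Subset n → (Fin m → Fin n) → Subset m
T ∘ₛ f = tabulate λ x → T ! f x

!-∘ₛ : ∀ {m n} (T : Subset n) (f : Fin m → Fin n) x → (T ∘ₛ f) ! x ≡ T ! f x
!-∘ₛ T f x = !-tabulate _ x

-- The sum of the singletons f y over y in Y; a xor makes dot-push hold
-- without injectivity.
push : ∀ {m n} → (Fin m → Fin n) → Subset m → Fin n → Bool
push f [] j = false
push f (y ∷ Y) j = (y ∧ does (j Fin.≟ f zero)) xor push (f ∘ suc) Y j

dot-push : ∀ {m n} (f : Fin m → Fin n) Y T → dot T (push f Y) ≡ dot (T ∘ₛ f) (Y !_)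
dot-push f [] T = dot-false T
dot-push f (y ∷ Y) T = trans (dot-xor T _ (push (f ∘ suc) Y))
  (cong₂ _xor_ (trans (dot-single T (f zero) y) (Bool.∧-comm y _)) (dot-push (f ∘ suc) Y T))

push-out : ∀ {m n} (f : Fin m → Fin n) Y j → (∀ x → f x ≢ j) → push f Y j ≡ false
push-out f [] j out = refl
push-out f (y ∷ Y) j out = cong₂ _xor_ (trans (cong (y ∧_) (dec-false (j Fin.≟ f zero) (≢-sym (out zero)))) (Bool.∧-zeroʳ y)) (push-out (f ∘ suc) Y j (out ∘ suc))

push-at : ∀ {m n} (f : Fin m → Fin n) → Injective _≡_ _≡_ f → ∀ Y x → push f Y (f x) ≡ Y ! x
push-at f inj (y ∷ Y) zero = trans (cong₂ _xor_ (trans (cong (y ∧_) (dec-true (f zero Fin.≟ f zero) refl)) (Bool.∧-identityʳ y))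
    (push-out (f ∘ suc) Y (f zero) λ x e → Fin.0≢1+n (sym (inj e)))) (Bool.xor-identityʳ y)
push-at f inj (y ∷ Y) (suc x) = trans (cong (_xor push (f ∘ suc) Y (f (suc x)))
    (trans (cong (y ∧_) (dec-false (f (suc x) Fin.≟ f zero) λ e → Fin.0≢1+n (sym (inj e)))) (Bool.∧-zeroʳ y)))
  (push-at (f ∘ suc) (λ e → Fin.suc-injective (inj e)) Y x)

two-elements : ∀ {n} (X : Subset n) {a b} → X ! a ≡ true → X ! b ≡ true → a ≢ b → 2 ≤ ∣ X ∣
two-elements X {a} {b} Xa Xb a≢b = subst (_< ∣ X ∣) (∣⁅x⁆∣≡1 a) (p⊂q⇒∣p∣<∣q∣
  ((λ x∈ → subst (_∈ X) (sym (x∈⁅y⁆⇒x≡y a x∈)) (!⇒∈ X Xa)) , b , !⇒∈ X Xb , λ b∈ → a≢b (sym (x∈⁅y⁆⇒x≡y a b∈))))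

six-edges : (V : ℕ) → (Fin 6 → Fin V × Fin V) → Graph
six-edges V es = record { nV = V ; nE = 6 ; ends = es }

record Permutation : Set where
  field
    to from : Fin 6 → Fin 6
    to-from : ∀ x → to (from x) ≡ x
    from-to : ∀ x → from (to x) ≡ x

permutation : (to from : Vec (Fin 6) 6) →
  {True (Fin.all? λ x → lookup to (lookup from x) Fin.≟ x)} → {True (Fin.all? λ x → lookup from (lookup to x) Fin.≟ x)} → Permutation
permutation to from {p} {q} = record { to = lookup to ; from = lookup from ; to-from = toWitness p ; from-to = toWitness q }

identity : Permutation
identity = record { to = id ; from = id ; to-from = λ _ → refl ; from-to = λ _ → refl }

module _ (V : ℕ) (es : Fin 6 → Fin V × Fin V) where

  private
    H = six-edges V es

  -- The splitting of M(H) along X is M(K₄), after relabelling by σ.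
  SplitsToK₄ : Subset 6 → Permutation → Set
  SplitsToK₄ X σ = ∀ T → (K₄-cycle T → colSum (incidence H) (T ∘ₛ from) ≡ ∅ × dot (T ∘ₛ from) (X !_) ≡ false) ×
                         (colSum (incidence H) (T ∘ₛ from) ≡ ∅ × dot (T ∘ₛ from) (X !_) ≡ false → K₄-cycle T)
    where open Permutation σ

  splitsToK₄? : ∀ X σ → Dec (SplitsToK₄ X σ)
  splitsToK₄? X σ = allSubset? λ T → (K₄-cycle? T →-dec rhs? T) ×-dec (rhs? T →-dec K₄-cycle? T)
    where
    open Permutation σ
    rhs? : ∀ T → Dec (colSum (incidence H) (T ∘ₛ from) ≡ ∅ × dot (T ∘ₛ from) (X !_) ≡ false)
    rhs? T = _ ≟ₛ _ ×-dec (_ Bool.≟ false)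

  module _ (acyclic : ∀ I → (¬ CycleIn H I) ⇔ MatIndep (incidence H) I) where

    -- Splitting along the image `Y` of `X` under `f` commutes with taking the minor, since the
    -- parity of a cycle on `Y` is the parity of its trace on `X`. So the splitting along `Y` has a
    -- minor M(K₄).
    minor⇒not-gammoid : (X : Subset 6) (σ : Permutation) → SplitsToK₄ X σ → ∀ {a b} → X ! a ≡ true → X ! b ≡ true → a ≢ b →
      ∀ G {r} (A : Fin (nE G) → Vec Bool r) → Represents (cycleMatroid G) A →
      (∀ Y → 2 ≤ ∣ Y ∣ → BinaryGammoid (splitting A Y)) → ¬ HasMinor (cycleMatroid H) (cycleMatroid G)
    minor⇒not-gammoid X σ splits Xa Xb a≢b G {r} A represents gammoids (f , f-inj , C , f∉C , iso) =
      refute (proj₂ (gammoids Y (two-elements Y (trans (!Y _) Xa) (trans (!Y _) Xb) (λ e → a≢b (f-inj e)))))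
      where
      n = nE G
      open Permutation σ
      open Space (kernel A) using (Cycle)

      Y : Subset n
      Y = tabulate (push f X)

      !Y : ∀ x → Y ! f x ≡ X ! x
      !Y x = trans (!-tabulate (push f X) (f x)) (push-at f f-inj X x)

      parity : ∀ T → dot T (Y !_) ≡ dot (T ∘ₛ f) (X !_)
      parity T = trans (dot-cong T (!-tabulate (push f X))) (dot-push f X T)

      minor-cycles : ∀ T → (colSum (incidence H) T ≡ ∅) ⇔ MinorCycle A f C T
      minor-cycles = independents-determine (Space.cycle? (kernel (incidence H))) (minorCycle? A f C)
        (Space.cycle-∅ (kernel (incidence H)))
        (∅ , Space.cycle-∅ (kernel A) , (λ j e → contradiction (!-∅ j) (true≢false e)) , λ x → trans (!-∅ (f x)) (sym (!-∅ x)))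
        (λ {S} {T} → Space.cycle-⊕ (kernel (incidence H)) {S} {T}) (λ {S} {T} → minorCycle-⊕ A f C {S} {T})
        λ I → mk⇔
          (λ ind → Equivalence.to (contr I) (Equivalence.to (iso I (image f I) (image⇔ f I)) (Equivalence.from (acyclic I) ind)))
          (λ ind → Equivalence.to (acyclic I) (Equivalence.from (iso I (image f I) (image⇔ f I)) (Equivalence.from (contr I) ind)))
        where
        contr : ∀ I → _
        contr I = contrIndep⇔ A f C f-inj f∉C (Indep (cycleMatroid G)) represents I (image f I) (image⇔ f I)

      -- A basis of `C` for `A` serves the splitting too: `Y` misses `C`, so respanning inside `C`
      -- does not change the parity on `Y`.
      b = basis A C
      open Basis b

      f∉J : ∀ x → f x ∉ J
      f∉J x fx∈J = f∉C x (J⊆C fx∈J)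

      hit? : ∀ I j → Dec (∃ λ x → I ! x ≡ true × f (to x) ≡ j)
      hit? I j = Fin.any? λ x → (I ! x Bool.≟ true) ×-dec (f (to x) Fin.≟ j)

      lift : Subset 6 → Subset n
      lift I = tabulate λ j → does (hit? I j) ∨ J ! j

      lift-elim : ∀ I {j} → j ∈ lift I → (∃ λ x → I ! x ≡ true × f (to x) ≡ j) ⊎ j ∈ J
      lift-elim I {j} j∈ with ∨-split {does (hit? I j)} (trans (sym (!-tabulate _ j)) (∈⇒! j∈))
      ... | inj₁ h  = inj₁ (does⇒ (hit? I j) h)
      ... | inj₂ Jj = inj₂ (!⇒∈ J Jj)

      lift-hit : ∀ I x → I ! x ≡ true → f (to x) ∈ lift I
      lift-hit I x Ix = !⇒∈ (lift I) (trans (!-tabulate _ (f (to x))) (∨-introˡ (dec-true (hit? I (f (to x))) (x , Ix , refl))))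

      lift-J : ∀ I {j} → j ∈ J → j ∈ lift I
      lift-J I {j} j∈J = !⇒∈ (lift I) (trans (!-tabulate _ j) (∨-introʳ {does (hit? I j)} (∈⇒! j∈J)))

      ∘-from-to : ∀ (T : Subset 6) → (T ∘ₛ to) ∘ₛ from ≡ T
      ∘-from-to T = lookup-ext λ x → trans (!-∘ₛ (T ∘ₛ to) from x) (trans (!-∘ₛ T to (from x)) (cong (T !_) (to-from x)))

      lift-indep : ∀ I → MatIndep (incidence Q₁) I → MatIndep (splitMatrix A Y) (lift I)
      lift-indep I ind T T⊆ split = indep T T⊆J KT
        where
        KT : Cycle T
        KT = proj₁ (Equivalence.to (split-cycle A Y T) split)
        even : dot (T ∘ₛ f) (X !_) ≡ false
        even = trans (sym (parity T)) (proj₂ (Equivalence.to (split-cycle A Y T) split))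
        within : ∀ j → T ! j ≡ true → j ∈ C ⊎ ∃ λ x → f x ≡ j
        within j Tj with lift-elim I (T⊆ (!⇒∈ T Tj))
        ... | inj₁ (x , _ , e) = inj₂ (to x , e)
        ... | inj₂ j∈J = inj₁ (J⊆C j∈J)
        U : Subset 6
        U = (T ∘ₛ f) ∘ₛ to
        K₄U : K₄-cycle U
        K₄U = proj₂ (splits U) (subst (λ S → colSum (incidence H) S ≡ ∅ × dot S (X !_) ≡ false) (sym (∘-from-to (T ∘ₛ f)))
                (Equivalence.from (minor-cycles (T ∘ₛ f)) (T , KT , within , λ x → sym (!-∘ₛ T f x)) , even))
        U-at : ∀ x → U ! x ≡ T ! f (to x)
        U-at x = trans (!-∘ₛ (T ∘ₛ f) to x) (!-∘ₛ T f (to x))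
        U⊆I : U ⊆ I
        U⊆I {x} x∈U with lift-elim I (T⊆ (!⇒∈ T (trans (sym (U-at x)) (∈⇒! x∈U))))
        ... | inj₂ ∈J = contradiction ∈J (f∉J (to x))
        ... | inj₁ (y , Iy , e) = !⇒∈ I (trans (cong (I !_) (trans (sym (from-to x)) (trans (cong from (sym (f-inj e))) (from-to y)))) Iy)
        U≡∅ : U ≡ ∅
        U≡∅ = ind U U⊆I K₄U
        T⊆J : T ⊆ J
        T⊆J {j} j∈T with lift-elim I (T⊆ j∈T)
        ... | inj₂ j∈J = j∈J
        ... | inj₁ (x , _ , refl) = contradiction (trans (sym (U-at x)) (trans (cong (_! x) U≡∅) (!-∅ x))) (true≢false (∈⇒! j∈T))

      unlift-indep : ∀ I → MatIndep (splitMatrix A Y) (lift I) → MatIndep (incidence Q₁) I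
      unlift-indep I ind U U⊆I K₄U with Equivalence.to (minor-cycles (U ∘ₛ from)) (proj₁ (proj₁ (splits U) K₄U))
      ... | T , KT , wT , tT with respan A b T KT
      ...   | T′ , KT′ , inJ , same = ∅-intro λ x Ux → true≢false Ux (trans (sym (at x)) (trans (cong (_! f (to x)) T′≡∅) (!-∅ (f (to x)))))
        where
        at-f : ∀ x → T′ ! f x ≡ (U ∘ₛ from) ! x
        at-f x = trans (same (f x) (f∉C x)) (tT x)
        at : ∀ x → T′ ! f (to x) ≡ U ! x
        at x = trans (at-f (to x)) (trans (!-∘ₛ U from (to x)) (cong (U !_) (from-to x)))
        T′⊆ : T′ ⊆ lift I
        T′⊆ {j} j∈ with j ∈? C
        ... | yes j∈C = lift-J I (inJ j (∈⇒! j∈) j∈C)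
        ... | no j∉C with wT j (trans (sym (same j j∉C)) (∈⇒! j∈))
        ...   | inj₁ j∈C = contradiction j∈C j∉C
        ...   | inj₂ (x , refl) = subst (_∈ lift I) (cong f (to-from x)) (lift-hit I (from x)
                  (∈⇒! (U⊆I (!⇒∈ U (trans (sym (!-∘ₛ U from x)) (trans (sym (at-f x)) (∈⇒! j∈)))))))
        T′≡∅ : T′ ≡ ∅
        T′≡∅ = ind T′ T′⊆ (Equivalence.from (split-cycle A Y T′)
          (KT′ , trans (parity T′) (trans (cong (λ S → dot S (X !_)) (lookup-ext λ x → trans (!-∘ₛ T′ f x) (at-f x))) (proj₂ (proj₁ (splits U) K₄U)))))

      refute : ¬ Gammoid (splitting A Y)
      refute (v , Arc , emb , emb-inj , targets , rep) =
        K₄-not-gammoid Arc targets JV g (λ e → trans (sym (from-to _)) (trans (cong from (f-inj (emb-inj e))) (from-to _))) g∉J λ I → mk⇔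
          (λ ind → Flow-mono (occupied I) (linked⇒flow Arc emb targets (lift I) (Equivalence.to (rep (lift I)) (lift-indep I ind))))
          (λ φ → unlift-indep I (Equivalence.from (rep (lift I)) (flow⇒linked Arc emb targets (lift I) emb-inj (Flow-mono (source I) φ))))
        where
        J? : ∀ y → Dec (∃ λ j → j ∈ J × emb j ≡ y)
        J? y = Fin.any? λ j → (j ∈? J) ×-dec (emb j Fin.≟ y)
        JV : Fin v → Bool
        JV y = does (J? y)
        g : Fin 6 → Fin v
        g x = emb (f (to x))
        g∉J : ∀ x → JV (g x) ≡ false
        g∉J x = dec-false (J? (g x)) λ (j , j∈J , e) → f∉J (to x) (subst (_∈ J) (emb-inj e) j∈J)
        occupied : ∀ I y → Occupied JV g I y → Sources emb (lift I) y
        occupied I y (inj₁ Jy) with does⇒ (J? y) Jy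
        ... | j , j∈J , e = j , lift-J I j∈J , e
        occupied I y (inj₂ (x , Ix , e)) = f (to x) , lift-hit I x Ix , e
        source : ∀ I y → Sources emb (lift I) y → Occupied JV g I y
        source I y (j , j∈ , e) with lift-elim I j∈
        ... | inj₁ (x , Ix , refl) = inj₂ (x , Ix , e)
        ... | inj₂ j∈J = inj₁ (dec-true (J? y) (j , j∈J , e))

-- From a splitting with an M(K₄) minor to a minor M(Qᵢ)

∂ : Subset 6 → Vec Bool 4
∂ = colSum (incidence Q₁)

∂-even : ∀ T → dot (∂ T) (λ _ → true) ≡ false
∂-even = toWitness {a? = allSubset? λ T → dot (∂ T) (λ _ → true) Bool.≟ false} _

module _ (V : ℕ) (es : Fin 6 → Fin V × Fin V) where

  private
    H = six-edges V es

  -- M(H) is the contraction by p of M(K₄) extended by the vector p.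
  Contraction : Vec Bool 4 → Permutation → Set
  Contraction p π = ∀ T → (colSum (incidence H) T ≡ ∅ → ∂ (T ∘ₛ to) ≡ ∅ ⊎ ∂ (T ∘ₛ to) ≡ p) ×
                          (∂ (T ∘ₛ to) ≡ ∅ ⊎ ∂ (T ∘ₛ to) ≡ p → colSum (incidence H) T ≡ ∅)
    where open Permutation π

  contraction? : ∀ p π → Dec (Contraction p π)
  contraction? p π = allSubset? λ T → (_ ≟ₛ _ →-dec rhs? T) ×-dec (rhs? T →-dec _ ≟ₛ _)
    where
    open Permutation π
    rhs? : ∀ T → Dec (∂ (T ∘ₛ to) ≡ ∅ ⊎ ∂ (T ∘ₛ to) ≡ p)
    rhs? T = _ ≟ₛ _ ⊎-dec _ ≟ₛ _

  contraction⇒minor : (∀ I → (¬ CycleIn H I) ⇔ MatIndep (incidence H) I) → ∀ p π → Contraction p π →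
    ∀ G {r} (A : Fin (nE G) → Vec Bool r) → Represents (cycleMatroid G) A →
    (elem : Fin 6 → Fin (nE G)) → Injective _≡_ _≡_ elem → ∀ C → (∀ x → elem x ∉ C) →
    (∀ U → MinorCycle A elem C U ⇔ (∂ U ≡ ∅ ⊎ ∂ U ≡ p)) → HasMinor (cycleMatroid H) (cycleMatroid G)
  contraction⇒minor acyclic p π κ G A represents elem elem-inj C elem∉C cycles =
    f , f-inj , C , (λ x → elem∉C (from x)) , λ I J img → mk⇔
      (λ ind → Equivalence.from (contr I J img) λ T T⊆I m → Equivalence.to (acyclic I) ind T T⊆I (proj₂ (κ T) (Equivalence.to (cycles (T ∘ₛ to)) (relabel T m))))
      (λ ind → Equivalence.from (acyclic I) λ T T⊆I k → Equivalence.to (contr I J img) ind T T⊆I (unrelabel T (Equivalence.from (cycles (T ∘ₛ to)) (proj₁ (κ T) k))))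
    where
    open Permutation π
    f : Fin 6 → Fin (nE G)
    f x = elem (from x)
    f-inj : Injective _≡_ _≡_ f
    f-inj e = trans (sym (to-from _)) (trans (cong to (elem-inj e)) (to-from _))
    contr : ∀ I J → Image⇔ f I J → _
    contr I J img = contrIndep⇔ A f C f-inj (λ x → elem∉C (from x)) (Indep (cycleMatroid G)) represents I J img
    relabel : ∀ T → MinorCycle A f C T → MinorCycle A elem C (T ∘ₛ to)
    relabel T (S , KS , wS , tS) = S , KS , (λ j Sj → [ inj₁ , (λ (x , e) → inj₂ (from x , e)) ]′ (wS j Sj)) ,
      λ x → trans (cong (λ y → S ! elem y) (sym (from-to x))) (trans (tS (to x)) (sym (!-∘ₛ T to x)))
    unrelabel : ∀ T → MinorCycle A elem C (T ∘ₛ to) → MinorCycle A f C T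
    unrelabel T (S , KS , wS , tS) = S , KS , (λ j Sj → [ inj₁ , (λ (x , e) → inj₂ (to x , trans (cong elem (from-to x)) e)) ]′ (wS j Sj)) ,
      λ x → trans (tS (from x)) (trans (!-∘ₛ T to (from x)) (cong (T !_) (to-from x)))

con? : ∀ k → Dec (k ≡ con)
con? act = no λ ()
con? con = yes refl
con? del = no λ ()

-- The elements and the contracted set of the minor of the splitting are kept. Without the parity
-- condition the traces gain at most one coset of the cycle space of K₄, and its common boundary p
-- decides which Qᵢ arises.
K₄-minor⇒Q-minor : ∀ G {r} (A : Fin (nE G) → Vec Bool r) → Represents (cycleMatroid G) A → ∀ X →
  Minors.K₄-minor (kernel (splitMatrix A X)) → ∃ λ i → HasMinor (cycleMatroid (Q i)) (cycleMatroid G)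
K₄-minor⇒Q-minor G A represents X minor = choose (∂ t) (∂-even t) minor-cycles
  where
  open Minors (kernel (splitMatrix A X)) using (module K₄-minor; Allowed)
  open K₄-minor minor
  open Space (kernel A)
  n = nE G

  C : Subset n
  C = tabulate λ j → does (con? (colour j))

  ∈C : ∀ {j} → j ∈ C → colour j ≡ con
  ∈C {j} j∈ = does⇒ (con? (colour j)) (trans (sym (!-tabulate _ j)) (∈⇒! j∈))

  C∋ : ∀ {j} → colour j ≡ con → j ∈ C
  C∋ {j} cj = !⇒∈ C (trans (!-tabulate _ j) (dec-true (con? (colour j)) cj))

  elem∉C : ∀ x → elem x ∉ C
  elem∉C x ∈ = contradiction (trans (sym (elem-act x)) (∈C ∈)) λ ()

  Within-minor : Subset n → Set
  Within-minor T = ∀ j → T ! j ≡ true → j ∈ C ⊎ ∃ λ x → elem x ≡ j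

  allowed : ∀ {T} → Cycle T → Within-minor T → dot T (X !_) ≡ false → Allowed colour T
  allowed {T} KT w even = Equivalence.from (split-cycle A X T) (KT , even) , λ j Tj cj → bad j cj (w j Tj)
    where
    bad : ∀ j → colour j ≡ del → ¬ (j ∈ C ⊎ ∃ λ x → elem x ≡ j)
    bad j cj (inj₁ j∈C) = contradiction (trans (sym (∈C j∈C)) cj) λ ()
    bad j cj (inj₂ (x , refl)) = contradiction (trans (sym (elem-act x)) cj) λ ()

  within-minor : ∀ {T} → Allowed colour T → Within-minor T
  within-minor (_ , aT) j Tj with colour j in cj
  ... | con = inj₁ (C∋ cj)
  ... | act = inj₂ (act-elem j cj)
  ... | del = contradiction cj (aT j Tj)

  even⇒K₄ : ∀ {T} → Cycle T → Within-minor T → dot T (X !_) ≡ false → K₄-cycle (T ∘ₛ elem)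
  even⇒K₄ {T} KT w even = Equivalence.from (cycles (T ∘ₛ elem)) (T , allowed KT w even , λ x → sym (!-∘ₛ T elem x))

  -- Tested on the trace, since a cycle that meets `X` oddly may still have its trace in the cycle
  -- space of K₄.
  Odd : Subset n → Set
  Odd T = Cycle T × Within-minor T × ¬ K₄-cycle (T ∘ₛ elem)

  odd? : ∀ T → Dec (Odd T)
  odd? T = cycle? T ×-dec ((Fin.all? λ j → (T ! j Bool.≟ true) →-dec ((j ∈? C) ⊎-dec Fin.any? λ x → elem x Fin.≟ j)) ×-dec ¬? (K₄-cycle? (T ∘ₛ elem)))

  -- T₀ represents the nonzero coset of the cycle space of K₄ in that of the
  -- minor of B, or is ∅ when the two spaces agree.
  pivot : ∃ λ T₀ → Cycle T₀ × Within-minor T₀ × (∀ T → Odd T → ¬ K₄-cycle (T₀ ∘ₛ elem))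
  pivot with anySubset? odd?
  ... | yes (T₀ , KT₀ , wT₀ , odd) = T₀ , KT₀ , wT₀ , λ _ _ → odd
  ... | no none = ∅ , cycle-∅ , (λ j e → contradiction (!-∅ j) (true≢false e)) , λ T odd → contradiction (T , odd) none

  T₀ = proj₁ pivot
  KT₀ = proj₁ (proj₂ pivot)
  wT₀ = proj₁ (proj₂ (proj₂ pivot))
  t = T₀ ∘ₛ elem

  ⊕-within : ∀ S T → Within-minor S → Within-minor T → Within-minor (S ⊕ T)
  ⊕-within S T wS wT j e with S ! j in Sj | trans (sym (!-⊕ S T j)) e
  ... | true  | _  = wS j Sj
  ... | false | Tj = wT j Tj

  ∘ₛ-⊕ : ∀ S T → (S ⊕ T) ∘ₛ elem ≡ (S ∘ₛ elem) ⊕ (T ∘ₛ elem)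
  ∘ₛ-⊕ S T = lookup-ext λ x → trans (!-∘ₛ (S ⊕ T) elem x) (trans (!-⊕ S T (elem x))
    (sym (trans (!-⊕ (S ∘ₛ elem) (T ∘ₛ elem) x) (cong₂ _xor_ (!-∘ₛ S elem x) (!-∘ₛ T elem x)))))

  parity : ∀ {T} → Cycle T → Within-minor T → ¬ K₄-cycle (T ∘ₛ elem) → dot T (X !_) ≡ true
  parity {T} KT w odd with dot T (X !_) in e
  ... | true  = refl
  ... | false = contradiction (even⇒K₄ KT w e) odd

  minor-cycles : ∀ U → MinorCycle A elem C U ⇔ (∂ U ≡ ∅ ⊎ ∂ U ≡ ∂ t)
  minor-cycles U = mk⇔ to from
    where
    to : MinorCycle A elem C U → ∂ U ≡ ∅ ⊎ ∂ U ≡ ∂ t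
    to (T , KT , wT , tT) = subst (λ U → ∂ U ≡ ∅ ⊎ ∂ U ≡ ∂ t) {T ∘ₛ elem} {U} (lookup-ext λ x → trans (!-∘ₛ T elem x) (tT x)) (by (K₄-cycle? (T ∘ₛ elem)))
      where
      by : Dec (K₄-cycle (T ∘ₛ elem)) → ∂ (T ∘ₛ elem) ≡ ∅ ⊎ ∂ (T ∘ₛ elem) ≡ ∂ t
      by (yes k)  = inj₁ k
      by (no odd) = inj₂ (trans (sym (⊕-cancel (∂ t) (∂ (T ∘ₛ elem)))) (trans (cong (∂ t ⊕_) zero-sum) (⊕-∅ (∂ t))))
        where
        ⊕-∅ : ∀ {m} (S : Subset m) → S ⊕ ∅ ≡ S
        ⊕-∅ S = lookup-ext λ j → trans (!-⊕ S ∅ j) (trans (cong (S ! j xor_) (!-∅ j)) (Bool.xor-identityʳ _))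
        t-odd : ¬ K₄-cycle t
        t-odd = proj₂ (proj₂ (proj₂ pivot)) T (KT , wT , odd)
        zero-sum : ∂ t ⊕ ∂ (T ∘ₛ elem) ≡ ∅
        zero-sum = trans (sym (colSum-⊕ (incidence Q₁) t (T ∘ₛ elem))) (trans (cong ∂ (sym (∘ₛ-⊕ T₀ T)))
          (even⇒K₄ (cycle-⊕ KT₀ KT) (⊕-within T₀ T wT₀ wT)
            (trans (dot-⊕ T₀ T _) (cong₂ _xor_ (parity KT₀ wT₀ t-odd) (parity KT wT odd)))))
    lift : ∀ W → K₄-cycle W → MinorCycle A elem C W
    lift W k with Equivalence.to (cycles W) k
    ... | T , aT , tT = T , proj₁ (Equivalence.to (split-cycle A X T) (proj₁ aT)) , within-minor aT , tT
    from : ∂ U ≡ ∅ ⊎ ∂ U ≡ ∂ t → MinorCycle A elem C U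
    from (inj₁ k) = lift U k
    from (inj₂ e) = subst (MinorCycle A elem C) (⊕-cancel t U) (minorCycle-⊕ A elem C {t} {t ⊕ U}
      (T₀ , KT₀ , wT₀ , λ x → sym (!-∘ₛ T₀ elem x))
      (lift (t ⊕ U) (trans (colSum-⊕ (incidence Q₁) t U) (trans (cong (∂ t ⊕_) e) (⊕-self (∂ t))))))

  make : ∀ {V} (es : Fin 6 → Fin V × Fin V) → (∀ I → (¬ CycleIn (six-edges V es) I) ⇔ MatIndep (incidence (six-edges V es)) I) →
    ∀ p π → {True (contraction? V es p π)} → (∀ U → MinorCycle A elem C U ⇔ (∂ U ≡ ∅ ⊎ ∂ U ≡ p)) →
    HasMinor (cycleMatroid (six-edges V es)) (cycleMatroid G)
  make {V} es acyclic p π {w} = contraction⇒minor V es acyclic p π (toWitness w) G A represents elem elem-inj C elem∉C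

  make₂ : ∀ p π → {True (contraction? 3 (ends Q₂) p π)} → (∀ U → MinorCycle A elem C U ⇔ (∂ U ≡ ∅ ⊎ ∂ U ≡ p)) →
    HasMinor (cycleMatroid Q₂) (cycleMatroid G)
  make₂ p π {w} = make (ends Q₂) (acyclic⇔Q (# 1)) p π {w}

  -- A vector of weight two is an edge of K₄: contracting it turns that edge into the loop of `Q₂`,
  -- makes the four adjacent edges two parallel pairs and leaves the opposite edge single. The
  -- vector of weight four is the sum of any two opposite edges, which become the parallel pairs of
  -- `Q₄`.
  choose : ∀ p → dot p (λ _ → true) ≡ false → (∀ U → MinorCycle A elem C U ⇔ (∂ U ≡ ∅ ⊎ ∂ U ≡ p)) →
           ∃ λ i → HasMinor (cycleMatroid (Q i)) (cycleMatroid G)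
  choose p@(false ∷ false ∷ false ∷ false ∷ []) _ h = # 0 , make (ends Q₁) (acyclic⇔Q (# 0)) p
    identity h
  choose p@(false ∷ false ∷ true ∷ true ∷ []) _ h = # 1 , make₂ p
    (permutation (# 4 ∷ # 0 ∷ # 1 ∷ # 2 ∷ # 3 ∷ # 5 ∷ []) (# 1 ∷ # 2 ∷ # 3 ∷ # 4 ∷ # 0 ∷ # 5 ∷ [])) h
  choose p@(false ∷ true ∷ false ∷ true ∷ []) _ h = # 1 , make₂ p
    (permutation (# 0 ∷ # 4 ∷ # 1 ∷ # 2 ∷ # 5 ∷ # 3 ∷ []) (# 0 ∷ # 2 ∷ # 3 ∷ # 5 ∷ # 1 ∷ # 4 ∷ [])) h
  choose p@(false ∷ true ∷ true ∷ false ∷ []) _ h = # 1 , make₂ p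
    (permutation (# 0 ∷ # 1 ∷ # 4 ∷ # 5 ∷ # 2 ∷ # 3 ∷ []) (# 0 ∷ # 1 ∷ # 4 ∷ # 5 ∷ # 2 ∷ # 3 ∷ [])) h
  choose p@(true ∷ false ∷ false ∷ true ∷ []) _ h = # 1 , make₂ p
    (permutation (# 0 ∷ # 2 ∷ # 5 ∷ # 4 ∷ # 1 ∷ # 3 ∷ []) (# 0 ∷ # 4 ∷ # 1 ∷ # 5 ∷ # 3 ∷ # 2 ∷ [])) h
  choose p@(true ∷ false ∷ true ∷ false ∷ []) _ h = # 1 , make₂ p
    (permutation (# 0 ∷ # 5 ∷ # 2 ∷ # 1 ∷ # 4 ∷ # 3 ∷ []) (# 0 ∷ # 3 ∷ # 2 ∷ # 5 ∷ # 4 ∷ # 1 ∷ [])) h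
  choose p@(true ∷ true ∷ false ∷ false ∷ []) _ h = # 1 , make₂ p
    (permutation (# 5 ∷ # 0 ∷ # 2 ∷ # 1 ∷ # 3 ∷ # 4 ∷ []) (# 1 ∷ # 3 ∷ # 2 ∷ # 4 ∷ # 5 ∷ # 0 ∷ [])) h
  choose p@(true ∷ true ∷ true ∷ true ∷ []) _ h = # 3 , make (ends Q₄) (acyclic⇔Q (# 3)) p
    (permutation (# 0 ∷ # 2 ∷ # 4 ∷ # 5 ∷ # 3 ∷ # 1 ∷ []) (# 0 ∷ # 5 ∷ # 1 ∷ # 4 ∷ # 2 ∷ # 3 ∷ [])) h

-- The two implications of the equivalence

rep⇒gammoid : ∀ {n r} (A : Fin n → Vec Bool r) → Representation.Rep (kernel A) (λ _ → act) → Gammoid (vecMatroid A)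
rep⇒gammoid {n} A representation = v , Arc , emb , (λ e → emb-inj _ _ refl refl e) , T , λ I → mk⇔
  (λ ind → flow⇒linked Arc emb T I (λ e → emb-inj _ _ refl refl e)
             (Flow-mono (λ { y (j , j∈I , e) → j , ∈⇒! j∈I , e }) (Equivalence.to (rep (I !_) (λ _ _ → refl)) (to I ind))))
  (λ linked → from I (Equivalence.from (rep (I !_) (λ _ _ → refl))
             (Flow-mono (λ { y (j , Ij , e) → j , !⇒∈ I Ij , e }) (linked⇒flow Arc emb T I linked))))
  where
  open Representation (kernel A)
  open Rep representation
  to : ∀ I → MatIndep A I → Indep-in (λ _ → act) (I !_)
  to I ind S KS w j _ = trans (cong (_! j) (ind S (λ {x} x∈ → [ !⇒∈ I , (λ ()) ]′ (w x (∈⇒! x∈))) KS)) (!-∅ j)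
  from : ∀ I → Indep-in (λ _ → act) (I !_) → MatIndep A I
  from I ind S S⊆I KS = ∅-intro λ j Sj → true≢false Sj (ind S KS (λ i Si → inj₁ (∈⇒! (S⊆I (!⇒∈ S Si)))) j (∈⇒! (S⊆I (!⇒∈ S Sj))))

theorem1p4 : (G : Graph) (r : ℕ) (A : Fin (nE G) → Vec Bool r) →
    Represents (cycleMatroid G) A →
    ((∀ (X : Subset (nE G)) → 2 ≤ ∣ X ∣ → BinaryGammoid (splitting A X))
    ⇔ (∀ (i : Fin 4) → ¬ HasMinor (cycleMatroid (Q i)) (cycleMatroid G)))
theorem1p4 G r A represents = mk⇔ only-if if
  where
  only-if : (∀ X → 2 ≤ ∣ X ∣ → BinaryGammoid (splitting A X)) → ∀ i → ¬ HasMinor (cycleMatroid (Q i)) (cycleMatroid G)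
  only-if gammoids = λ
    -- Edges 2, 4, 5 are the star of a vertex, which every cycle meets evenly, so this splitting
    -- leaves M(K₄) unchanged.
    { zero → refuted (ends Q₁) (acyclic⇔Q (# 0)) (false ∷ false ∷ true ∷ false ∷ true ∷ true ∷ []) identity (# 2) (# 4) refl refl λ ()
    ; (suc zero) → refuted (ends Q₂) (acyclic⇔Q (# 1)) X σ (# 1) (# 3) refl refl λ ()
    ; (suc (suc zero)) → refuted (ends Q₃) (acyclic⇔Q (# 2)) X σ (# 1) (# 3) refl refl λ ()
    ; (suc (suc (suc zero))) → refuted (ends Q₄) (acyclic⇔Q (# 3)) X
        (permutation (# 0 ∷ # 2 ∷ # 5 ∷ # 4 ∷ # 3 ∷ # 1 ∷ []) (# 0 ∷ # 5 ∷ # 1 ∷ # 4 ∷ # 3 ∷ # 2 ∷ [])) (# 1) (# 3) refl refl λ () }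
    where
    -- One edge of each parallel pair, and the loop in `Q₂` and `Q₃`. The new coordinate makes the
    -- six columns distinct and nonzero in a space of rank 3: the Fano plane without a point, which
    -- is M(K₄).
    X = false ∷ true ∷ false ∷ true ∷ false ∷ true ∷ []
    σ = permutation (# 0 ∷ # 1 ∷ # 4 ∷ # 5 ∷ # 2 ∷ # 3 ∷ []) (# 0 ∷ # 1 ∷ # 4 ∷ # 5 ∷ # 2 ∷ # 3 ∷ [])
    refuted : ∀ {V} (es : Fin 6 → Fin V × Fin V) → (∀ I → (¬ CycleIn (six-edges V es) I) ⇔ MatIndep (incidence (six-edges V es)) I) →
      ∀ X σ → {True (splitsToK₄? V es X σ)} → ∀ a b → X ! a ≡ true → X ! b ≡ true → a ≢ b → ¬ HasMinor (cycleMatroid (six-edges V es)) (cycleMatroid G)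
    refuted es acyclic X σ {w} a b Xa Xb a≢b = minor⇒not-gammoid _ es acyclic X σ (toWitness w) Xa Xb a≢b G A represents gammoids

  if : (∀ i → ¬ HasMinor (cycleMatroid (Q i)) (cycleMatroid G)) → ∀ X → 2 ≤ ∣ X ∣ → BinaryGammoid (splitting A X)
  if no-minor X _ with Representation.decompose (kernel (splitMatrix A X)) (λ _ → act) (<-wellFounded _)
  ... | inj₂ representation = (suc r , splitMatrix A X , λ I → mk⇔ id id) , rep⇒gammoid (splitMatrix A X) representation
  ... | inj₁ minor with K₄-minor⇒Q-minor G A represents X minor
  ...   | i , has = contradiction has (no-minor i)
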